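{- For every $n\ge1$ and every partition $\lambda\vdash n$, $\langle (2n)!\,A_n,s_\lambda\rangle=f^{\rho(\lambda)}$, the number of standard Young tableaux of the skew shape $\rho(\lambda)$.
   Context: $A_n=\frac{1}{(2n)!}\sum_{\lambda\vdash n}|\phi(\lambda)|\,p_\lambda$, where for $\lambda=\langle 1^{m_1},\dots,n^{m_n}\rangle\vdash n$ ($m_k$ parts equal to $k$), $\phi(\lambda)=(2n)!\prod_{k=1}^n\frac{1}{m_k!}\left(\frac{4^k(4^k-1)B_{2k}}{(2k)(2k)!}\right)^{m_k}$ with $B_{2k}$ Bernoulli numbers, and $p_\lambda$ power sums; $\langle\cdot,\cdot\rangle$ is the Hall inner product and $s_\lambda$ the Schur function. For $\lambda\vdash n$ let $\lambda'$ be the conjugate partition and $\ell=\ell(\lambda')$ its number of parts. Then $\rho(\lambda)=\sigma/\tau$ is the skew shape with $\sigma_i=2\lambda'_i+\ell-i$ and $\tau_i=\ell-i$ for $1\le i\le\ell$; equivalently, row $i$ of $\rho(\lambda)$ has length $2\lambda'_i$ and each row begins one square to the left of the row above. (E.g. $\rho(5,3,1,1)=(12,7,6,3,2)/(4,3,2,1)$.) -}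

module Defs where

open import Data.Nat as ℕ using (ℕ; zero; suc; _+_; _*_; _∸_; _^_; _≤_; _<_; _!; _≤ᵇ_; _≤?_)
open import Data.Nat.Combinatorics using (_C_)
open import Data.Integer as ℤ using (ℤ; +_)
open import Data.Rational as ℚ using (ℚ; 0ℚ; 1ℚ)
open import Data.Bool using (Bool; true; false; if_then_else_)
open import Data.Maybe using (Maybe; just; nothing)
open import Data.Product using (Σ; _×_; _,_; proj₁; proj₂)
open import Data.List using (List; []; _∷_; _++_; map; foldr; concat; concatMap; filter; upTo; length; zipWith; zip; replicate)
open import Data.Nat.ListAction using (sum; product)
open import Data.List.Properties using (≡-dec)
open import Data.List.Relation.Unary.All using (All)
open import Data.List.Relation.Unary.Linked using (Linked)
open import Data.List.Relation.Unary.Unique.Propositional using (Unique)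
open import Data.List.Relation.Binary.Pointwise using (Pointwise)
open import Data.List.Relation.Binary.Permutation.Propositional using (_↭_)
open import Data.List.Membership.Propositional using (_∈_)
open import Relation.Nullary using (does)
open import Relation.Binary.PropositionalEquality using (_≡_)

ℕ→ℚ : ℕ → ℚ
ℕ→ℚ n = + n ℚ./ 1

-- q / d  (d ≠ 0 in every use; division by 0 returns 0)
divℕ : ℚ → ℕ → ℚ
divℕ q zero    = 0ℚ
divℕ q (suc d) = q ℚ.* (+ 1 ℚ./ suc d)

sumℚ : List ℚ → ℚ
sumℚ = foldr ℚ._+_ 0ℚ

productℚ : List ℚ → ℚ
productℚ = foldr ℚ._*_ 1ℚ

powℚ : ℚ → ℕ → ℚ
powℚ q zero    = 1ℚ
powℚ q (suc m) = q ℚ.* powℚ q m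

nth : {A : Set} → List A → ℕ → Maybe A
nth []       _       = nothing
nth (x ∷ xs) zero    = just x
nth (x ∷ xs) (suc i) = nth xs i

nthℕ : List ℕ → ℕ → ℕ
nthℕ []       _       = 0
nthℕ (x ∷ xs) zero    = x
nthℕ (x ∷ xs) (suc i) = nthℕ xs i

oneTo : ℕ → List ℕ
oneTo n = map suc (upTo n)

count : ℕ → List ℕ → ℕ
count k xs = length (filter (λ x → k ℕ.≟ x) xs)

HasCard : {A : Set} → (A → Set) → ℕ → Set
HasCard {A} P k =
  Σ (List A) λ xs → Unique xs × All P xs × (∀ x → P x → x ∈ xs) × length xs ≡ k

IsPartition : List ℕ → Set
IsPartition λs = Linked (λ a b → b ≤ a) λs × All (λ a → 1 ≤ a) λs

IsPartitionOf : ℕ → List ℕ → Set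
IsPartitionOf n λs = IsPartition λs × sum λs ≡ n

-- partitions of n with all parts ≤ m (fuel f ≥ n), parts in decreasing order
partsB : ℕ → ℕ → ℕ → List (List ℕ)
partsB _       zero    _ = [] ∷ []
partsB zero    (suc n) _ = []
partsB (suc f) (suc n) m =
  concatMap (λ k → map (k ∷_) (partsB f (suc n ∸ k) k))
            (filter (λ k → k ≤? m) (oneTo (suc n)))

partitions : ℕ → List (List ℕ)
partitions n = partsB n n n

mult : List ℕ → ℕ → ℕ
mult μ k = count k μ

zee : List ℕ → ℕ
zee μ = product (map (λ k → k ^ mult μ k * (mult μ k) !) (oneTo (sum μ)))

insD : ℕ → List ℕ → List ℕ
insD x []       = x ∷ []
insD x (y ∷ ys) = if y ≤ᵇ x then x ∷ y ∷ ys else y ∷ insD x ys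

sortD : List ℕ → List ℕ
sortD = foldr insD []

-- Symmetric functions over ℚ, written in the power-sum basis:
-- a formal finite sum  Σ c_i p_{μ_i}  is a list of pairs (c_i , μ_i).

SymFun : Set
SymFun = List (ℚ × List ℕ)

PosIndexed : SymFun → Set
PosIndexed G = All (λ t → All (λ a → 1 ≤ a) (proj₂ t)) G

hallP : List ℕ → List ℕ → ℚ
hallP μ ν = if does (≡-dec ℕ._≟_ (sortD μ) (sortD ν)) then ℕ→ℚ (zee μ) else 0ℚ

⟨_,_⟩ : SymFun → SymFun → ℚ
⟨ F , G ⟩ = sumℚ (map (λ s → sumℚ (map (λ t →
              proj₁ s ℚ.* proj₁ t ℚ.* hallP (proj₂ s) (proj₂ t)) G)) F)

subAt : ℕ → ℕ → List ℕ → List ℕ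
subAt _       _ []       = []
subAt zero    k (a ∷ as) = (a ∸ k) ∷ as
subAt (suc i) k (a ∷ as) = a ∷ subAt i k as

allZero : List ℕ → Bool
allZero []           = true
allZero (zero ∷ as)  = allZero as
allZero (suc _ ∷ as) = false

-- coefficient of x^α in p_μ(x_1,…,x_N), N = length α
pCoeff : List ℕ → List ℕ → ℕ
pCoeff []      α = if allZero α then 1 else 0
pCoeff (k ∷ μ) α =
  sum (map (λ i → if k ≤ᵇ nthℕ α i then pCoeff μ (subAt i k α) else 0) (upTo (length α)))

monoCoeff : SymFun → List ℕ → ℚ
monoCoeff G α = sumℚ (map (λ t → proj₁ t ℚ.* ℕ→ℚ (pCoeff (proj₂ t) α)) G)

-- Tableaux. A filling of a skew shape σ/τ (σ, τ lists of equal length)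
-- is a list of rows; row i lists the entries in columns τ_i, …, σ_i − 1
-- (columns 0-based, English convention).

Filling : Set
Filling = List (List ℕ)

entry : List ℕ → Filling → ℕ → ℕ → Maybe ℕ
entry τ T i j with nth T i
... | nothing  = nothing
... | just row = if nthℕ τ i ≤ᵇ j then nth row (j ∸ nthℕ τ i) else nothing

RowLengths : List ℕ → List ℕ → Filling → Set
RowLengths σ τ T = Pointwise (λ row st → length row ≡ proj₁ st ∸ proj₂ st) T (zip σ τ)

ColumnsStrict : List ℕ → Filling → Set
ColumnsStrict τ T = ∀ i j a b → entry τ T i j ≡ just a → entry τ T (suc i) j ≡ just b → a < b

IsSYT : List ℕ → List ℕ → Filling → Set
IsSYT σ τ T =
  RowLengths σ τ T ×
  All (Linked _<_) T ×
  ColumnsStrict τ T ×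
  concat T ↭ oneTo (length (concat T))

NumSYT : List ℕ → List ℕ → ℕ → Set
NumSYT σ τ k = HasCard (IsSYT σ τ) k

IsSSYT : List ℕ → List ℕ → Filling → Set
IsSSYT λs α T =
  RowLengths λs (replicate (length λs) 0) T ×
  All (Linked _≤_) T ×
  ColumnsStrict (replicate (length λs) 0) T ×
  All (All (λ x → 1 ≤ x × x ≤ length α)) T ×
  map (λ k → count k (concat T)) (oneTo (length α)) ≡ α

-- G (a formal p-sum with positive parts) restricted to N variables equals
-- the Schur polynomial s_λ(x_1,…,x_N) = Σ_{T SSYT of shape λ} x^T.
-- For N ≥ |λ| this determines G in degrees ≤ N, i.e. G = s_λ there.
IsSchurIn : ℕ → List ℕ → SymFun → Set
IsSchurIn N λs G =
  PosIndexed G ×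
  (∀ α → length α ≡ N → Σ ℕ λ k → HasCard (IsSSYT λs α) k × monoCoeff G α ≡ ℕ→ℚ k)

-- Bernoulli numbers: B_0 = 1, Σ_{j=0}^{m} C(m+1,j) B_j = 0 for m ≥ 1

bernoulliUpTo : ℕ → List ℚ
bernoulliUpTo zero    = 1ℚ ∷ []
bernoulliUpTo (suc m) =
  bernoulliUpTo m ++
  (ℚ.- divℕ (sumℚ (zipWith (λ j b → ℕ→ℚ (suc (suc m) C j) ℚ.* b) (upTo (suc m)) (bernoulliUpTo m)))
            (suc (suc m))) ∷ []

bernoulli : ℕ → ℚ
bernoulli m with nth (bernoulliUpTo m) m
... | just b  = b
... | nothing = 0ℚ

tanCoeff : ℕ → ℚ
tanCoeff k = divℕ (ℕ→ℚ (4 ^ k * (4 ^ k ∸ 1)) ℚ.* bernoulli (2 * k)) (2 * k * (2 * k) !)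

φ : ℕ → List ℕ → ℚ
φ n μ = ℕ→ℚ ((2 * n) !) ℚ.*
        productℚ (map (λ k → divℕ (powℚ (tanCoeff k) (mult μ k)) ((mult μ k) !)) (oneTo n))

scaledA : ℕ → SymFun
scaledA n = map (λ μ → (ℚ.∣ φ n μ ∣ , μ)) (partitions n)

conjugate : List ℕ → List ℕ
conjugate λs = map (λ i → length (filter (λ a → i ≤? a) λs)) (oneTo (nthℕ λs 0))

-- σ_i = 2 λ'_i + ℓ − i  (i = 1..ℓ, ℓ = ℓ(λ'))
rhoOuter : List ℕ → List ℕ
rhoOuter λs = map (λ i → 2 * nthℕ (conjugate λs) i + (ℓ ∸ suc i)) (upTo ℓ)
  where ℓ = length (conjugate λs)

rhoInner : List ℕ → List ℕ
rhoInner λs = map (λ i → ℓ ∸ suc i) (upTo ℓ)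
  where ℓ = length (conjugate λs)

{-# OPTIONS --safe #-}

-- Let θ be the ring homomorphism from symmetric functions to ℚ with ⟨(2n)! A_n, G⟩ = (2n)! θ(G) for G
-- of degree n. As Σ_k 4^k (4^k − 1) |B_{2k}| / (2k (2k)!) x^{2k} = −log cos x, Newton's identities give
-- θ(e_m) = 1 / (2m)!. Take for s_λ the dual Jacobi–Trudi determinant det(e_{s_i − t_j}), where the s_i
-- and t_j are the shifted column lengths of λ and of the empty shape. Removing the entries 1 from a
-- tableau makes the inner shape grow by a horizontal strip. In shifted coordinates this raises some t_j
-- by one, and the steps that leave the set of shapes produce a determinant with two equal rows or with a
-- zero row; so the determinants obey the recursion of the tableau numbers. This applies with column
-- lengths to semistandard tableaux of shape λ, and with row lengths to standard tableaux of shape ρ(λ),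
-- whose shifted row lengths are 2 s_i and 2 t_j. Hence both counts come from the same determinant, with
-- e_m replaced by x^{2m} / (2m)! in the second case, and this replacement is θ.

module Submission where

open import Defs
open import Data.Bool using (Bool; true; false; T; not; _xor_; if_then_else_)
import Data.Bool.Properties as Boolₚ
open import Data.Empty using (⊥-elim)
open import Data.Integer as ℤ using (ℤ)
import Data.Integer.Properties as ℤₚ
open import Data.List using (List; []; _∷_; [_]; _++_; applyUpTo; concat; filter; length; map; replicate; reverse; upTo; zip; zipWith)
open import Data.List.Membership.Propositional using (_∈_; find; lose)
open import Data.List.Membership.Propositional.Properties
open import Data.List.Properties using (++-assoc; ++-identityʳ; applyUpTo-∷ʳ; filter-++; filter-accept; filter-reject; length-++; length-applyUpTo; length-map; length-replicate; map-++; map-applyUpTo; map-cong; map-id; map-upTo; map-∘; reverse-++; reverse-injective; unfold-reverse; ∷-injective; ∷-injectiveʳ; ∷-injectiveˡ; ≡-dec)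
open import Data.List.Relation.Binary.Permutation.Propositional using (_↭_; prep; ↭-refl; ↭-sym; ↭-trans)
open import Data.List.Relation.Binary.Permutation.Propositional.Properties using (All-resp-↭; filter-↭; shift; ↭-length; ↭-reverse)
open import Data.List.Relation.Binary.Pointwise using (Pointwise; []; _∷_)
open import Data.List.Relation.Unary.All as All using (All; []; _∷_)
import Data.List.Relation.Unary.All.Properties as Allₚ
open import Data.List.Relation.Unary.AllPairs as AllPairs using (AllPairs; []; _∷_)
import Data.List.Relation.Unary.AllPairs.Properties as AllPairsₚ
open import Data.List.Relation.Unary.Any using (here; there)
open import Data.List.Relation.Unary.Linked as Linked using (Linked; []; [-]; _∷_)
import Data.List.Relation.Unary.Linked.Properties as Linkedₚ
open import Data.List.Relation.Unary.Unique.Propositional using (Unique)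
import Data.List.Relation.Unary.Unique.Propositional.Properties as Uniqueₚ
open import Data.Maybe using (Maybe; just; nothing)
open import Data.Nat as ℕ using (ℕ; zero; suc; _!; _<_; _>_; _^_; _≤_; _≤?_; _≤ᵇ_; _∸_; s≤s; z≤n)
open import Data.Nat.Combinatorics using (_C_; k![n∸k]!∣n!; k>n⇒nCk≡0; nC1≡n; nCk+nC[k+1]≡[n+1]C[k+1]; nCk≡nC[n∸k]; nCk≡n!/k![n-k]!; nCn≡1)
open import Data.Nat.DivMod using (m/n*n≡m)
open import Data.Nat.ListAction using (product; sum)
open import Data.Nat.ListAction.Properties using (sum-++)
import Data.Nat.Properties as ℕₚ
open import Data.Nat.Solver using (module +-*-Solver)
open import Data.Product using (Σ; ∃; _×_; _,_; proj₁; proj₂)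
open import Data.Rational using (ℚ; 0ℚ; 1ℚ; _+_; _*_; _-_; -_; ∣_∣; _/_; toℚᵘ)
import Data.Rational.Properties as ℚₚ
open import Data.Rational.Unnormalised as ℚᵘ using (mkℚᵘ; *≡*)
import Data.Rational.Unnormalised.Properties as ℚᵘₚ
open import Data.Sum using (_⊎_; inj₁; inj₂)
open import Data.Unit using (⊤; tt)
open import Function using (_∘_)
open import Level using (0ℓ)
open import Relation.Binary using (tri<; tri≈; tri>)
open import Relation.Binary.PropositionalEquality hiding ([_])
open import Relation.Nullary using (¬_; Dec; yes; no; does)
open import Relation.Nullary.Decidable using (dec-false; dec-true; dec⇒maybe)
open import Tactic.RingSolver using (solve-∀)
open import Tactic.RingSolver.Core.AlmostCommutativeRing using (AlmostCommutativeRing; fromCommutativeRing)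

-- No ring of symmetric functions is constructed. A formal power-sum expansion is only read through
-- linear functionals: the coefficients of the monomials x^α and the Hall pairing with `scaledA n`.
-- Each functional has to turn multiplication by e_m into an operator of its own, so the determinant
-- has operators as entries, and a relation between two models is carried through its expansion.
-- Multiplication by e_m on power-sum lists is defined by Newton's recursions and not by a closed
-- formula in the p_μ; a functional is then compatible with it as soon as its operators satisfy the
-- same recursions. The absolute values in A_n are the arithmetic obstacle. The Bernoulli recurrence
-- yields x tanh x, whose coefficients alternate in sign. The powers of tanh and of tan have
-- derivatives at 0 given by the same recursion up to signs, and for tan it stays within the natural
-- numbers; comparing the two gives the sign and the absolute value together. The replacement of e_m
-- by x^m / m! is the restriction to contents with entries 0 and 1.

ℚ-ring : AlmostCommutativeRing 0ℓ 0ℓ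
ℚ-ring = fromCommutativeRing ℚₚ.+-*-commutativeRing (λ x → dec⇒maybe (0ℚ ℚₚ.≟ x))

+-interchange : ∀ a b c d → (a + b) + (c + d) ≡ (a + c) + (b + d)
+-interchange = solve-∀ ℚ-ring

*-interchange : ∀ a b c d → (a * b) * (c * d) ≡ (a * c) * (b * d)
*-interchange = solve-∀ ℚ-ring

private
  via-ℚᵘ : ∀ n → toℚᵘ (ℕ→ℚ n) ℚᵘ.≃ mkℚᵘ (ℤ.+ n) 0
  via-ℚᵘ n = ℚₚ.toℚᵘ-fromℚᵘ (mkℚᵘ (ℤ.+ n) 0)

ℕ→ℚ-+ : ∀ m n → ℕ→ℚ (m ℕ.+ n) ≡ ℕ→ℚ m + ℕ→ℚ n
ℕ→ℚ-+ m n = ℚₚ.toℚᵘ-injective (begin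
  toℚᵘ (ℕ→ℚ (m ℕ.+ n)) ≈⟨ via-ℚᵘ (m ℕ.+ n) ⟩
  mkℚᵘ (ℤ.+ (m ℕ.+ n)) 0 ≈⟨ *≡* (cong (ℤ._* (ℤ.+ 1)) (sym (cong₂ ℤ._+_ (ℤₚ.*-identityʳ (ℤ.+ m)) (ℤₚ.*-identityʳ (ℤ.+ n))))) ⟩
  mkℚᵘ (ℤ.+ m) 0 ℚᵘ.+ mkℚᵘ (ℤ.+ n) 0 ≈⟨ ℚᵘₚ.+-cong (via-ℚᵘ m) (via-ℚᵘ n) ⟨
  toℚᵘ (ℕ→ℚ m) ℚᵘ.+ toℚᵘ (ℕ→ℚ n) ≈⟨ ℚₚ.toℚᵘ-homo-+ (ℕ→ℚ m) (ℕ→ℚ n) ⟨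
  toℚᵘ (ℕ→ℚ m + ℕ→ℚ n) ∎)
  where open ℚᵘₚ.≃-Reasoning

ℕ→ℚ-* : ∀ m n → ℕ→ℚ (m ℕ.* n) ≡ ℕ→ℚ m * ℕ→ℚ n
ℕ→ℚ-* m n = ℚₚ.toℚᵘ-injective (begin
  toℚᵘ (ℕ→ℚ (m ℕ.* n)) ≈⟨ via-ℚᵘ (m ℕ.* n) ⟩
  mkℚᵘ (ℤ.+ (m ℕ.* n)) 0 ≈⟨ *≡* (cong (ℤ._* (ℤ.+ 1)) (ℤₚ.pos-* m n)) ⟩
  mkℚᵘ (ℤ.+ m) 0 ℚᵘ.* mkℚᵘ (ℤ.+ n) 0 ≈⟨ ℚᵘₚ.*-cong (via-ℚᵘ m) (via-ℚᵘ n) ⟨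
  toℚᵘ (ℕ→ℚ m) ℚᵘ.* toℚᵘ (ℕ→ℚ n) ≈⟨ ℚₚ.toℚᵘ-homo-* (ℕ→ℚ m) (ℕ→ℚ n) ⟨
  toℚᵘ (ℕ→ℚ m * ℕ→ℚ n) ∎)
  where open ℚᵘₚ.≃-Reasoning

ℕ→ℚ-suc : ∀ n → ℕ→ℚ (suc n) ≡ 1ℚ + ℕ→ℚ n
ℕ→ℚ-suc = ℕ→ℚ-+ 1

1/suc : ℕ → ℚ
1/suc d = ℤ.+ 1 / suc d

*-1/suc : ∀ d → ℕ→ℚ (suc d) * (ℤ.+ 1 / suc d) ≡ 1ℚ
*-1/suc d = ℚₚ.toℚᵘ-injective (begin
  toℚᵘ (ℕ→ℚ (suc d) * (ℤ.+ 1 / suc d)) ≈⟨ ℚₚ.toℚᵘ-homo-* (ℕ→ℚ (suc d)) (ℤ.+ 1 / suc d) ⟩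
  toℚᵘ (ℕ→ℚ (suc d)) ℚᵘ.* toℚᵘ (ℤ.+ 1 / suc d) ≈⟨ ℚᵘₚ.*-cong (via-ℚᵘ (suc d)) (ℚₚ.toℚᵘ-fromℚᵘ (mkℚᵘ (ℤ.+ 1) d)) ⟩
  mkℚᵘ (ℤ.+ suc d) 0 ℚᵘ.* mkℚᵘ (ℤ.+ 1) d ≈⟨ *≡* (cong ℤ.+_ (cong suc (eq d))) ⟩
  toℚᵘ 1ℚ ∎)
  where
  open ℚᵘₚ.≃-Reasoning
  eq : ∀ d → (d ℕ.* 1) ℕ.* 1 ≡ (d ℕ.+ 0) ℕ.+ 0
  eq d = trans (ℕₚ.*-identityʳ _) (trans (ℕₚ.*-identityʳ d) (sym (trans (ℕₚ.+-identityʳ _) (ℕₚ.+-identityʳ d))))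

*-cancelˡ-suc : ∀ d {x y} → ℕ→ℚ (suc d) * x ≡ ℕ→ℚ (suc d) * y → x ≡ y
*-cancelˡ-suc d {x} {y} eq = begin
  x ≡⟨ unit x ⟨
  r * (ℕ→ℚ (suc d) * x) ≡⟨ cong (r *_) eq ⟩
  r * (ℕ→ℚ (suc d) * y) ≡⟨ unit y ⟩
  y ∎
  where
  open ≡-Reasoning
  r = ℤ.+ 1 / suc d
  assoc : ∀ r n x → r * (n * x) ≡ (n * r) * x
  assoc = solve-∀ ℚ-ring
  unit : ∀ x → r * (ℕ→ℚ (suc d) * x) ≡ x
  unit x = trans (assoc r (ℕ→ℚ (suc d)) x) (trans (cong (_* x) (*-1/suc d)) (ℚₚ.*-identityˡ x))

divℕ-* : ∀ q d → .{{_ : ℕ.NonZero d}} → divℕ q d * ℕ→ℚ d ≡ q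
divℕ-* q (suc d) = trans (assoc q (ℤ.+ 1 / suc d) (ℕ→ℚ (suc d)))
  (trans (cong (q *_) (*-1/suc d)) (ℚₚ.*-identityʳ q))
  where
  assoc : ∀ q r n → (q * r) * n ≡ q * (n * r)
  assoc = solve-∀ ℚ-ring

open ≡-Reasoning

-- Determinants and alternating functions

-- The operations of a Laplace expansion whose entries act on minors. No laws are demanded, so
-- power-sum lists, on which ring laws fail as equalities of lists, are a model next to coefficient
-- functions.
record Pairing (M : Set) : Set where
  infixl 6 _⊖_
  field
    0# 1# : M
    _⊖_   : M → M → M
    op    : ℕ → M → M

module Laplace {M : Set} (A : Pairing M) where
  open Pairing A

  -- The matrix entry e_{c-t}. Both indices are lowered together, so a negative difference ends in
  -- the clause with value 0.
  ent : ℕ → ℕ → M → M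
  ent zero    c       x = op c x
  ent (suc t) zero    x = 0#
  ent (suc t) (suc c) x = ent t c x

  -- Laplace expansion along one row. `f` is the complementary minor as a function of the columns
  -- that remain, and the nested differences produce the signs.
  ∂ : ℕ → (List ℕ → M) → List ℕ → M
  ∂ t f [] = 0#
  ∂ t f (c ∷ cs) = ent t c (f cs) ⊖ ∂ t (λ xs → f (c ∷ xs)) cs

  det : List ℕ → List ℕ → M
  det []       [] = 1#
  det []       (_ ∷ _) = 0#
  det (t ∷ ts) cs = ∂ t (det ts) cs

module _ {M N : Set} (A : Pairing M) (B : Pairing N) (R : M → N → Set) (g : ℕ → ℕ) where
  private
    module A = Pairing A
    module B = Pairing B
    module LA = Laplace A
    module LB = Laplace B

  -- A relation instead of a homomorphism serves three purposes: evaluation of power-sum lists, an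
  -- equality restricted to certain contents with all indices doubled by `g`, and, with one side
  -- ignored, positivity of the indices.
  det-rel : R A.0# B.0# → R A.1# B.1# →
            (∀ x y x′ y′ → R x y → R x′ y′ → R (x A.⊖ x′) (y B.⊖ y′)) →
            (∀ t c x y → R x y → R (LA.ent t c x) (LB.ent (g t) (g c) y)) →
            ∀ ts cs → R (LA.det ts cs) (LB.det (map g ts) (map g cs))
  det-rel r0 r1 r⊖ rent = go
    where
    ∂-rel : ∀ t {f h} → (∀ xs → R (f xs) (h (map g xs))) →
            ∀ cs → R (LA.∂ t f cs) (LB.∂ (g t) h (map g cs))
    ∂-rel t fh [] = r0
    ∂-rel t fh (c ∷ cs) = r⊖ _ _ _ _ (rent t c _ _ (fh cs)) (∂-rel t (λ xs → fh (c ∷ xs)) cs)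
    go : ∀ ts cs → R (LA.det ts cs) (LB.det (map g ts) (map g cs))
    go []       [] = r1
    go []       (_ ∷ _) = r0
    go (t ∷ ts) cs = ∂-rel t (go ts) cs

Content : Set
Content = List ℕ → ℚ

_⟨_⟩ : Content → ℕ → Content
(f ⟨ a ⟩) β = f (a ∷ β)

down : Content → ℕ → Content
down f zero    β = 0ℚ
down f (suc a) β = f (a ∷ β)

-- Multiplication by e_m, acting on the coefficients α ↦ [x^α] of a power series.
E : ℕ → Content → Content
E zero    f α = f α
E (suc m) f [] = 0ℚ
E (suc m) f (a ∷ α) = E (suc m) (f ⟨ a ⟩) α + E m (down f a) α

elementary : Pairing Content
elementary = record
  { 0# = λ _ → 0ℚ
  ; 1# = λ α → if allZero α then 1ℚ else 0ℚ
  ; _⊖_ = λ f g α → f α - g α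
  ; op = E
  }

open Laplace elementary

-- Abstracts over sum and difference, so that additivity of `E`, `ent` and `∂` is shown once: the
-- difference comes from the row expansion, the sum from splitting off a variable.
record Linear (_⊙_ : ℚ → ℚ → ℚ) : Set where
  field
    0⊙0   : 0ℚ ⊙ 0ℚ ≡ 0ℚ
    +-⊙   : ∀ a b c d → (a ⊙ b) + (c ⊙ d) ≡ (a + c) ⊙ (b + d)
    minus-⊙ : ∀ a b c d → (a ⊙ b) - (c ⊙ d) ≡ (a - c) ⊙ (b - d)

+-linear : Linear _+_
+-linear = record { 0⊙0 = refl ; +-⊙ = +-interchange ; minus-⊙ = solve-∀ ℚ-ring }

minus-linear : Linear _-_
minus-linear = record { 0⊙0 = refl ; +-⊙ = solve-∀ ℚ-ring ; minus-⊙ = solve-∀ ℚ-ring }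

0-0 : ∀ {x y} → x ≡ 0ℚ → y ≡ 0ℚ → x - y ≡ 0ℚ
0-0 refl refl = refl

0+0 : ∀ {x y} → x ≡ 0ℚ → y ≡ 0ℚ → x + y ≡ 0ℚ
0+0 refl refl = refl

down-cong : ∀ {f g : Content} → f ≗ g → ∀ a → down f a ≗ down g a
down-cong f≗g zero    β = refl
down-cong f≗g (suc a) β = f≗g (a ∷ β)

E-cong : ∀ m {f g} → f ≗ g → E m f ≗ E m g
E-cong zero    f≗g α = f≗g α
E-cong (suc m) f≗g [] = refl
E-cong (suc m) f≗g (a ∷ α) =
  cong₂ _+_ (E-cong (suc m) (λ β → f≗g (a ∷ β)) α) (E-cong m (down-cong f≗g a) α)

E-0 : ∀ m α → E m (λ _ → 0ℚ) α ≡ 0ℚ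
E-0 zero    α = refl
E-0 (suc m) [] = refl
E-0 (suc m) (a ∷ α) =
  0+0 (E-0 (suc m) α) (trans (E-cong m (down-0 a) α) (E-0 m α))
  where
  down-0 : ∀ a → down (λ _ → 0ℚ) a ≗ (λ _ → 0ℚ)
  down-0 zero    _ = refl
  down-0 (suc _) _ = refl

E-[] : ∀ m {f} → f [] ≡ 0ℚ → E m f [] ≡ 0ℚ
E-[] zero    f0 = f0
E-[] (suc m) f0 = refl

module _ {_⊙_} (lin : Linear _⊙_) where
  open Linear lin

  E-⊙ : ∀ m f g α → E m (λ β → f β ⊙ g β) α ≡ E m f α ⊙ E m g α
  E-⊙ zero    f g α = refl
  E-⊙ (suc m) f g [] = sym 0⊙0
  E-⊙ (suc m) f g (a ∷ α) =
    trans (cong₂ _+_ (E-⊙ (suc m) (f ⟨ a ⟩) (g ⟨ a ⟩) α)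
                     (trans (E-cong m (down-⊙ a) α) (E-⊙ m (down f a) (down g a) α)))
          (+-⊙ (E (suc m) (f ⟨ a ⟩) α) _ _ _)
    where
    down-⊙ : ∀ a → down (λ β → f β ⊙ g β) a ≗ (λ β → down f a β ⊙ down g a β)
    down-⊙ zero    _ = sym 0⊙0
    down-⊙ (suc a) _ = refl

-- Commuting entries are what makes a determinant with two equal rows vanish. Expanding both
-- operators at the first exponent gives four terms, of which the middle two are exchanged; at
-- exponent 0 the terms with `down` drop out.
E-comm : ∀ m n f α → E m (E n f) α ≡ E n (E m f) α
E-comm zero    n       f α  = refl
E-comm (suc m) zero    f α  = refl
E-comm (suc m) (suc n) f [] = refl
E-comm (suc m) (suc n) f (zero ∷ α) =
  cong₂ _+_ (half m n) (trans (E-0 m α) (sym (E-0 n α)))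
  where
  expand : ∀ m n → E (suc m) (λ β → E (suc n) f (0 ∷ β)) α ≡ E (suc m) (E (suc n) (f ⟨ 0 ⟩)) α
  expand m n = trans (E-⊙ +-linear (suc m) (E (suc n) (f ⟨ 0 ⟩)) (E n (down f 0)) α)
    (trans (cong (E (suc m) (E (suc n) (f ⟨ 0 ⟩)) α +_)
             (trans (E-cong (suc m) (E-0 n) α) (E-0 (suc m) α)))
           (ℚₚ.+-identityʳ _))
  half : ∀ m n → E (suc m) (λ β → E (suc n) f (0 ∷ β)) α ≡ E (suc n) (λ β → E (suc m) f (0 ∷ β)) α
  half m n = trans (expand m n) (trans (E-comm (suc m) (suc n) (f ⟨ 0 ⟩) α) (sym (expand n m)))
E-comm (suc m) (suc n) f (suc a ∷ α) =
  trans (expand m n) (trans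
    (trans (cong₂ _+_ (cong₂ _+_ (E-comm (suc m) (suc n) (f ⟨ suc a ⟩) α) (E-comm (suc m) n (f ⟨ a ⟩) α))
                      (cong₂ _+_ (E-comm m (suc n) (f ⟨ a ⟩) α) (E-comm m n (down f a) α)))
           (+-interchange (E (suc n) (E (suc m) (f ⟨ suc a ⟩)) α) _ _ _))
    (sym (expand n m)))
  where
  expand : ∀ m n → E (suc m) (E (suc n) f) (suc a ∷ α) ≡
           (E (suc m) (E (suc n) (f ⟨ suc a ⟩)) α + E (suc m) (E n (f ⟨ a ⟩)) α) +
           (E m (E (suc n) (f ⟨ a ⟩)) α + E m (E n (down f a)) α)
  expand m n = cong₂ _+_
    (E-⊙ +-linear (suc m) (E (suc n) (f ⟨ suc a ⟩)) (E n (f ⟨ a ⟩)) α)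
    (E-⊙ +-linear m (E (suc n) (f ⟨ a ⟩)) (E n (down f a)) α)

ent-cong : ∀ t c {f g} → f ≗ g → ent t c f ≗ ent t c g
ent-cong zero    c = E-cong c
ent-cong (suc t) zero    _ _ = refl
ent-cong (suc t) (suc c) = ent-cong t c

ent-0 : ∀ t c α → ent t c (λ _ → 0ℚ) α ≡ 0ℚ
ent-0 zero    c = E-0 c
ent-0 (suc t) zero    _ = refl
ent-0 (suc t) (suc c) = ent-0 t c

ent-[] : ∀ t c {f} → f [] ≡ 0ℚ → ent t c f [] ≡ 0ℚ
ent-[] zero    c       f0 = E-[] c f0
ent-[] (suc t) zero    f0 = refl
ent-[] (suc t) (suc c) f0 = ent-[] t c f0

ent-⊙ : ∀ {_⊙_} → Linear _⊙_ → ∀ t c f g α → ent t c (λ β → f β ⊙ g β) α ≡ ent t c f α ⊙ ent t c g α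
ent-⊙ lin zero    c = E-⊙ lin c
ent-⊙ lin (suc t) zero    _ _ _ = sym (Linear.0⊙0 lin)
ent-⊙ lin (suc t) (suc c) = ent-⊙ lin t c

ent-E : ∀ t c m f α → ent t c (E m f) α ≡ E m (ent t c f) α
ent-E zero    c       m f α = E-comm c m f α
ent-E (suc t) zero    m f α = sym (E-0 m α)
ent-E (suc t) (suc c) m f α = ent-E t c m f α

ent-comm : ∀ t c t′ c′ f α → ent t c (ent t′ c′ f) α ≡ ent t′ c′ (ent t c f) α
ent-comm t c zero     c′       f α = ent-E t c c′ f α
ent-comm t c (suc t′) zero     f α = ent-0 t c α
ent-comm t c (suc t′) (suc c′) f α = ent-comm t c t′ c′ f α

ent-< : ∀ {t c} f α → c < t → ent t c f α ≡ 0ℚ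
ent-< {suc t} {zero}  f α _ = refl
ent-< {suc t} {suc c} f α (ℕ.s≤s c<t) = ent-< f α c<t

ent-≡[] : ∀ t f → ent t t f [] ≡ f []
ent-≡[] zero    f = refl
ent-≡[] (suc t) f = ent-≡[] t f

ent-≢[] : ∀ t c f → t ≢ c → ent t c f [] ≡ 0ℚ
ent-≢[] zero    zero    f t≢c = ⊥-elim (t≢c refl)
ent-≢[] zero    (suc c) f t≢c = refl
ent-≢[] (suc t) zero    f t≢c = refl
ent-≢[] (suc t) (suc c) f t≢c = ent-≢[] t c f (λ p → t≢c (cong suc p))

-- With one variable x split off, e_{c-t} becomes e_{c-t} + x e_{c-t-1}, and the second index
-- belongs to the row `suc t`. This is how removing a letter comes to raise a row coordinate.
ent-step : ∀ t c g k β → ent t c g (k ∷ β) ≡ ent t c (g ⟨ k ⟩) β + ent (suc t) c (down g k) β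
ent-step zero    zero    g k β = sym (ℚₚ.+-identityʳ _)
ent-step zero    (suc c) g k β = refl
ent-step (suc t) zero    g k β = refl
ent-step (suc t) (suc c) g k β = ent-step t c g k β

∂-cong : ∀ t {f g} → (∀ xs → f xs ≗ g xs) → ∀ cs → ∂ t f cs ≗ ∂ t g cs
∂-cong t f≗g []       α = refl
∂-cong t f≗g (c ∷ cs) α =
  cong₂ _-_ (ent-cong t c (f≗g cs) α) (∂-cong t (λ xs → f≗g (c ∷ xs)) cs α)

∂-0 : ∀ t cs α → ∂ t (λ _ _ → 0ℚ) cs α ≡ 0ℚ
∂-0 t []       α = refl
∂-0 t (c ∷ cs) α = 0-0 (ent-0 t c α) (∂-0 t cs α)

∂-[] : ∀ t {f} → (∀ xs → f xs [] ≡ 0ℚ) → ∀ cs → ∂ t f cs [] ≡ 0ℚ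
∂-[] t f0 [] = refl
∂-[] t f0 (c ∷ cs) = 0-0 (ent-[] t c (f0 cs)) (∂-[] t (λ xs → f0 (c ∷ xs)) cs)

∂-≢[] : ∀ t f cs → All (t ≢_) cs → ∂ t f cs [] ≡ 0ℚ
∂-≢[] t f []       [] = refl
∂-≢[] t f (c ∷ cs) (p ∷ ps) = 0-0 (ent-≢[] t c (f cs) p) (∂-≢[] t _ cs ps)

∂-< : ∀ t f cs α → All (_< t) cs → ∂ t f cs α ≡ 0ℚ
∂-< t f []       α [] = refl
∂-< t f (c ∷ cs) α (p ∷ ps) = 0-0 (ent-< (f cs) α p) (∂-< t _ cs α ps)

∂-⊙ : ∀ {_⊙_} → Linear _⊙_ → ∀ t f g cs α →
      ∂ t (λ xs β → f xs β ⊙ g xs β) cs α ≡ ∂ t f cs α ⊙ ∂ t g cs α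
∂-⊙ lin t f g []       α = sym (Linear.0⊙0 lin)
∂-⊙ lin t f g (c ∷ cs) α =
  trans (cong₂ _-_ (ent-⊙ lin t c (f cs) (g cs) α) (∂-⊙ lin t (λ xs → f (c ∷ xs)) (λ xs → g (c ∷ xs)) cs α))
        (Linear.minus-⊙ lin (ent t c (f cs) α) _ _ _)

∂-step : ∀ t f cs k β → ∂ t f cs (k ∷ β) ≡
         ∂ t (λ xs → f xs ⟨ k ⟩) cs β + ∂ (suc t) (λ xs → down (f xs) k) cs β
∂-step t f []       k β = refl
∂-step t f (c ∷ cs) k β =
  trans (cong₂ _-_ (ent-step t c (f cs) k β) (∂-step t (λ xs → f (c ∷ xs)) cs k β))
        (Linear.minus-⊙ +-linear (ent t c (f cs ⟨ k ⟩) β) _ _ _)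

∂-ent : ∀ t t′ c f cs α → ∂ t (λ xs → ent t′ c (f xs)) cs α ≡ ent t′ c (∂ t f cs) α
∂-ent t t′ c f []        α = sym (ent-0 t′ c α)
∂-ent t t′ c f (c′ ∷ cs) α =
  trans (cong₂ _-_ (ent-comm t c′ t′ c (f cs) α) (∂-ent t t′ c (λ xs → f (c′ ∷ xs)) cs α))
        (sym (ent-⊙ minus-linear t′ c (ent t c′ (f cs)) _ α))

-- The terms in which the outer row uses the first column cancel those in which the inner row uses
-- it, because entries commute; what is left is the same double expansion over fewer columns.
∂∂≡0 : ∀ t f cs α → ∂ t (∂ t f) cs α ≡ 0ℚ
∂∂≡0 t f []       α = refl
∂∂≡0 t f (c ∷ cs) α = begin
  ent t c (∂ t f cs) α - ∂ t (λ xs → ∂ t f (c ∷ xs)) cs α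
    ≡⟨ cong (_-_ x) (∂-⊙ minus-linear t (λ xs → ent t c (f xs)) _ cs α) ⟩
  x - (∂ t (λ xs → ent t c (f xs)) cs α - ∂ t (∂ t (λ xs → f (c ∷ xs))) cs α)
    ≡⟨ cong (_-_ x) (cong₂ _-_ (∂-ent t t c f cs α) (∂∂≡0 t (λ xs → f (c ∷ xs)) cs α)) ⟩
  x - (x - 0ℚ)
    ≡⟨ cancel x ⟩
  0ℚ ∎
  where
  x = ent t c (∂ t f cs) α
  cancel : ∀ x → x - (x - 0ℚ) ≡ 0ℚ
  cancel = solve-∀ ℚ-ring

-- Stated for equal neighbours because in a strictly monotone list an entry that changes by one can
-- only collide with the next one.
record Alternating (F : List ℕ → ℚ) : Set where
  constructor alternating
  field repeated : ∀ xs x ys → F (xs ++ x ∷ x ∷ ys) ≡ 0ℚ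

open Alternating

det-alternating : ∀ cs α → Alternating (λ ts → det ts cs α)
det-alternating cs α = alternating (go cs α)
  where
  go : ∀ cs α xs x ys → det (xs ++ x ∷ x ∷ ys) cs α ≡ 0ℚ
  go cs α []       x ys = ∂∂≡0 x (det ys) cs α
  go cs α (t ∷ xs) x ys = trans (∂-cong t (λ cs α → go cs α xs x ys) cs α) (∂-0 t cs α)

-- I k F us sums F over all ways to increase k of the entries of us by one.
I : ℕ → (List ℕ → ℚ) → List ℕ → ℚ
I zero    F us = F us
I (suc k) F [] = 0ℚ
I (suc k) F (u ∷ us) = I (suc k) (λ xs → F (u ∷ xs)) us + I k (λ xs → F (suc u ∷ xs)) us

I-cong : ∀ k {F G} → F ≗ G → ∀ us → I k F us ≡ I k G us
I-cong zero    F≗G us = F≗G us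
I-cong (suc k) F≗G [] = refl
I-cong (suc k) F≗G (u ∷ us) =
  cong₂ _+_ (I-cong (suc k) (λ xs → F≗G (u ∷ xs)) us) (I-cong k (λ xs → F≗G (suc u ∷ xs)) us)

∂-I : ∀ t (Φ : List ℕ → List ℕ → Content) k us cs β →
      ∂ t (λ xs β → I k (λ vs → Φ vs xs β) us) cs β ≡ I k (λ vs → ∂ t (Φ vs) cs β) us
∂-I t Φ zero    us       cs β = refl
∂-I t Φ (suc k) []       cs β = ∂-0 t cs β
∂-I t Φ (suc k) (u ∷ us) cs β =
  trans (∂-⊙ +-linear t (λ xs β → I (suc k) (λ vs → Φ (u ∷ vs) xs β) us)
                        (λ xs β → I k (λ vs → Φ (suc u ∷ vs) xs β) us) cs β)
        (cong₂ _+_ (∂-I t (λ vs → Φ (u ∷ vs)) (suc k) us cs β) (∂-I t (λ vs → Φ (suc u ∷ vs)) k us cs β))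

-- By `ent-step` each row either leaves the first variable alone or uses it once and is raised; the
-- exponent `k` fixes how many rows use it.
det-step : ∀ ts cs k β → det ts cs (k ∷ β) ≡ I k (λ us → det us cs β) ts
det-step []       []      zero    β = refl
det-step []       []      (suc k) β = refl
det-step []       (_ ∷ _) zero    β = refl
det-step []       (_ ∷ _) (suc k) β = refl
det-step (t ∷ ts) cs k β = trans (∂-step t (det ts) cs k β) (rest k)
  where
  rest : ∀ k → ∂ t (λ xs → det ts xs ⟨ k ⟩) cs β + ∂ (suc t) (λ xs → down (det ts xs) k) cs β ≡
               I k (λ us → det us cs β) (t ∷ ts)
  rest zero = trans (cong₂ _+_ (∂-cong t (λ xs β → det-step ts xs 0 β) cs β) (∂-0 (suc t) cs β))
                       (ℚₚ.+-identityʳ _)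
  rest (suc k) = cong₂ _+_
    (trans (∂-cong t (λ xs β → det-step ts xs (suc k) β) cs β) (∂-I t det (suc k) ts cs β))
    (trans (∂-cong (suc t) (λ xs β → det-step ts xs k β) cs β) (∂-I (suc t) det k ts cs β))

det-∉ : ∀ ts c cs → All (_≢ c) ts → det ts (c ∷ cs) [] ≡ 0ℚ
det-∉ []       c cs [] = refl
det-∉ (t ∷ ts) c cs (p ∷ ps) =
  0-0 (ent-≢[] t c (det ts cs) p) (∂-[] t (λ xs → det-∉ ts c xs ps) cs)

Decreasing : List ℕ → Set
Decreasing = AllPairs _>_

>⇒≢ : ∀ {a b} → a > b → a ≢ b
>⇒≢ p refl = ℕₚ.<-irrefl refl p

det-≡ : ∀ ts → Decreasing ts → det ts ts [] ≡ 1ℚ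
det-≡ []       [] = refl
det-≡ (t ∷ ts) (p ∷ ps) = begin
  ent t t (det ts ts) [] - ∂ t (λ xs → det ts (t ∷ xs)) ts []
    ≡⟨ cong₂ _-_ (trans (ent-≡[] t _) (det-≡ ts ps)) (∂-≢[] t _ ts (All.map >⇒≢ p)) ⟩
  1ℚ - 0ℚ ≡⟨⟩
  1ℚ ∎

-- At the empty content the entry e_{c-t} is 1 for `t ≡ c` and 0 otherwise. If the heads differ, the
-- larger one is missing from the other list, so its row or its column is zero; equal heads are
-- split off.
det-≢ : ∀ ts cs → Decreasing ts → Decreasing cs → ts ≢ cs → det ts cs [] ≡ 0ℚ
det-≢ []       []       _        _        ts≢cs = ⊥-elim (ts≢cs refl)
det-≢ []       (_ ∷ _)  _        _        _ = refl
det-≢ (t ∷ ts) []       _        _        _ = refl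
det-≢ (t ∷ ts) (c ∷ cs) (p ∷ ps) (q ∷ qs) ts≢cs with ℕₚ.<-cmp t c
... | tri≈ _ refl _ = 0-0
  (trans (ent-≡[] t _) (det-≢ ts cs ps qs (λ eq → ts≢cs (cong (t ∷_) eq))))
  (∂-≢[] t _ cs (All.map >⇒≢ q))
... | tri> _ t≢c c<t = 0-0 (ent-≢[] t c (det ts cs) t≢c)
  (∂-≢[] t _ cs (All.map (λ r → >⇒≢ (ℕₚ.<-trans r c<t)) q))
... | tri< t<c t≢c _ = 0-0 (ent-≢[] t c (det ts cs) t≢c)
  (∂-[] t (λ xs → det-∉ ts c xs (All.map (λ r → ≢-sym (>⇒≢ (ℕₚ.<-trans r t<c))) p)) cs)

-- Symmetric functions in the power-sum basis

scale : ℚ → SymFun → SymFun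
scale q = map (λ t → q * proj₁ t , proj₂ t)

infixl 6 _⊟_
_⊟_ : SymFun → SymFun → SymFun
G ⊟ H = G ++ scale (- 1ℚ) H

pMul : ℕ → SymFun → SymFun
pMul i = map (λ t → proj₁ t , i ∷ proj₂ t)

-- eMul m G is e_m G and qMul i m G is (Σ_j x_j^i e_m(x without x_j)) G, tied together by
-- (m+1) e_{m+1} = q_{1,m} and q_{i,m+1} = p_i e_{m+1} − q_{i+1,m}.
mutual
  eMul : ℕ → SymFun → SymFun
  eMul zero    G = G
  eMul (suc m) G = scale (1/suc m) (qMul 1 m G)

  qMul : ℕ → ℕ → SymFun → SymFun
  qMul i zero    G = pMul i G
  qMul i (suc m) G = pMul i (eMul (suc m) G) ⊟ qMul (suc i) m G

symmetric : Pairing SymFun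
symmetric = record { 0# = [] ; 1# = (1ℚ , []) ∷ [] ; _⊖_ = _⊟_ ; op = eMul }

scale-pos : ∀ q {G} → PosIndexed G → PosIndexed (scale q G)
scale-pos q = Allₚ.map⁺

⊟-pos : ∀ {G H} → PosIndexed G → PosIndexed H → PosIndexed (G ⊟ H)
⊟-pos p q = Allₚ.++⁺ p (scale-pos (- 1ℚ) q)

pMul-pos : ∀ i {G} → PosIndexed G → PosIndexed (pMul (suc i) G)
pMul-pos i p = Allₚ.map⁺ (All.map (ℕ.s≤s ℕ.z≤n ∷_) p)

mutual
  eMul-pos : ∀ m {G} → PosIndexed G → PosIndexed (eMul m G)
  eMul-pos zero    p = p
  eMul-pos (suc m) p = scale-pos (1/suc m) (qMul-pos 0 m p)

  qMul-pos : ∀ i m {G} → PosIndexed G → PosIndexed (qMul (suc i) m G)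
  qMul-pos i zero    p = pMul-pos i p
  qMul-pos i (suc m) p = ⊟-pos (pMul-pos i (eMul-pos (suc m) p)) (qMul-pos (suc i) m p)

val : (List ℕ → ℚ) → SymFun → ℚ
val w G = sumℚ (map (λ t → proj₁ t * w (proj₂ t)) G)

val-++ : ∀ w G H → val w (G ++ H) ≡ val w G + val w H
val-++ w []      H = sym (ℚₚ.+-identityˡ _)
val-++ w (t ∷ G) H = trans (cong (proj₁ t * w (proj₂ t) +_) (val-++ w G H)) (sym (ℚₚ.+-assoc (proj₁ t * w (proj₂ t)) _ _))

val-scale : ∀ w q G → val w (scale q G) ≡ q * val w G
val-scale w q [] = sym (ℚₚ.*-zeroʳ q)
val-scale w q ((c , μ) ∷ G) = trans (cong (q * c * w μ +_) (val-scale w q G)) (distr q c (w μ) (val w G))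
  where
  distr : ∀ q c x y → q * c * x + q * y ≡ q * (c * x + y)
  distr = solve-∀ ℚ-ring

val-⊟ : ∀ w G H → val w (G ⊟ H) ≡ val w G - val w H
val-⊟ w G H = trans (val-++ w G _) (cong (_+_ (val w G)) (trans (val-scale w (- 1ℚ) H) (neg (val w H))))
  where
  neg : ∀ x → - 1ℚ * x ≡ - x
  neg = solve-∀ ℚ-ring

-- An interpretation of the p_μ by functions on `X` in which multiplication by p_i, e_m and q_{i,m}
-- becomes an operator, subject to the recursions that define `eMul` and `qMul`. Then `value`
-- intertwines `eMul` with `e`. One instance gives monomial coefficients, the other gives θ.
record NewtonAction (X : Set) (w : List ℕ → X → ℚ) : Set₁ where
  field
    p       : ℕ → (X → ℚ) → X → ℚ
    e       : ℕ → (X → ℚ) → X → ℚ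
    q       : ℕ → ℕ → (X → ℚ) → X → ℚ
    p-cong  : ∀ i {f g} → f ≗ g → p i f ≗ p i g
    p-0     : ∀ i x → p i (λ _ → 0ℚ) x ≡ 0ℚ
    p-linear : ∀ i c f g x → p i (λ y → c * f y + g y) x ≡ c * p i f x + p i g x
    w-∷     : ∀ i μ → w (suc i ∷ μ) ≗ p (suc i) (w μ)
    e-0     : ∀ f → e 0 f ≗ f
    e-suc   : ∀ m f x → ℕ→ℚ (suc m) * e (suc m) f x ≡ q 1 m f x
    q-0     : ∀ i f → q (suc i) 0 f ≗ p (suc i) f
    q-suc   : ∀ i m f x → q (suc i) (suc m) f x ≡ p (suc i) (e (suc m) f) x - q (suc (suc i)) m f x

  value : SymFun → X → ℚ
  value G x = val (λ μ → w μ x) G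

  value-pMul : ∀ i G → value (pMul (suc i) G) ≗ p (suc i) (value G)
  value-pMul i []            x = sym (p-0 (suc i) x)
  value-pMul i ((c , μ) ∷ G) x =
    trans (cong₂ _+_ (cong (c *_) (w-∷ i μ x)) (value-pMul i G x))
          (sym (p-linear (suc i) c (w μ) (value G) x))

  mutual
    value-eMul : ∀ m G → value (eMul m G) ≗ e m (value G)
    value-eMul zero    G x = sym (e-0 (value G) x)
    value-eMul (suc m) G x = *-cancelˡ-suc m (begin
      ℕ→ℚ (suc m) * value (eMul (suc m) G) x
        ≡⟨ cong (ℕ→ℚ (suc m) *_) (val-scale _ (1/suc m) (qMul 1 m G)) ⟩
      ℕ→ℚ (suc m) * ((1/suc m) * value (qMul 1 m G) x)
        ≡⟨ ℚₚ.*-assoc (ℕ→ℚ (suc m)) (1/suc m) _ ⟨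
      ℕ→ℚ (suc m) * (1/suc m) * value (qMul 1 m G) x
        ≡⟨ cong (_* value (qMul 1 m G) x) (*-1/suc m) ⟩
      1ℚ * value (qMul 1 m G) x
        ≡⟨ ℚₚ.*-identityˡ _ ⟩
      value (qMul 1 m G) x
        ≡⟨ value-qMul 0 m G x ⟩
      q 1 m (value G) x
        ≡⟨ e-suc m (value G) x ⟨
      ℕ→ℚ (suc m) * e (suc m) (value G) x ∎)

    value-qMul : ∀ i m G → value (qMul (suc i) m G) ≗ q (suc i) m (value G)
    value-qMul i zero    G x = trans (value-pMul i G x) (sym (q-0 i (value G) x))
    value-qMul i (suc m) G x =
      trans (val-⊟ _ (pMul (suc i) (eMul (suc m) G)) _)
        (trans (cong₂ _-_ (trans (value-pMul i (eMul (suc m) G) x) (p-cong (suc i) (value-eMul (suc m) G) x))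
                          (value-qMul (suc i) m G x))
               (sym (q-suc i m (value G) x)))

lower : ℕ → Content → ℕ → Content
lower zero    f a = f ⟨ a ⟩
lower (suc i) f zero = λ _ → 0ℚ
lower (suc i) f (suc a) = lower i f a

-- Multiplication by p_i and by Σ_j x_j^i e_m(x without x_j), as for E.
P : ℕ → Content → Content
P i f [] = 0ℚ
P i f (a ∷ α) = lower i f a α + P i (f ⟨ a ⟩) α

Q : ℕ → ℕ → Content → Content
Q i zero    f α = P i f α
Q i (suc m) f [] = 0ℚ
Q i (suc m) f (a ∷ α) = E (suc m) (lower i f a) α + Q i (suc m) (f ⟨ a ⟩) α + Q i m (down f a) α

lower-cong : ∀ i {f g} → f ≗ g → ∀ a → lower i f a ≗ lower i g a
lower-cong zero    f≗g a       β = f≗g (a ∷ β)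
lower-cong (suc i) f≗g zero    β = refl
lower-cong (suc i) f≗g (suc a) β = lower-cong i f≗g a β

P-cong : ∀ i {f g} → f ≗ g → P i f ≗ P i g
P-cong i f≗g [] = refl
P-cong i f≗g (a ∷ α) = cong₂ _+_ (lower-cong i f≗g a α) (P-cong i (λ β → f≗g (a ∷ β)) α)

P-0 : ∀ i α → P i (λ _ → 0ℚ) α ≡ 0ℚ
P-0 i [] = refl
P-0 i (a ∷ α) = 0+0 (lower-0 i a α) (P-0 i α)
  where
  lower-0 : ∀ i a α → lower i (λ _ → 0ℚ) a α ≡ 0ℚ
  lower-0 zero    a       α = refl
  lower-0 (suc i) zero    α = refl
  lower-0 (suc i) (suc a) α = lower-0 i a α

P-scale : ∀ i c f α → P i (λ β → c * f β) α ≡ c * P i f α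
P-scale i c f [] = sym (ℚₚ.*-zeroʳ c)
P-scale i c f (a ∷ α) = trans (cong₂ _+_ (lower-scale i f a) (P-scale i c (f ⟨ a ⟩) α))
                              (sym (ℚₚ.*-distribˡ-+ c (lower i f a α) _))
  where
  lower-scale : ∀ i f a → lower i (λ β → c * f β) a α ≡ c * lower i f a α
  lower-scale zero    f a = refl
  lower-scale (suc i) f zero = sym (ℚₚ.*-zeroʳ c)
  lower-scale (suc i) f (suc a) = lower-scale i f a

P-+ : ∀ i f g α → P i (λ β → f β + g β) α ≡ P i f α + P i g α
P-+ i f g [] = refl
P-+ i f g (a ∷ α) = trans (cong₂ _+_ (lower-+ i f g a) (P-+ i (f ⟨ a ⟩) (g ⟨ a ⟩) α)) (+-interchange (lower i f a α) _ _ _)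
  where
  lower-+ : ∀ i f g a → lower i (λ β → f β + g β) a α ≡ lower i f a α + lower i g a α
  lower-+ zero    f g a = refl
  lower-+ (suc i) f g zero = refl
  lower-+ (suc i) f g (suc a) = lower-+ i f g a

lower-1 : ∀ f a → lower 1 f a ≗ down f a
lower-1 f zero    β = refl
lower-1 f (suc a) β = refl

lower-E : ∀ i m f a β → lower i (E (suc m) f) a β ≡ E (suc m) (lower i f a) β + E m (lower (suc i) f a) β
lower-E zero    m f a       β = cong (E (suc m) (f ⟨ a ⟩) β +_) (E-cong m (λ γ → sym (lower-1 f a γ)) β)
lower-E (suc i) m f zero    β = sym (0+0 (E-0 (suc m) β) (E-0 m β))
lower-E (suc i) m f (suc a) β = lower-E i m f a β

-- In x_j^i e_{m+1} the variable x_j is either absent from the monomial of e_{m+1}, which gives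
-- q_{i,m+1}, or divides it, which gives q_{i+1,m}.
P-E : ∀ i m f α → P i (E (suc m) f) α ≡ Q i (suc m) f α + Q (suc i) m f α
P-E i zero    f [] = refl
P-E i (suc m) f [] = refl
P-E i zero    f (a ∷ α) =
  trans (cong₂ _+_ (lower-E i 0 f a α)
                   (trans (P-+ i (E 1 (f ⟨ a ⟩)) (down f a) α)
                          (cong (_+ P i (down f a) α) (P-E i 0 (f ⟨ a ⟩) α))))
        (regroup (E 1 (lower i f a) α) _ _ _ _)
  where
  regroup : ∀ x y u v w → (x + y) + ((u + v) + w) ≡ (x + u + w) + (y + v)
  regroup = solve-∀ ℚ-ring
P-E i (suc m) f (a ∷ α) =
  trans (cong₂ _+_ (lower-E i (suc m) f a α)
                   (trans (P-+ i (E (suc (suc m)) (f ⟨ a ⟩)) (E (suc m) (down f a)) α)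
                          (cong₂ _+_ (P-E i (suc m) (f ⟨ a ⟩) α) (P-E i m (down f a) α))))
        (regroup (E (suc (suc m)) (lower i f a) α) _ _ _ _ _)
  where
  regroup : ∀ x y u v w z → (x + y) + ((u + v) + (w + z)) ≡ (x + u + w) + (y + v + z)
  regroup = solve-∀ ℚ-ring

-- Each monomial of e_{m+1} is obtained once for every one of its m + 1 variables.
suc*E : ∀ m f α → ℕ→ℚ (suc m) * E (suc m) f α ≡ Q 1 m f α
suc*E zero    f [] = refl
suc*E (suc m) f [] = ℚₚ.*-zeroʳ (ℕ→ℚ (suc (suc m)))
suc*E zero    f (a ∷ α) =
  trans (regroup (E 1 (f ⟨ a ⟩) α) (down f a α))
        (cong₂ _+_ (sym (lower-1 f a α)) (suc*E 0 (f ⟨ a ⟩) α))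
  where
  regroup : ∀ x y → 1ℚ * (x + y) ≡ y + 1ℚ * x
  regroup = solve-∀ ℚ-ring
suc*E (suc m) f (a ∷ α) =
  trans (trans (cong (_* (E (suc (suc m)) (f ⟨ a ⟩) α + E (suc m) (down f a) α)) (ℕ→ℚ-suc (suc m)))
               (regroup (ℕ→ℚ (suc m)) (E (suc (suc m)) (f ⟨ a ⟩) α) _))
        (cong₂ _+_ (cong₂ _+_ (E-cong (suc m) (λ β → sym (lower-1 f a β)) α)
                              (trans (cong (_* E (suc (suc m)) (f ⟨ a ⟩) α) (sym (ℕ→ℚ-suc (suc m)))) (suc*E (suc m) (f ⟨ a ⟩) α)))
                   (suc*E m (down f a) α))
  where
  regroup : ∀ m x y → (1ℚ + m) * (x + y) ≡ (y + (1ℚ + m) * x) + m * y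
  regroup = solve-∀ ℚ-ring

-- The sum over the position that absorbs the part `i` is split into position 0 and the later ones.
-- `f` is arbitrary so that the induction can put the first exponent in front.
ℕ→ℚ-pCoeff-∷ : ∀ i (f : List ℕ → ℕ) α →
  ℕ→ℚ (sum (map (λ j → if i ≤ᵇ nthℕ α j then f (subAt j i α) else 0) (upTo (length α)))) ≡
  P i (λ β → ℕ→ℚ (f β)) α
ℕ→ℚ-pCoeff-∷ i f [] = refl
ℕ→ℚ-pCoeff-∷ i f (a ∷ α) =
  trans (ℕ→ℚ-+ (if i ≤ᵇ a then f ((a ∸ i) ∷ α) else 0) _)
    (cong₂ _+_ (first i a f)
      (trans (cong (λ l → ℕ→ℚ (sum l))
               (trans (cong (map _) (sym (map-applyUpTo (λ j → j) suc (length α)))) (sym (map-∘ (upTo (length α))))))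
             (ℕ→ℚ-pCoeff-∷ i (λ β → f (a ∷ β)) α)))
  where
  first : ∀ i a f → ℕ→ℚ (if i ≤ᵇ a then f ((a ∸ i) ∷ α) else 0) ≡ lower i (λ β → ℕ→ℚ (f β)) a α
  first zero          a       f = refl
  first (suc i)       zero    f = refl
  first (suc zero)    (suc a) f = refl
  first (suc (suc i)) (suc a) f = first (suc i) a f

monomial-action : NewtonAction (List ℕ) (λ μ α → ℕ→ℚ (pCoeff μ α))
monomial-action = record
  { p = P ; e = E ; q = Q
  ; p-cong = P-cong ; p-0 = P-0 ; p-linear = λ i c f g α → trans (P-+ i (λ β → c * f β) g α) (cong (_+ P i g α) (P-scale i c f α))
  ; w-∷ = λ i μ → ℕ→ℚ-pCoeff-∷ (suc i) (pCoeff μ)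
  ; e-0 = λ f x → refl
  ; e-suc = suc*E
  ; q-0 = λ i f x → refl
  ; q-suc = λ i m f x → trans (cancel (Q (suc i) (suc m) f x) _) (cong (_- Q (suc (suc i)) m f x) (sym (P-E (suc i) m f x)))
  }
  where
  cancel : ∀ x y → x ≡ (x + y) - y
  cancel = solve-∀ ℚ-ring

module S = Laplace symmetric

-- Exponential generating functions and Bernoulli numbers

-- Exponential generating functions: f stands for Σ f n x^n / n!, D is the derivative and ⊛ the product.
Seq : Set
Seq = ℕ → ℚ

D : Seq → Seq
D f n = f (suc n)

infixl 7 _⊛_
infixl 6 _⊕_
_⊕_ : Seq → Seq → Seq
(f ⊕ g) n = f n + g n

infixl 8 _·_
_·_ : ℚ → Seq → Seq
(c · f) n = c * f n

_⊛_ : Seq → Seq → Seq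
(f ⊛ g) zero = f 0 * g 0
(f ⊛ g) (suc n) = (D f ⊛ g) n + (f ⊛ D g) n

⊛-cong : ∀ {f f′ g g′} → f ≗ f′ → g ≗ g′ → f ⊛ g ≗ f′ ⊛ g′
⊛-cong p q zero = cong₂ _*_ (p 0) (q 0)
⊛-cong p q (suc n) = cong₂ _+_ (⊛-cong (λ k → p (suc k)) q n) (⊛-cong p (λ k → q (suc k)) n)

⊛-comm : ∀ f g → f ⊛ g ≗ g ⊛ f
⊛-comm f g zero = ℚₚ.*-comm (f 0) (g 0)
⊛-comm f g (suc n) = trans (cong₂ _+_ (⊛-comm (D f) g n) (⊛-comm f (D g) n)) (ℚₚ.+-comm ((g ⊛ D f) n) _)

⊛-distribʳ : ∀ f g h → (f ⊕ g) ⊛ h ≗ (f ⊛ h) ⊕ (g ⊛ h)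
⊛-distribʳ f g h zero = ℚₚ.*-distribʳ-+ (h 0) (f 0) (g 0)
⊛-distribʳ f g h (suc n) = trans (cong₂ _+_ (⊛-distribʳ (D f) (D g) h n) (⊛-distribʳ f g (D h) n))
                                 (+-interchange ((D f ⊛ h) n) _ _ _)

⊛-distribˡ : ∀ f g h → f ⊛ (g ⊕ h) ≗ (f ⊛ g) ⊕ (f ⊛ h)
⊛-distribˡ f g h n = trans (⊛-comm f (g ⊕ h) n)
  (trans (⊛-distribʳ g h f n) (cong₂ _+_ (⊛-comm g f n) (⊛-comm h f n)))

⊛-scaleˡ : ∀ c f g → (c · f) ⊛ g ≗ c · (f ⊛ g)
⊛-scaleˡ c f g zero = ℚₚ.*-assoc c (f 0) (g 0)
⊛-scaleˡ c f g (suc n) = trans (cong₂ _+_ (⊛-scaleˡ c (D f) g n) (⊛-scaleˡ c f (D g) n))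
                               (sym (ℚₚ.*-distribˡ-+ c ((D f ⊛ g) n) _))

⊛-scaleʳ : ∀ c f g → f ⊛ (c · g) ≗ c · (f ⊛ g)
⊛-scaleʳ c f g n = trans (⊛-comm f (c · g) n) (trans (⊛-scaleˡ c g f n) (cong (c *_) (⊛-comm g f n)))

⊛-linear : ∀ c f g h → (c · f ⊕ g) ⊛ h ≗ c · (f ⊛ h) ⊕ (g ⊛ h)
⊛-linear c f g h n = trans (⊛-distribʳ (c · f) g h n) (cong (_+ (g ⊛ h) n) (⊛-scaleˡ c f h n))

⊛-assoc : ∀ f g h → (f ⊛ g) ⊛ h ≗ f ⊛ (g ⊛ h)
⊛-assoc f g h zero = ℚₚ.*-assoc (f 0) (g 0) (h 0)
⊛-assoc f g h (suc n) = begin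
  ((D f ⊛ g ⊕ f ⊛ D g) ⊛ h) n + ((f ⊛ g) ⊛ D h) n
    ≡⟨ cong (_+ ((f ⊛ g) ⊛ D h) n) (⊛-distribʳ (D f ⊛ g) (f ⊛ D g) h n) ⟩
  ((D f ⊛ g) ⊛ h) n + ((f ⊛ D g) ⊛ h) n + ((f ⊛ g) ⊛ D h) n
    ≡⟨ cong₂ _+_ (cong₂ _+_ (⊛-assoc (D f) g h n) (⊛-assoc f (D g) h n)) (⊛-assoc f g (D h) n) ⟩
  (D f ⊛ (g ⊛ h)) n + (f ⊛ (D g ⊛ h)) n + (f ⊛ (g ⊛ D h)) n
    ≡⟨ ℚₚ.+-assoc ((D f ⊛ (g ⊛ h)) n) _ _ ⟩
  (D f ⊛ (g ⊛ h)) n + ((f ⊛ (D g ⊛ h)) n + (f ⊛ (g ⊛ D h)) n)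
    ≡⟨ cong ((D f ⊛ (g ⊛ h)) n +_) (⊛-distribˡ f (D g ⊛ h) (g ⊛ D h) n) ⟨
  (D f ⊛ (g ⊛ h)) n + (f ⊛ (D g ⊛ h ⊕ g ⊛ D h)) n ∎

⊛-zeroˡ : ∀ f → (λ _ → 0ℚ) ⊛ f ≗ (λ _ → 0ℚ)
⊛-zeroˡ f zero = ℚₚ.*-zeroˡ (f 0)
⊛-zeroˡ f (suc n) = cong₂ _+_ (⊛-zeroˡ f n) (⊛-zeroˡ (D f) n)

𝟙 : Seq
𝟙 zero = 1ℚ
𝟙 (suc n) = 0ℚ

⊛-identityˡ : ∀ f → 𝟙 ⊛ f ≗ f
⊛-identityˡ f zero = ℚₚ.*-identityˡ (f 0)
⊛-identityˡ f (suc n) = trans (cong₂ _+_ (⊛-zeroˡ f n) (⊛-identityˡ (D f) n)) (ℚₚ.+-identityˡ (f (suc n)))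

𝕩 : Seq
𝕩 zero = 0ℚ
𝕩 (suc n) = 𝟙 n

𝕩-⊛ : ∀ f n → (𝕩 ⊛ f) (suc n) ≡ ℕ→ℚ (suc n) * f n
𝕩-⊛ f n = trans (cong (_+ (𝕩 ⊛ D f) n) (⊛-identityˡ f n)) (step n)
  where
  lemma : ∀ k y → y + k * y ≡ (1ℚ + k) * y
  lemma = solve-∀ ℚ-ring
  lemma₀ : ∀ x y → x + 0ℚ * y ≡ 1ℚ * x
  lemma₀ = solve-∀ ℚ-ring
  step : ∀ n → f n + (𝕩 ⊛ D f) n ≡ ℕ→ℚ (suc n) * f n
  step zero = lemma₀ (f 0) (f 1)
  step (suc n) = trans (cong (f (suc n) +_) (𝕩-⊛ (D f) n))
    (trans (lemma (ℕ→ℚ (suc n)) (f (suc n))) (cong (_* f (suc n)) (sym (ℕ→ℚ-suc (suc n)))))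

𝕩-cancel : ∀ f → 𝕩 ⊛ f ≗ (λ _ → 0ℚ) → f ≗ (λ _ → 0ℚ)
𝕩-cancel f eq n = *-cancelˡ-suc n (trans (sym (𝕩-⊛ f n)) (trans (eq (suc n)) (sym (ℚₚ.*-zeroʳ (ℕ→ℚ (suc n))))))

⊛-leading : ∀ n h u → (∀ j → j ℕ.< n → h j ≡ 0ℚ) → (h ⊛ u) n ≡ h n * u 0
⊛-leading zero    h u _   = refl
⊛-leading (suc n) h u h≡0 = trans
  (cong₂ _+_ (⊛-leading n (D h) u (λ j j<n → h≡0 (suc j) (ℕ.s≤s j<n)))
             (trans (⊛-leading n h (D u) (λ j j<n → h≡0 j (ℕₚ.m<n⇒m<1+n j<n)))
                    (trans (cong (_* u 1) (h≡0 n (ℕₚ.n<1+n n))) (ℚₚ.*-zeroˡ (u 1)))))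
  (ℚₚ.+-identityʳ (h (suc n) * u 0))

-- The lowest nonzero coefficient of `h` would survive in the product, multiplied by `u 0`.
⊛-cancel : ∀ h u → u 0 ≡ 1ℚ → h ⊛ u ≗ (λ _ → 0ℚ) → h ≗ (λ _ → 0ℚ)
⊛-cancel h u u0 eq n = below (suc n) n (ℕₚ.n<1+n n)
  where
  below : ∀ m j → j ℕ.< m → h j ≡ 0ℚ
  below (suc m) j (ℕ.s≤s j≤m) with ℕₚ.m≤n⇒m<n∨m≡n j≤m
  ... | inj₁ j<m  = below m j j<m
  ... | inj₂ refl = begin
    h m ≡⟨ ℚₚ.*-identityʳ (h m) ⟨
    h m * 1ℚ ≡⟨ cong (h m *_) u0 ⟨
    h m * u 0 ≡⟨ ⊛-leading m h u (below m) ⟨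
    (h ⊛ u) m ≡⟨ eq m ⟩
    0ℚ ∎

Sum : Seq → ℕ → ℕ → ℚ
Sum F i zero = 0ℚ
Sum F i (suc n) = F i + Sum F (suc i) n

Sum-cong : ∀ {F G} → F ≗ G → ∀ i n → Sum F i n ≡ Sum G i n
Sum-cong F≗G i zero = refl
Sum-cong F≗G i (suc n) = cong₂ _+_ (F≗G i) (Sum-cong F≗G (suc i) n)

Sum-D : ∀ F i n → Sum (D F) i n ≡ Sum F (suc i) n
Sum-D F i zero = refl
Sum-D F i (suc n) = cong (F (suc i) +_) (Sum-D F (suc i) n)

Sum-⊕ : ∀ F G i n → Sum (F ⊕ G) i n ≡ Sum F i n + Sum G i n
Sum-⊕ F G i zero = refl
Sum-⊕ F G i (suc n) = trans (cong (F i + G i +_) (Sum-⊕ F G (suc i) n)) (+-interchange (F i) (G i) _ _)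

Sum-snoc : ∀ F i n → Sum F i (suc n) ≡ Sum F i n + F (i ℕ.+ n)
Sum-snoc F i zero = trans (ℚₚ.+-comm (F i) 0ℚ) (cong (λ k → 0ℚ + F k) (sym (ℕₚ.+-identityʳ i)))
Sum-snoc F i (suc n) = trans (cong (F i +_) (Sum-snoc F (suc i) n))
  (trans (sym (ℚₚ.+-assoc (F i) _ _)) (cong (λ k → Sum F i (suc n) + F k) (sym (ℕₚ.+-suc i n))))

exp : Seq
exp _ = 1ℚ

binomial : ℕ → Seq → Seq
binomial n f j = ℕ→ℚ (n C j) * f j

⊛-exp : ∀ f n → (f ⊛ exp) n ≡ Sum (binomial n f) 0 (suc n)
⊛-exp f zero = lemma (f 0)
  where
  lemma : ∀ x → x * 1ℚ ≡ 1ℚ * x + 0ℚ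
  lemma = solve-∀ ℚ-ring
⊛-exp f (suc n) = begin
  (D f ⊛ exp) n + (f ⊛ exp) n
    ≡⟨ cong₂ _+_ (⊛-exp (D f) n) (⊛-exp f n) ⟩
  Sum (binomial n (D f)) 0 (suc n) + Sum (binomial n f) 0 (suc n)
    -- A term with C(n, n + 1) = 0 is appended, so that after splitting off index 0 both sums have
    -- the range needed for Pascal's rule.
    ≡⟨ cong (Sum (binomial n (D f)) 0 (suc n) +_) (sym last-zero) ⟩
  Sum (binomial n (D f)) 0 (suc n) + Sum (binomial n f) 0 (suc (suc n))
    ≡⟨ cong (λ s → Sum (binomial n (D f)) 0 (suc n) + (binomial n f 0 + s)) (sym (Sum-D (binomial n f) 0 (suc n))) ⟩
  Sum (binomial n (D f)) 0 (suc n) + (binomial n f 0 + Sum (D (binomial n f)) 0 (suc n))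
    ≡⟨ lemma (Sum (binomial n (D f)) 0 (suc n)) (binomial n f 0) (Sum (D (binomial n f)) 0 (suc n)) ⟩
  binomial n f 0 + (Sum (binomial n (D f)) 0 (suc n) + Sum (D (binomial n f)) 0 (suc n))
    ≡⟨ cong (binomial n f 0 +_) (sym (Sum-⊕ (binomial n (D f)) (D (binomial n f)) 0 (suc n))) ⟩
  binomial n f 0 + Sum (binomial n (D f) ⊕ D (binomial n f)) 0 (suc n)
    ≡⟨ cong (binomial n f 0 +_) (Sum-cong pascal 0 (suc n)) ⟩
  binomial (suc n) f 0 + Sum (D (binomial (suc n) f)) 0 (suc n)
    ≡⟨ cong (binomial (suc n) f 0 +_) (Sum-D (binomial (suc n) f) 0 (suc n)) ⟩
  Sum (binomial (suc n) f) 0 (suc (suc n)) ∎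
  where
  lemma : ∀ x y z → x + (y + z) ≡ y + (x + z)
  lemma = solve-∀ ℚ-ring
  last-zero : Sum (binomial n f) 0 (suc (suc n)) ≡ Sum (binomial n f) 0 (suc n)
  last-zero = trans (Sum-snoc (binomial n f) 0 (suc n))
    (trans (cong (λ k → Sum (binomial n f) 0 (suc n) + ℕ→ℚ k * f (suc n)) (k>n⇒nCk≡0 (ℕₚ.n<1+n n)))
           (trans (cong (Sum (binomial n f) 0 (suc n) +_) (ℚₚ.*-zeroˡ (f (suc n)))) (ℚₚ.+-identityʳ _)))
  pascal : binomial n (D f) ⊕ D (binomial n f) ≗ D (binomial (suc n) f)
  pascal j = trans (sym (ℚₚ.*-distribʳ-+ (f (suc j)) (ℕ→ℚ (n C j)) (ℕ→ℚ (n C suc j))))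
    (cong (_* f (suc j)) (trans (sym (ℕ→ℚ-+ (n C j) (n C suc j))) (cong ℕ→ℚ (nCk+nC[k+1]≡[n+1]C[k+1] n j))))

private
  nth-snoc : ∀ {A : Set} (xs : List A) y → nth (xs ++ y ∷ []) (length xs) ≡ just y
  nth-snoc []       y = refl
  nth-snoc (x ∷ xs) y = nth-snoc xs y

  nextBernoulli : ℕ → ℚ
  nextBernoulli m = - divℕ (sumℚ (zipWith (λ j b → ℕ→ℚ (suc (suc m) C j) * b) (upTo (suc m)) (bernoulliUpTo m))) (suc (suc m))

  length-bernoulliUpTo : ∀ m → length (bernoulliUpTo m) ≡ suc m
  length-bernoulliUpTo zero = refl
  length-bernoulliUpTo (suc m) = trans (length-++ (bernoulliUpTo m))
    (trans (cong (ℕ._+ 1) (length-bernoulliUpTo m)) (ℕₚ.+-comm (suc m) 1))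

  bernoulli-just : ∀ m {c} → nth (bernoulliUpTo m) m ≡ just c → bernoulli m ≡ c
  bernoulli-just m eq with nth (bernoulliUpTo m) m
  bernoulli-just m refl | just _ = refl

  bernoulli-next : ∀ m → bernoulli (suc m) ≡ nextBernoulli m
  bernoulli-next m = bernoulli-just (suc m)
    (trans (cong (nth (bernoulliUpTo (suc m))) (sym (length-bernoulliUpTo m))) (nth-snoc (bernoulliUpTo m) (nextBernoulli m)))

  bernoulliUpTo-applyUpTo : ∀ m → bernoulliUpTo m ≡ applyUpTo bernoulli (suc m)
  bernoulliUpTo-applyUpTo zero = refl
  bernoulliUpTo-applyUpTo (suc m) = trans
    (cong₂ (λ xs y → xs ++ y ∷ []) (bernoulliUpTo-applyUpTo m) (sym (bernoulli-next m)))
    (applyUpTo-∷ʳ bernoulli (suc m))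

  sum-zipWith : ∀ (F : ℕ → ℚ → ℚ) B n i →
    sumℚ (zipWith F (applyUpTo (i ℕ.+_) n) (applyUpTo (λ j → B (i ℕ.+ j)) n)) ≡ Sum (λ j → F j (B j)) i n
  sum-zipWith F B zero    i = refl
  sum-zipWith F B (suc n) i = cong₂ _+_ (cong (λ k → F k (B k)) (ℕₚ.+-identityʳ i))
    (trans (cong sumℚ (cong₂ (zipWith F) (applyUpTo-cong (λ j → ℕₚ.+-suc i j) n)
                                         (applyUpTo-cong (λ j → cong B (ℕₚ.+-suc i j)) n)))
           (sum-zipWith F B n (suc i)))
    where
    applyUpTo-cong : ∀ {A : Set} {f g : ℕ → A} → f ≗ g → ∀ n → applyUpTo f n ≡ applyUpTo g n
    applyUpTo-cong f≗g zero = refl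
    applyUpTo-cong f≗g (suc n) = cong₂ _∷_ (f≗g 0) (applyUpTo-cong (λ j → f≗g (suc j)) n)

-- The Bernoulli recurrence read as B(x) (e^x - 1) = x. It governs the degrees from 2 on; the values
-- in degrees 0 and 1 supply the term x.
bernoulli-⊛-exp : bernoulli ⊛ exp ≗ bernoulli ⊕ 𝕩
bernoulli-⊛-exp zero = refl
bernoulli-⊛-exp (suc zero) = refl
bernoulli-⊛-exp (suc (suc m)) = begin
  (bernoulli ⊛ exp) n ≡⟨ ⊛-exp bernoulli n ⟩
  Sum F 0 (suc n) ≡⟨ Sum-snoc F 0 n ⟩
  Sum F 0 n + F n ≡⟨ cong₂ _+_ (Sum-snoc F 0 (suc m)) (trans (cong (λ k → ℕ→ℚ k * bernoulli n) (nCn≡1 n)) (ℚₚ.*-identityˡ _)) ⟩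
  (s + F (suc m)) + bernoulli n ≡⟨ cong (λ z → (s + z) + bernoulli n) F-last ⟩
  (s + - s) + bernoulli n ≡⟨ lemma s (bernoulli n) ⟩
  bernoulli n + 0ℚ ∎
  where
  n = suc (suc m)
  F = binomial n bernoulli
  s = Sum F 0 (suc m)
  lemma : ∀ s b → (s + - s) + b ≡ b + 0ℚ
  lemma = solve-∀ ℚ-ring
  list-sum : sumℚ (zipWith (λ j b → ℕ→ℚ (n C j) * b) (upTo (suc m)) (bernoulliUpTo m)) ≡ s
  list-sum = trans (cong (λ bs → sumℚ (zipWith (λ j b → ℕ→ℚ (n C j) * b) (upTo (suc m)) bs)) (bernoulliUpTo-applyUpTo m))
    (sum-zipWith (λ j b → ℕ→ℚ (n C j) * b) bernoulli (suc m) 0)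
  nC[n-1]≡n : n C suc m ≡ n
  nC[n-1]≡n = trans (nCk≡nC[n∸k] (ℕₚ.n≤1+n (suc m))) (trans (cong (n C_) (ℕₚ.m+n∸n≡m 1 m)) (nC1≡n n))
  neg : ∀ k d → k * (- d) ≡ - (d * k)
  neg = solve-∀ ℚ-ring
  -- C(n, n - 1) = n undoes the division in the definition of the Bernoulli number.
  F-last : F (suc m) ≡ - s
  F-last = begin
    ℕ→ℚ (n C suc m) * bernoulli (suc m) ≡⟨ cong₂ (λ k b → ℕ→ℚ k * b) nC[n-1]≡n (bernoulli-next m) ⟩
    ℕ→ℚ n * nextBernoulli m ≡⟨ neg (ℕ→ℚ n) (divℕ l n) ⟩
    - (divℕ l n * ℕ→ℚ n) ≡⟨ cong -_ (divℕ-* l n) ⟩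
    - l ≡⟨ cong -_ list-sum ⟩
    - s ∎
    where l = sumℚ (zipWith (λ j b → ℕ→ℚ (n C j) * b) (upTo (suc m)) (bernoulliUpTo m))

2ℚ : ℚ
2ℚ = 1ℚ + 1ℚ

-- f(2x)
double : Seq → Seq
double f n = ℕ→ℚ (2 ^ n) * f n

ℕ→ℚ-2^suc : ∀ n → ℕ→ℚ (2 ^ suc n) ≡ 2ℚ * ℕ→ℚ (2 ^ n)
ℕ→ℚ-2^suc n = ℕ→ℚ-* 2 (2 ^ n)

double-D : ∀ f → D (double f) ≗ 2ℚ · double (D f)
double-D f n = trans (cong (_* f (suc n)) (ℕ→ℚ-2^suc n)) (ℚₚ.*-assoc 2ℚ (ℕ→ℚ (2 ^ n)) (f (suc n)))

double-⊛ : ∀ f g → double (f ⊛ g) ≗ double f ⊛ double g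
double-⊛ f g zero = lemma (f 0) (g 0)
  where
  lemma : ∀ x y → 1ℚ * (x * y) ≡ (1ℚ * x) * (1ℚ * y)
  lemma = solve-∀ ℚ-ring
double-⊛ f g (suc n) = begin
  ℕ→ℚ (2 ^ suc n) * ((D f ⊛ g) n + (f ⊛ D g) n)
    ≡⟨ cong (_* ((D f ⊛ g) n + (f ⊛ D g) n)) (ℕ→ℚ-2^suc n) ⟩
  2ℚ * ℕ→ℚ (2 ^ n) * ((D f ⊛ g) n + (f ⊛ D g) n)
    ≡⟨ lemma 2ℚ (ℕ→ℚ (2 ^ n)) ((D f ⊛ g) n) ((f ⊛ D g) n) ⟩
  2ℚ * double (D f ⊛ g) n + 2ℚ * double (f ⊛ D g) n
    ≡⟨ cong₂ (λ a b → 2ℚ * a + 2ℚ * b) (double-⊛ (D f) g n) (double-⊛ f (D g) n) ⟩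
  2ℚ * (double (D f) ⊛ double g) n + 2ℚ * (double f ⊛ double (D g)) n
    ≡⟨ cong₂ _+_ (⊛-scaleˡ 2ℚ (double (D f)) (double g) n) (⊛-scaleʳ 2ℚ (double f) (double (D g)) n) ⟨
  (2ℚ · double (D f) ⊛ double g) n + (double f ⊛ 2ℚ · double (D g)) n
    ≡⟨ cong₂ _+_ (⊛-cong (double-D f) (λ _ → refl) n) (⊛-cong (λ _ → refl) (double-D g) n) ⟨
  (D (double f) ⊛ double g) n + (double f ⊛ D (double g)) n ∎
  where
  lemma : ∀ t k x y → t * k * (x + y) ≡ t * (k * x) + t * (k * y)
  lemma = solve-∀ ℚ-ring

exp² : exp ⊛ exp ≗ double exp
exp² zero = refl
exp² (suc n) = trans (cong₂ _+_ (exp² n) (exp² n)) (trans (lemma (ℕ→ℚ (2 ^ n))) (cong (_* 1ℚ) (sym (ℕ→ℚ-2^suc n))))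
  where
  lemma : ∀ k → k * 1ℚ + k * 1ℚ ≡ 2ℚ * k * 1ℚ
  lemma = solve-∀ ℚ-ring

double-𝕩 : double 𝕩 ≗ 2ℚ · 𝕩
double-𝕩 zero = refl
double-𝕩 (suc zero) = refl
double-𝕩 (suc (suc n)) = trans (ℚₚ.*-zeroʳ (ℕ→ℚ (2 ^ suc (suc n)))) (sym (ℚₚ.*-zeroʳ 2ℚ))

double-bernoulli : (double bernoulli ⊛ exp) ⊛ exp ≗ double bernoulli ⊕ 2ℚ · 𝕩
double-bernoulli n = begin
  ((double bernoulli ⊛ exp) ⊛ exp) n ≡⟨ ⊛-assoc (double bernoulli) exp exp n ⟩
  (double bernoulli ⊛ (exp ⊛ exp)) n ≡⟨ ⊛-cong (λ _ → refl) exp² n ⟩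
  (double bernoulli ⊛ double exp) n ≡⟨ double-⊛ bernoulli exp n ⟨
  double (bernoulli ⊛ exp) n ≡⟨ cong (ℕ→ℚ (2 ^ n) *_) (bernoulli-⊛-exp n) ⟩
  ℕ→ℚ (2 ^ n) * (bernoulli n + 𝕩 n) ≡⟨ ℚₚ.*-distribˡ-+ (ℕ→ℚ (2 ^ n)) (bernoulli n) (𝕩 n) ⟩
  double bernoulli n + double 𝕩 n ≡⟨ cong (double bernoulli n +_) (double-𝕩 n) ⟩
  double bernoulli n + 2ℚ * 𝕩 n ∎

-- −x / (e^x + 1)
δ : Seq
δ = (- 1ℚ) · bernoulli ⊕ double bernoulli

-- The recurrences at x and at 2x combine to δ (e^{2x} - 1) = x (1 - e^x). The common factor e^x - 1
-- has constant term 0 and cannot be inverted; it is removed in `δ-exp`.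
δ-exp-exp : (δ ⊛ exp) ⊛ exp ≗ δ ⊕ 𝕩 ⊕ (- 1ℚ) · (𝕩 ⊛ exp)
δ-exp-exp n = begin
  ((δ ⊛ exp) ⊛ exp) n
    ≡⟨ ⊛-cong (⊛-linear (- 1ℚ) bernoulli (double bernoulli) exp) (λ _ → refl) n ⟩
  (((- 1ℚ) · (bernoulli ⊛ exp) ⊕ (double bernoulli ⊛ exp)) ⊛ exp) n
    ≡⟨ ⊛-linear (- 1ℚ) (bernoulli ⊛ exp) (double bernoulli ⊛ exp) exp n ⟩
  - 1ℚ * ((bernoulli ⊛ exp) ⊛ exp) n + ((double bernoulli ⊛ exp) ⊛ exp) n
    ≡⟨ cong₂ (λ a b → - 1ℚ * a + b) bee (double-bernoulli n) ⟩
  - 1ℚ * (bernoulli n + 𝕩 n + (𝕩 ⊛ exp) n) + (double bernoulli n + 2ℚ * 𝕩 n)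
    ≡⟨ lemma (bernoulli n) (𝕩 n) ((𝕩 ⊛ exp) n) (double bernoulli n) ⟩
  (- 1ℚ * bernoulli n + double bernoulli n) + 𝕩 n + - 1ℚ * (𝕩 ⊛ exp) n ∎
  where
  bee : ((bernoulli ⊛ exp) ⊛ exp) n ≡ bernoulli n + 𝕩 n + (𝕩 ⊛ exp) n
  bee = trans (⊛-cong bernoulli-⊛-exp (λ _ → refl) n)
    (trans (⊛-distribʳ bernoulli 𝕩 exp n) (cong (_+ (𝕩 ⊛ exp) n) (bernoulli-⊛-exp n)))
  lemma : ∀ b x y d → - 1ℚ * (b + x + y) + (d + 2ℚ * x) ≡ (- 1ℚ * b + d) + x + - 1ℚ * y
  lemma = solve-∀ ℚ-ring

-- The defect w satisfies w (e^x − 1) = 0, and multiplying by x / (e^x − 1) gives x w = 0.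
δ-exp : ∀ n → (δ ⊛ exp) n + δ n + 𝕩 n ≡ 0ℚ
δ-exp = 𝕩-cancel w (λ n → cancel (bw n) (eq n))
  where
  w : Seq
  w = δ ⊛ exp ⊕ δ ⊕ 𝕩
  bw : Seq
  bw = bernoulli ⊛ w
  cancel : ∀ x {y} → x + y ≡ x → y ≡ 0ℚ
  cancel x {y} eq = trans (lemma x y) (trans (cong (_- x) eq) (ℚₚ.+-inverseʳ x))
    where
    lemma : ∀ x y → y ≡ (x + y) - x
    lemma = solve-∀ ℚ-ring
  w-exp : w ⊛ exp ≗ w
  w-exp n = begin
    (w ⊛ exp) n
      ≡⟨ ⊛-distribʳ (δ ⊛ exp ⊕ δ) 𝕩 exp n ⟩
    ((δ ⊛ exp ⊕ δ) ⊛ exp) n + (𝕩 ⊛ exp) n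
      ≡⟨ cong (_+ (𝕩 ⊛ exp) n) (trans (⊛-distribʳ (δ ⊛ exp) δ exp n) (cong (_+ (δ ⊛ exp) n) (δ-exp-exp n))) ⟩
    δ n + 𝕩 n + - 1ℚ * (𝕩 ⊛ exp) n + (δ ⊛ exp) n + (𝕩 ⊛ exp) n
      ≡⟨ lemma (δ n) (𝕩 n) ((𝕩 ⊛ exp) n) ((δ ⊛ exp) n) ⟩
    w n ∎
    where
    lemma : ∀ d x y e → d + x + - 1ℚ * y + e + y ≡ e + d + x
    lemma = solve-∀ ℚ-ring
  eq : ∀ n → bw n + (𝕩 ⊛ w) n ≡ bw n
  eq n = begin
    bw n + (𝕩 ⊛ w) n ≡⟨ ⊛-distribʳ bernoulli 𝕩 w n ⟨
    ((bernoulli ⊕ 𝕩) ⊛ w) n ≡⟨ ⊛-cong bernoulli-⊛-exp (λ _ → refl) n ⟨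
    ((bernoulli ⊛ exp) ⊛ w) n ≡⟨ ⊛-assoc bernoulli exp w n ⟩
    (bernoulli ⊛ (exp ⊛ w)) n ≡⟨ ⊛-cong (λ _ → refl) (⊛-comm exp w) n ⟩
    (bernoulli ⊛ (w ⊛ exp)) n ≡⟨ ⊛-cong (λ _ → refl) w-exp n ⟩
    bw n ∎

mutual
  cosh : Seq
  cosh zero = 1ℚ
  cosh (suc n) = sinh n

  sinh : Seq
  sinh zero = 0ℚ
  sinh (suc n) = cosh n

exp⁻ : Seq
exp⁻ = (- 1ℚ) · sinh ⊕ cosh

exp-cosh-sinh : exp ≗ sinh ⊕ cosh
exp-cosh-sinh zero = refl
exp-cosh-sinh (suc n) = trans (exp-cosh-sinh n) (ℚₚ.+-comm (sinh n) (cosh n))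

D-exp⁻ : D exp⁻ ≗ (- 1ℚ) · exp⁻
D-exp⁻ n = lemma (cosh n) (sinh n)
  where
  lemma : ∀ c s → - 1ℚ * c + s ≡ - 1ℚ * (- 1ℚ * s + c)
  lemma = solve-∀ ℚ-ring

double-exp-exp⁻ : double exp ⊛ exp⁻ ≗ exp
double-exp-exp⁻ zero = refl
double-exp-exp⁻ (suc n) = begin
  (D (double exp) ⊛ exp⁻) n + (double exp ⊛ D exp⁻) n
    ≡⟨ cong₂ _+_ (⊛-cong (double-D exp) (λ _ → refl) n) (⊛-cong (λ _ → refl) D-exp⁻ n) ⟩
  (2ℚ · double exp ⊛ exp⁻) n + (double exp ⊛ (- 1ℚ) · exp⁻) n
    ≡⟨ cong₂ _+_ (⊛-scaleˡ 2ℚ (double exp) exp⁻ n) (⊛-scaleʳ (- 1ℚ) (double exp) exp⁻ n) ⟩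
  2ℚ * (double exp ⊛ exp⁻) n + - 1ℚ * (double exp ⊛ exp⁻) n
    ≡⟨ lemma ((double exp ⊛ exp⁻) n) ⟩
  (double exp ⊛ exp⁻) n
    ≡⟨ double-exp-exp⁻ n ⟩
  1ℚ ∎
  where
  lemma : ∀ y → 2ℚ * y + - 1ℚ * y ≡ y
  lemma = solve-∀ ℚ-ring

-- x tanh x − x, that is, Σ 2^n (2^n − 1) B_n x^n / n!.
γ : Seq
γ = double δ

γ-cosh : ∀ n → (γ ⊛ cosh) n + (𝕩 ⊛ cosh) n ≡ (𝕩 ⊛ sinh) n
γ-cosh n = halve (begin
  (γ ⊛ exp) n + (γ ⊛ exp⁻) n + 2ℚ * (𝕩 ⊛ exp⁻) n
    ≡⟨ cong (λ a → a + (γ ⊛ exp⁻) n + 2ℚ * (𝕩 ⊛ exp⁻) n) (trans (⊛-cong (λ _ → refl) (λ k → sym (double-exp-exp⁻ k)) n) (sym (⊛-assoc γ (double exp) exp⁻ n))) ⟩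
  ((γ ⊛ double exp) ⊛ exp⁻) n + (γ ⊛ exp⁻) n + 2ℚ * (𝕩 ⊛ exp⁻) n
    ≡⟨ cong (λ a → ((γ ⊛ double exp) ⊛ exp⁻) n + (γ ⊛ exp⁻) n + a) (⊛-scaleˡ 2ℚ 𝕩 exp⁻ n) ⟨
  ((γ ⊛ double exp) ⊛ exp⁻) n + (γ ⊛ exp⁻) n + (2ℚ · 𝕩 ⊛ exp⁻) n
    ≡⟨ cong (_+ (2ℚ · 𝕩 ⊛ exp⁻) n) (⊛-distribʳ (γ ⊛ double exp) γ exp⁻ n) ⟨
  ((γ ⊛ double exp ⊕ γ) ⊛ exp⁻) n + (2ℚ · 𝕩 ⊛ exp⁻) n
    ≡⟨ ⊛-distribʳ (γ ⊛ double exp ⊕ γ) (2ℚ · 𝕩) exp⁻ n ⟨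
  ((γ ⊛ double exp ⊕ γ ⊕ 2ℚ · 𝕩) ⊛ exp⁻) n
    ≡⟨ ⊛-cong γ-double-exp (λ _ → refl) n ⟩
  ((λ _ → 0ℚ) ⊛ exp⁻) n
    ≡⟨ ⊛-zeroˡ exp⁻ n ⟩
  0ℚ ∎)
  where
  γ-double-exp : ∀ k → (γ ⊛ double exp) k + γ k + 2ℚ * 𝕩 k ≡ 0ℚ
  γ-double-exp k = begin
    (γ ⊛ double exp) k + γ k + 2ℚ * 𝕩 k
      ≡⟨ cong₂ (λ a b → a + γ k + b) (sym (double-⊛ δ exp k)) (sym (double-𝕩 k)) ⟩
    p * (δ ⊛ exp) k + p * δ k + p * 𝕩 k
      ≡⟨ lemma p ((δ ⊛ exp) k) (δ k) (𝕩 k) ⟩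
    p * ((δ ⊛ exp) k + δ k + 𝕩 k)
      ≡⟨ cong (p *_) (δ-exp k) ⟩
    p * 0ℚ
      ≡⟨ ℚₚ.*-zeroʳ p ⟩
    0ℚ ∎
    where
    p = ℕ→ℚ (2 ^ k)
    lemma : ∀ p a b c → p * a + p * b + p * c ≡ p * (a + b + c)
    lemma = solve-∀ ℚ-ring
  split : ∀ f → (f ⊛ exp⁻) n ≡ - 1ℚ * (f ⊛ sinh) n + (f ⊛ cosh) n
  split f = trans (⊛-distribˡ f ((- 1ℚ) · sinh) cosh n) (cong (_+ (f ⊛ cosh) n) (⊛-scaleʳ (- 1ℚ) f sinh n))
  split-exp : (γ ⊛ exp) n ≡ (γ ⊛ sinh) n + (γ ⊛ cosh) n
  split-exp = trans (⊛-cong (λ _ → refl) exp-cosh-sinh n) (⊛-distribˡ γ sinh cosh n)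
  halve : (γ ⊛ exp) n + (γ ⊛ exp⁻) n + 2ℚ * (𝕩 ⊛ exp⁻) n ≡ 0ℚ → (γ ⊛ cosh) n + (𝕩 ⊛ cosh) n ≡ (𝕩 ⊛ sinh) n
  halve eq = *-cancelˡ-suc 1 (begin
    2ℚ * ((γ ⊛ cosh) n + (𝕩 ⊛ cosh) n)
      ≡⟨ lemma ((γ ⊛ sinh) n) ((γ ⊛ cosh) n) ((𝕩 ⊛ sinh) n) ((𝕩 ⊛ cosh) n) ⟩
    (γ ⊛ sinh) n + (γ ⊛ cosh) n + (- 1ℚ * (γ ⊛ sinh) n + (γ ⊛ cosh) n) +
      2ℚ * (- 1ℚ * (𝕩 ⊛ sinh) n + (𝕩 ⊛ cosh) n) + 2ℚ * (𝕩 ⊛ sinh) n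
      ≡⟨ cong (_+ 2ℚ * (𝕩 ⊛ sinh) n) (cong₂ _+_ (cong₂ _+_ split-exp (split γ)) (cong (2ℚ *_) (split 𝕩))) ⟨
    (γ ⊛ exp) n + (γ ⊛ exp⁻) n + 2ℚ * (𝕩 ⊛ exp⁻) n + 2ℚ * (𝕩 ⊛ sinh) n
      ≡⟨ cong (_+ 2ℚ * (𝕩 ⊛ sinh) n) eq ⟩
    0ℚ + 2ℚ * (𝕩 ⊛ sinh) n
      ≡⟨ ℚₚ.+-identityˡ (2ℚ * (𝕩 ⊛ sinh) n) ⟩
    2ℚ * (𝕩 ⊛ sinh) n ∎)
    where
    lemma : ∀ gs gc xs xc → 2ℚ * (gc + xc) ≡ gs + gc + (- 1ℚ * gs + gc) + 2ℚ * (- 1ℚ * xs + xc) + 2ℚ * xs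
    lemma = solve-∀ ℚ-ring

-- Powers of the tangent

-- The n-th derivatives at 0 of tanh^m and of tan^m.
tanhPow : ℕ → Seq
tanhPow zero    zero = 1ℚ
tanhPow (suc m) zero = 0ℚ
tanhPow zero    (suc n) = 0ℚ
tanhPow (suc m) (suc n) = ℕ→ℚ (suc m) * (tanhPow m n - tanhPow (suc (suc m)) n)

tanPow : ℕ → ℕ → ℕ
tanPow zero    zero = 1
tanPow (suc m) zero = 0
tanPow zero    (suc n) = 0
tanPow (suc m) (suc n) = suc m ℕ.* (tanPow m n ℕ.+ tanPow (suc (suc m)) n)

tanhPow-0 : tanhPow 0 ≗ 𝟙
tanhPow-0 zero = refl
tanhPow-0 (suc n) = refl

-- Identifies the series defined by (tanh^m)′ = m (tanh^{m-1} - tanh^{m+1}) with powers of sinh x /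
-- cosh x. The induction is on the degree for all exponents at once, because differentiation reaches
-- both neighbouring exponents.
tanhPow-cosh : ∀ m → tanhPow (suc m) ⊛ cosh ≗ tanhPow m ⊛ sinh
tanhPow-cosh zero    zero = refl
tanhPow-cosh (suc m) zero = refl
tanhPow-cosh m (suc n) = begin
  (D T₁ ⊛ cosh) n + (T₁ ⊛ sinh) n
    ≡⟨ cong (_+ (T₁ ⊛ sinh) n) (derivative (suc m) cosh) ⟩
  ℕ→ℚ (suc m) * ((tanhPow m ⊛ cosh) n - (T₂ ⊛ cosh) n) + (T₁ ⊛ sinh) n
    ≡⟨ cong (λ y → ℕ→ℚ (suc m) * ((tanhPow m ⊛ cosh) n - y) + (T₁ ⊛ sinh) n) (tanhPow-cosh (suc m) n) ⟩
  ℕ→ℚ (suc m) * ((tanhPow m ⊛ cosh) n - (T₁ ⊛ sinh) n) + (T₁ ⊛ sinh) n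
    ≡⟨ finish m ⟩
  (D (tanhPow m) ⊛ sinh) n + (tanhPow m ⊛ cosh) n ∎
  where
  T₁ = tanhPow (suc m)
  T₂ = tanhPow (suc (suc m))
  -- The power with exponent m - 1. Its value at m = 0 is a default that always comes with the
  -- factor m.
  below : ℕ → Seq
  below zero = λ _ → 0ℚ
  below (suc m) = tanhPow m
  below-cosh : ∀ m → ℕ→ℚ m * (tanhPow m ⊛ cosh) n ≡ ℕ→ℚ m * (below m ⊛ sinh) n
  below-cosh zero = trans (ℚₚ.*-zeroˡ ((tanhPow 0 ⊛ cosh) n)) (sym (ℚₚ.*-zeroˡ ((below 0 ⊛ sinh) n)))
  below-cosh (suc m) = cong (ℕ→ℚ (suc m) *_) (tanhPow-cosh m n)
  derivative : ∀ m u → (D (tanhPow m) ⊛ u) n ≡ ℕ→ℚ m * ((below m ⊛ u) n - (tanhPow (suc m) ⊛ u) n)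
  derivative zero    u = trans (⊛-zeroˡ u n) (sym (ℚₚ.*-zeroˡ ((below 0 ⊛ u) n - (tanhPow 1 ⊛ u) n)))
  derivative (suc m) u = begin
    (D (tanhPow (suc m)) ⊛ u) n
      ≡⟨ ⊛-cong (λ k → cong (ℕ→ℚ (suc m) *_) (minus (tanhPow m k) (tanhPow (suc (suc m)) k))) (λ _ → refl) n ⟩
    (ℕ→ℚ (suc m) · ((- 1ℚ) · tanhPow (suc (suc m)) ⊕ tanhPow m) ⊛ u) n
      ≡⟨ ⊛-scaleˡ (ℕ→ℚ (suc m)) _ u n ⟩
    ℕ→ℚ (suc m) * (((- 1ℚ) · tanhPow (suc (suc m)) ⊕ tanhPow m) ⊛ u) n
      ≡⟨ cong (ℕ→ℚ (suc m) *_) (trans (⊛-linear (- 1ℚ) (tanhPow (suc (suc m))) (tanhPow m) u n) (sym (minus ((tanhPow m ⊛ u) n) _))) ⟩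
    ℕ→ℚ (suc m) * ((tanhPow m ⊛ u) n - (tanhPow (suc (suc m)) ⊛ u) n) ∎
    where
    minus : ∀ x y → x - y ≡ - 1ℚ * y + x
    minus = solve-∀ ℚ-ring
  finish : ∀ m → ℕ→ℚ (suc m) * ((tanhPow m ⊛ cosh) n - (tanhPow (suc m) ⊛ sinh) n) + (tanhPow (suc m) ⊛ sinh) n ≡
                 (D (tanhPow m) ⊛ sinh) n + (tanhPow m ⊛ cosh) n
  finish m = begin
    ℕ→ℚ (suc m) * (x - y) + y ≡⟨ cong (λ k → k * (x - y) + y) (ℕ→ℚ-suc m) ⟩
    (1ℚ + ℕ→ℚ m) * (x - y) + y ≡⟨ lemma (ℕ→ℚ m) x y ⟩
    (ℕ→ℚ m * x - ℕ→ℚ m * y) + x ≡⟨ cong (λ z → (z - ℕ→ℚ m * y) + x) (below-cosh m) ⟩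
    (ℕ→ℚ m * (below m ⊛ sinh) n - ℕ→ℚ m * y) + x ≡⟨ lemma₂ (ℕ→ℚ m) ((below m ⊛ sinh) n) x y ⟩
    ℕ→ℚ m * ((below m ⊛ sinh) n - y) + x ≡⟨ cong (_+ x) (derivative m sinh) ⟨
    (D (tanhPow m) ⊛ sinh) n + x ∎
    where
    x = (tanhPow m ⊛ cosh) n
    y = (tanhPow (suc m) ⊛ sinh) n
    lemma : ∀ m x y → (1ℚ + m) * (x - y) + y ≡ (m * x - m * y) + x
    lemma = solve-∀ ℚ-ring
    lemma₂ : ∀ m b x y → (m * b - m * y) + x ≡ m * (b - y) + x
    lemma₂ = solve-∀ ℚ-ring

x·tanh : Seq
x·tanh = 𝕩 ⊛ tanhPow 1

x·tanh-cosh : x·tanh ⊛ cosh ≗ 𝕩 ⊛ sinh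
x·tanh-cosh n = trans (⊛-assoc 𝕩 (tanhPow 1) cosh n)
  (⊛-cong (λ _ → refl) (λ k → trans (tanhPow-cosh 0 k) (trans (⊛-cong tanhPow-0 (λ _ → refl) k) (⊛-identityˡ sinh k))) n)

γ+𝕩≗x·tanh : γ ⊕ 𝕩 ≗ x·tanh
γ+𝕩≗x·tanh n = trans (lemma (γ n + 𝕩 n) (x·tanh n)) (trans (cong (_+ x·tanh n) (⊛-cancel h cosh refl h-cosh n)) (ℚₚ.+-identityˡ (x·tanh n)))
  where
  lemma : ∀ a b → a ≡ (- 1ℚ * b + a) + b
  lemma = solve-∀ ℚ-ring
  h : Seq
  h = (- 1ℚ) · x·tanh ⊕ (γ ⊕ 𝕩)
  inverse : ∀ a → - 1ℚ * a + a ≡ 0ℚ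
  inverse = solve-∀ ℚ-ring
  h-cosh : h ⊛ cosh ≗ (λ _ → 0ℚ)
  h-cosh n = trans (⊛-linear (- 1ℚ) x·tanh (γ ⊕ 𝕩) cosh n)
    (trans (cong₂ (λ a b → - 1ℚ * a + b) (x·tanh-cosh n) (trans (⊛-distribʳ γ 𝕩 cosh n) (γ-cosh n)))
           (inverse ((𝕩 ⊛ sinh) n)))

parity : ℕ → Bool
parity zero = false
parity (suc n) = not (parity n)

HasParity : Bool → Seq → Set
HasParity p f = ∀ n → parity n ≢ p → f n ≡ 0ℚ

D-parity : ∀ {p f} → HasParity p f → HasParity (not p) (D f)
D-parity h n n≢ = h (suc n) (λ eq → n≢ (trans (sym (Boolₚ.not-involutive _)) (cong not eq)))

⊛-parity : ∀ {p q f g} → HasParity p f → HasParity q g → HasParity (p xor q) (f ⊛ g)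
⊛-parity {false} {false} {f} {g} hf hg zero n≢ = ⊥-elim (n≢ refl)
⊛-parity {true}  {true}  {f} {g} hf hg zero n≢ = ⊥-elim (n≢ refl)
⊛-parity {false} {true}  {f} {g} hf hg zero n≢ = trans (cong (f 0 *_) (hg 0 (λ ()))) (ℚₚ.*-zeroʳ (f 0))
⊛-parity {true}  {false} {f} {g} hf hg zero n≢ = trans (cong (_* g 0) (hf 0 (λ ()))) (ℚₚ.*-zeroˡ (g 0))
⊛-parity {p} {q} {f} {g} hf hg (suc n) n≢ = cong₂ _+_
  (⊛-parity {not p} {q} {D f} {g} (D-parity {p} hf) hg n (λ eq → n≢ (trans (cong not eq) (not-xorˡ p q))))
  (⊛-parity {p} {not q} {f} {D g} hf (D-parity {q} hg) n (λ eq → n≢ (trans (cong not eq) (not-xorʳ p q))))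
  where
  not-xorˡ : ∀ p q → not (not p xor q) ≡ p xor q
  not-xorˡ false q = Boolₚ.not-involutive q
  not-xorˡ true  q = refl
  not-xorʳ : ∀ p q → not (p xor not q) ≡ p xor q
  not-xorʳ false q = Boolₚ.not-involutive q
  not-xorʳ true  q = cong not (Boolₚ.not-involutive q)

mutual
  cosh-even : HasParity false cosh
  cosh-even zero    n≢ = ⊥-elim (n≢ refl)
  cosh-even (suc n) n≢ = sinh-odd n (λ eq → n≢ (cong not eq))

  sinh-odd : HasParity true sinh
  sinh-odd zero    n≢ = refl
  sinh-odd (suc n) n≢ = cosh-even n (λ eq → n≢ (cong not eq))

tanhPow-parity : ∀ m → HasParity (parity m) (tanhPow m)
tanhPow-parity zero    zero    n≢ = ⊥-elim (n≢ refl)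
tanhPow-parity (suc m) zero    n≢ = refl
tanhPow-parity zero    (suc n) n≢ = refl
tanhPow-parity (suc m) (suc n) n≢ = trans
  (cong₂ (λ a b → ℕ→ℚ (suc m) * (a - b))
    (tanhPow-parity m n (λ eq → n≢ (cong not eq)))
    (tanhPow-parity (suc (suc m)) n (λ eq → n≢ (cong not (trans eq (Boolₚ.not-involutive (parity m)))))))
  (ℚₚ.*-zeroʳ (ℕ→ℚ (suc m)))

𝕩-odd : HasParity true 𝕩
𝕩-odd zero          _  = refl
𝕩-odd (suc zero)    n≢ = ⊥-elim (n≢ refl)
𝕩-odd (suc (suc n)) _  = refl

x·tanh-even : HasParity false x·tanh
x·tanh-even = ⊛-parity {true} {true} {𝕩} {tanhPow 1} 𝕩-odd (tanhPow-parity 1)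

dbl : ℕ → ℕ
dbl zero = zero
dbl (suc n) = suc (suc (dbl n))

dbl≡2* : ∀ n → dbl n ≡ 2 ℕ.* n
dbl≡2* zero = refl
dbl≡2* (suc n) = trans (cong (λ k → suc (suc k)) (dbl≡2* n)) (cong suc (sym (ℕₚ.+-suc n (n ℕ.+ 0))))

parity-dbl : ∀ n → parity (dbl n) ≡ false
parity-dbl zero = refl
parity-dbl (suc n) = trans (Boolₚ.not-involutive _) (parity-dbl n)

Sum-even : ∀ {F} → HasParity false F → ∀ i n → Sum F (dbl i) (suc (dbl n)) ≡ Sum (λ l → F (dbl l)) i (suc n)
Sum-even         hF i zero = refl
Sum-even {F} hF i (suc n) = cong (F (dbl i) +_)
  (trans (cong (_+ Sum F (dbl (suc i)) (suc (dbl n))) (hF (suc (dbl i)) odd)) (trans (ℚₚ.+-identityˡ _) (Sum-even hF (suc i) n)))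
  where
  odd : parity (suc (dbl i)) ≢ false
  odd eq with trans (sym (cong not (parity-dbl i))) eq
  ... | ()

sinh-odd-1 : ∀ n → sinh (suc (dbl n)) ≡ 1ℚ
sinh-odd-1 zero = refl
sinh-odd-1 (suc n) = sinh-odd-1 n

evenTerm : ℕ → ℕ → ℚ
evenTerm N l = ℕ→ℚ (dbl N C dbl l) * x·tanh (dbl l)

-- The coefficient of x tanh x · e^x in degree 2N + 2. The factor e^x gives the plain binomial sum;
-- by parity only the part x tanh x cosh x = x sinh x contributes, and the term of index 0 is zero.
Sum-evenTerm : ∀ N → Sum (evenTerm (suc N)) 1 (suc N) ≡ ℕ→ℚ (dbl (suc N))
Sum-evenTerm N = begin
  Sum (evenTerm (suc N)) 1 (suc N)
    ≡⟨ sym (trans (cong (_+ Sum (evenTerm (suc N)) 1 (suc N)) (ℚₚ.*-zeroʳ 1ℚ)) (ℚₚ.+-identityˡ _)) ⟩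
  Sum (evenTerm (suc N)) 0 (suc (suc N))
    ≡⟨ Sum-even {binomial M x·tanh} (λ n n≢ → trans (cong (ℕ→ℚ (M C n) *_) (x·tanh-even n n≢)) (ℚₚ.*-zeroʳ (ℕ→ℚ (M C n)))) 0 (suc N) ⟨
  Sum (binomial M x·tanh) 0 (suc M)
    ≡⟨ ⊛-exp x·tanh M ⟨
  (x·tanh ⊛ exp) M
    ≡⟨ trans (⊛-cong (λ _ → refl) exp-cosh-sinh M) (⊛-distribˡ x·tanh sinh cosh M) ⟩
  (x·tanh ⊛ sinh) M + (x·tanh ⊛ cosh) M
    ≡⟨ cong₂ _+_ (⊛-parity {false} {true} {x·tanh} {sinh} x·tanh-even sinh-odd M M-not-odd) (x·tanh-cosh M) ⟩
  0ℚ + (𝕩 ⊛ sinh) M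
    ≡⟨ ℚₚ.+-identityˡ ((𝕩 ⊛ sinh) M) ⟩
  (𝕩 ⊛ sinh) M
    ≡⟨ 𝕩-⊛ sinh (suc (dbl N)) ⟩
  ℕ→ℚ M * sinh (suc (dbl N))
    ≡⟨ trans (cong (ℕ→ℚ M *_) (sinh-odd-1 N)) (ℚₚ.*-identityʳ (ℕ→ℚ M)) ⟩
  ℕ→ℚ M ∎
  where
  M = dbl (suc N)
  M-not-odd : parity M ≢ true
  M-not-odd eq with trans (sym eq) (parity-dbl (suc N))
  ... | ()

sign : ℕ → ℚ
sign zero = 1ℚ
sign (suc n) = - sign n

sign² : ∀ n → sign n * sign n ≡ 1ℚ
sign² zero = refl
sign² (suc n) = trans (lemma (sign n)) (sign² n)
  where
  lemma : ∀ x → (- x) * (- x) ≡ x * x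
  lemma = solve-∀ ℚ-ring

tanhPow-< : ∀ m n → n ℕ.< m → tanhPow m n ≡ 0ℚ
tanhPow-< (suc m) zero    _ = refl
tanhPow-< (suc m) (suc n) (ℕ.s≤s n<m) = trans
  (cong₂ (λ a b → ℕ→ℚ (suc m) * (a - b)) (tanhPow-< m n n<m) (tanhPow-< (suc (suc m)) n (ℕₚ.<-trans n<m (ℕₚ.m<n+m m {2} (ℕ.s≤s ℕ.z≤n)))))
  (ℚₚ.*-zeroʳ (ℕ→ℚ (suc m)))

tanPow-< : ∀ m n → n ℕ.< m → tanPow m n ≡ 0
tanPow-< (suc m) zero    _ = refl
tanPow-< (suc m) (suc n) (ℕ.s≤s n<m) = trans
  (cong₂ (λ a b → suc m ℕ.* (a ℕ.+ b)) (tanPow-< m n n<m) (tanPow-< (suc (suc m)) n (ℕₚ.<-trans n<m (ℕₚ.m<n+m m {2} (ℕ.s≤s ℕ.z≤n)))))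
  (ℕₚ.*-zeroʳ (suc m))

-- From tanh(ix) = i tan x: in degree m + 2k the coefficients of tanh^m and tan^m differ by the
-- factor (-1)^k. In the recursion the higher exponent lowers k by one, and this sign turns the
-- difference into a sum.
tanhPow-tanPow : ∀ n m k → n ≡ dbl k ℕ.+ m → tanhPow m n ≡ sign k * ℕ→ℚ (tanPow m n)
tanhPow-tanPow zero    zero    zero    eq = refl
tanhPow-tanPow (suc n) zero    k       eq = sym (ℚₚ.*-zeroʳ (sign k))
tanhPow-tanPow zero    (suc m) k       eq = sym (ℚₚ.*-zeroʳ (sign k))
tanhPow-tanPow (suc n) (suc m) k       eq = begin
  ℕ→ℚ (suc m) * (tanhPow m n - tanhPow (suc (suc m)) n)
    ≡⟨ cong₂ (λ a b → ℕ→ℚ (suc m) * (a - b)) (tanhPow-tanPow n m k eq′) (upper k eq′) ⟩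
  ℕ→ℚ (suc m) * (sign k * ℕ→ℚ (tanPow m n) - - sign k * ℕ→ℚ (tanPow (suc (suc m)) n))
    ≡⟨ lemma (ℕ→ℚ (suc m)) (sign k) (ℕ→ℚ (tanPow m n)) (ℕ→ℚ (tanPow (suc (suc m)) n)) ⟩
  sign k * (ℕ→ℚ (suc m) * (ℕ→ℚ (tanPow m n) + ℕ→ℚ (tanPow (suc (suc m)) n)))
    ≡⟨ cong (λ a → sign k * (ℕ→ℚ (suc m) * a)) (ℕ→ℚ-+ (tanPow m n) (tanPow (suc (suc m)) n)) ⟨
  sign k * (ℕ→ℚ (suc m) * ℕ→ℚ (tanPow m n ℕ.+ tanPow (suc (suc m)) n))
    ≡⟨ cong (sign k *_) (ℕ→ℚ-* (suc m) (tanPow m n ℕ.+ tanPow (suc (suc m)) n)) ⟨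
  sign k * ℕ→ℚ (tanPow (suc m) (suc n)) ∎
  where
  eq′ : n ≡ dbl k ℕ.+ m
  eq′ = ℕₚ.suc-injective (trans eq (ℕₚ.+-suc (dbl k) m))
  lemma : ∀ c s a b → c * (s * a - - s * b) ≡ s * (c * (a + b))
  lemma = solve-∀ ℚ-ring
  upper : ∀ k → n ≡ dbl k ℕ.+ m → tanhPow (suc (suc m)) n ≡ - sign k * ℕ→ℚ (tanPow (suc (suc m)) n)
  -- Here the degree is m and the exponent m + 2 exceeds it, so both values are 0.
  upper zero    refl = trans (tanhPow-< (suc (suc m)) m n<2+n)
    (sym (trans (cong (λ t → - 1ℚ * ℕ→ℚ t) (tanPow-< (suc (suc m)) m n<2+n)) (ℚₚ.*-zeroʳ (- 1ℚ))))
    where n<2+n = ℕₚ.m<n+m m {2} (ℕ.s≤s ℕ.z≤n)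
  upper (suc k) refl = trans (tanhPow-tanPow n (suc (suc m)) k (sym (trans (ℕₚ.+-suc (dbl k) (suc m)) (cong suc (ℕₚ.+-suc (dbl k) m)))))
    (cong (_* ℕ→ℚ (tanPow (suc (suc m)) n)) (neg (sign k)))
    where
    neg : ∀ s → s ≡ - - s
    neg = solve-∀ ℚ-ring

-- The tangent numbers 1, 2, 16, 272, ...
tangent : ℕ → ℕ
tangent i = tanPow 1 (suc (dbl i))

x·tanh-tangent : ∀ i → x·tanh (dbl (suc i)) ≡ ℕ→ℚ (dbl (suc i)) * (sign i * ℕ→ℚ (tangent i))
x·tanh-tangent i = trans (𝕩-⊛ (tanhPow 1) (suc (dbl i)))
  (cong (ℕ→ℚ (dbl (suc i)) *_) (tanhPow-tanPow (suc (dbl i)) 1 i (ℕₚ.+-comm 1 (dbl i))))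

-- (2i)! times the value |4^i (4^i − 1) B_{2i}| / (2 (2i)!) of the i-th power sum under θ
powerSum : ℕ → ℕ
powerSum zero = 0
powerSum (suc i) = suc i ℕ.* tangent i

-- Σ_j (−1)^j π_{i+j} C(2(i+m), 2(i+j)) for j = 0, …, m, where π_i = powerSum i
alternatingSum : ℕ → ℕ → ℚ
alternatingSum i zero = ℕ→ℚ (powerSum i)
alternatingSum i (suc m) =
  ℕ→ℚ (powerSum i) * ℕ→ℚ (dbl (i ℕ.+ suc m) C dbl i) - alternatingSum (suc i) m

2*powerSum : ∀ i → 2ℚ * ℕ→ℚ (powerSum (suc i)) ≡ sign i * x·tanh (dbl (suc i))
2*powerSum i = begin
  2ℚ * ℕ→ℚ (suc i ℕ.* tangent i)
    ≡⟨ cong (2ℚ *_) (ℕ→ℚ-* (suc i) (tangent i)) ⟩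
  2ℚ * (ℕ→ℚ (suc i) * ℕ→ℚ (tangent i))
    ≡⟨ lemma 2ℚ (ℕ→ℚ (suc i)) (ℕ→ℚ (tangent i)) ⟩
  1ℚ * ((2ℚ * ℕ→ℚ (suc i)) * ℕ→ℚ (tangent i))
    ≡⟨ cong₂ (λ a b → a * (b * ℕ→ℚ (tangent i))) (sym (sign² i)) (trans (sym (ℕ→ℚ-* 2 (suc i))) (cong ℕ→ℚ (sym (dbl≡2* (suc i))))) ⟩
  sign i * sign i * (ℕ→ℚ (dbl (suc i)) * ℕ→ℚ (tangent i))
    ≡⟨ lemma₂ (sign i) (ℕ→ℚ (dbl (suc i))) (ℕ→ℚ (tangent i)) ⟩
  sign i * (ℕ→ℚ (dbl (suc i)) * (sign i * ℕ→ℚ (tangent i)))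
    ≡⟨ cong (sign i *_) (x·tanh-tangent i) ⟨
  sign i * x·tanh (dbl (suc i)) ∎
  where
  lemma : ∀ t a b → t * (a * b) ≡ 1ℚ * ((t * a) * b)
  lemma = solve-∀ ℚ-ring
  lemma₂ : ∀ s a b → s * s * (a * b) ≡ s * (a * (s * b))
  lemma₂ = solve-∀ ℚ-ring

-- The signs (-1)^j cancel those of the coefficients of tanh, so that a plain binomial sum over
-- coefficients of x tanh x remains, up to the sign of its first term.
2*alternatingSum : ∀ m i N → N ≡ suc i ℕ.+ m →
  2ℚ * alternatingSum (suc i) m ≡ sign i * Sum (evenTerm N) (suc i) (suc m)
2*alternatingSum zero    i N refl = trans (2*powerSum i) (cong (sign i *_)
  (trans (lemma (x·tanh (dbl (suc i)))) (cong (_+ 0ℚ) (trans (cong (λ k → ℕ→ℚ k * x·tanh (dbl (suc i))) (sym (nCn≡1 (dbl (suc i)))))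
    (cong (λ k → ℕ→ℚ (dbl (suc k) C dbl (suc i)) * x·tanh (dbl (suc i))) (sym (ℕₚ.+-identityʳ i)))))))
  where
  lemma : ∀ x → x ≡ 1ℚ * x + 0ℚ
  lemma = solve-∀ ℚ-ring
2*alternatingSum (suc m) i N refl = begin
  2ℚ * (p * c - z) ≡⟨ lemma 2ℚ p c z ⟩
  (2ℚ * p) * c - 2ℚ * z ≡⟨ cong₂ (λ a b → a * c - b) (2*powerSum i) (2*alternatingSum m (suc i) N (ℕₚ.+-suc (suc i) m)) ⟩
  (sign i * h) * c - (- sign i) * s ≡⟨ lemma₂ (sign i) h c s ⟩
  sign i * (c * h + s) ∎
  where
  p = ℕ→ℚ (powerSum (suc i))
  c = ℕ→ℚ (dbl N C dbl (suc i))
  z = alternatingSum (suc (suc i)) m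
  h = x·tanh (dbl (suc i))
  s = Sum (evenTerm N) (suc (suc i)) (suc m)
  lemma : ∀ t p c z → t * (p * c - z) ≡ (t * p) * c - t * z
  lemma = solve-∀ ℚ-ring
  lemma₂ : ∀ s h c t → (s * h) * c - (- s) * t ≡ s * (c * h + t)
  lemma₂ = solve-∀ ℚ-ring

-- Newton's identity (m + 1) e_{m+1} = q_{1,m} under θ with θ(e_m) = 1 / (2m)!, multiplied by (2m +
-- 2)!.
alternatingSum-1 : ∀ m → alternatingSum 1 m ≡ ℕ→ℚ (suc m)
alternatingSum-1 m = *-cancelˡ-suc 1 (begin
  2ℚ * alternatingSum 1 m ≡⟨ 2*alternatingSum m 0 (suc m) refl ⟩
  1ℚ * Sum (evenTerm (suc m)) 1 (suc m) ≡⟨ ℚₚ.*-identityˡ (Sum (evenTerm (suc m)) 1 (suc m)) ⟩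
  Sum (evenTerm (suc m)) 1 (suc m) ≡⟨ Sum-evenTerm m ⟩
  ℕ→ℚ (dbl (suc m)) ≡⟨ cong ℕ→ℚ (dbl≡2* (suc m)) ⟩
  ℕ→ℚ (2 ℕ.* suc m) ≡⟨ ℕ→ℚ-* 2 (suc m) ⟩
  2ℚ * ℕ→ℚ (suc m) ∎)

∣ℕ→ℚ∣ : ∀ n → ∣ ℕ→ℚ n ∣ ≡ ℕ→ℚ n
∣ℕ→ℚ∣ n = ℚₚ.0≤p⇒∣p∣≡p (ℚₚ.nonNegative⁻¹ (ℕ→ℚ n) {{ℚₚ.normalize-nonNeg n 1}})

∣sign*ℕ∣ : ∀ k n → ∣ sign k * ℕ→ℚ n ∣ ≡ ℕ→ℚ n
∣sign*ℕ∣ zero    n = trans (cong ∣_∣ (ℚₚ.*-identityˡ (ℕ→ℚ n))) (∣ℕ→ℚ∣ n)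
∣sign*ℕ∣ (suc k) n = trans (cong ∣_∣ (sym (ℚₚ.neg-distribˡ-* (sign k) (ℕ→ℚ n))))
  (trans (ℚₚ.∣-p∣≡∣p∣ (sign k * ℕ→ℚ n)) (∣sign*ℕ∣ k n))

-- The coefficient of γ in degree 2k, where 2^{2k} = 4^k; in even degrees the summand x of γ + x
-- contributes nothing.
tanCoeff-numerator : ∀ i → let k = suc i in
  ℕ→ℚ (4 ^ k ℕ.* (4 ^ k ∸ 1)) * bernoulli (2 ℕ.* k) ≡ x·tanh (2 ℕ.* k)
tanCoeff-numerator i = begin
  ℕ→ℚ (q ℕ.* (q ∸ 1)) * bernoulli M ≡⟨ cong (_* bernoulli M) (ℕ→ℚ-* q (q ∸ 1)) ⟩
  ℕ→ℚ q * ℕ→ℚ (q ∸ 1) * bernoulli M ≡⟨ lemma (ℕ→ℚ q) (ℕ→ℚ (q ∸ 1)) (bernoulli M) ⟩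
  ℕ→ℚ q * (- 1ℚ * bernoulli M + (1ℚ + ℕ→ℚ (q ∸ 1)) * bernoulli M)
    ≡⟨ cong (λ a → ℕ→ℚ q * (- 1ℚ * bernoulli M + a * bernoulli M)) (trans (sym (ℕ→ℚ-suc (q ∸ 1))) (cong ℕ→ℚ (ℕₚ.m+[n∸m]≡n 1≤q))) ⟩
  ℕ→ℚ q * (- 1ℚ * bernoulli M + ℕ→ℚ q * bernoulli M) ≡⟨ cong (λ a → ℕ→ℚ a * (- 1ℚ * bernoulli M + ℕ→ℚ a * bernoulli M)) (ℕₚ.^-*-assoc 2 2 k) ⟩
  γ M ≡⟨ ℚₚ.+-identityʳ (γ M) ⟨
  γ M + 0ℚ ≡⟨ cong (γ M +_) (𝕩-odd M M-even) ⟨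
  γ M + 𝕩 M ≡⟨ γ+𝕩≗x·tanh M ⟩
  x·tanh M ∎
  where
  k = suc i
  M = 2 ℕ.* k
  q = 4 ^ k
  1≤q : 1 ℕ.≤ q
  1≤q = ℕₚ.m^n>0 4 k
  M-even : parity M ≢ true
  M-even eq with trans (sym eq) (trans (cong parity (sym (dbl≡2* k))) (parity-dbl k))
  ... | ()
  lemma : ∀ q p b → q * p * b ≡ q * (- 1ℚ * b + (1ℚ + p) * b)
  lemma = solve-∀ ℚ-ring

∣tanCoeff∣*! : ∀ i → ∣ tanCoeff (suc i) ∣ * ℕ→ℚ ((2 ℕ.* suc i) !) ≡ ℕ→ℚ (tangent i)
∣tanCoeff∣*! i = begin
  ∣ tanCoeff k ∣ * ℕ→ℚ (M !) ≡⟨ cong (∣ tanCoeff k ∣ *_) (∣ℕ→ℚ∣ (M !)) ⟨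
  ∣ tanCoeff k ∣ * ∣ ℕ→ℚ (M !) ∣ ≡⟨ ℚₚ.∣p*q∣≡∣p∣*∣q∣ (tanCoeff k) (ℕ→ℚ (M !)) ⟨
  ∣ tanCoeff k * ℕ→ℚ (M !) ∣ ≡⟨ cong ∣_∣ signed ⟩
  ∣ sign i * ℕ→ℚ (tangent i) ∣ ≡⟨ ∣sign*ℕ∣ i (tangent i) ⟩
  ℕ→ℚ (tangent i) ∎
  where
  k = suc i
  M = 2 ℕ.* k
  num = ℕ→ℚ (4 ^ k ℕ.* (4 ^ k ∸ 1)) * bernoulli M
  instance
    M!≢0 : ℕ.NonZero (M !)
    M!≢0 = ℕₚ._!≢0 M
    M*M!≢0 : ℕ.NonZero (M ℕ.* M !)
    M*M!≢0 = ℕₚ.m*n≢0 M (M !)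
  rearrange : ∀ t m f → m * (t * f) ≡ t * (m * f)
  rearrange = solve-∀ ℚ-ring
  signed : tanCoeff k * ℕ→ℚ (M !) ≡ sign i * ℕ→ℚ (tangent i)
  signed = *-cancelˡ-suc (ℕ.pred M) (begin
    ℕ→ℚ M * (tanCoeff k * ℕ→ℚ (M !)) ≡⟨ rearrange (tanCoeff k) (ℕ→ℚ M) (ℕ→ℚ (M !)) ⟩
    tanCoeff k * (ℕ→ℚ M * ℕ→ℚ (M !)) ≡⟨ cong (tanCoeff k *_) (ℕ→ℚ-* M (M !)) ⟨
    tanCoeff k * ℕ→ℚ (M ℕ.* M !) ≡⟨ divℕ-* num (M ℕ.* M !) ⟩
    num ≡⟨ tanCoeff-numerator i ⟩
    x·tanh M ≡⟨ cong x·tanh (dbl≡2* k) ⟨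
    x·tanh (dbl k) ≡⟨ x·tanh-tangent i ⟩
    ℕ→ℚ (dbl k) * (sign i * ℕ→ℚ (tangent i)) ≡⟨ cong (λ a → ℕ→ℚ a * (sign i * ℕ→ℚ (tangent i))) (dbl≡2* k) ⟩
    ℕ→ℚ M * (sign i * ℕ→ℚ (tangent i)) ∎)

-- The Hall pairing with A_n

-- multiplication by x^m / m!
H : ℕ → Seq → Seq
H zero    f M = f M
H (suc m) f zero = 0ℚ
H (suc m) f (suc M) = H m f M + H (suc m) (D f) M

H-cong : ∀ m {f g} → f ≗ g → H m f ≗ H m g
H-cong zero    f≗g M = f≗g M
H-cong (suc m) f≗g zero = refl
H-cong (suc m) f≗g (suc M) = cong₂ _+_ (H-cong m f≗g M) (H-cong (suc m) (λ k → f≗g (suc k)) M)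

H-scale : ∀ m c f M → H m (c · f) M ≡ c * H m f M
H-scale zero    c f M = refl
H-scale (suc m) c f zero = sym (ℚₚ.*-zeroʳ c)
H-scale (suc m) c f (suc M) = trans (cong₂ _+_ (H-scale m c f M) (H-scale (suc m) c (D f) M))
                                    (sym (ℚₚ.*-distribˡ-+ c (H m f M) _))

H-0 : ∀ m M → H m (λ _ → 0ℚ) M ≡ 0ℚ
H-0 zero    M = refl
H-0 (suc m) zero = refl
H-0 (suc m) (suc M) = 0+0 (H-0 m M) (H-0 (suc m) M)

H-+ : ∀ m f g M → H m (f ⊕ g) M ≡ H m f M + H m g M
H-+ zero    f g M = refl
H-+ (suc m) f g zero = refl
H-+ (suc m) f g (suc M) = trans (cong₂ _+_ (H-+ m f g M) (H-+ (suc m) (D f) (D g) M)) (+-interchange (H m f M) _ _ _)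

H-H : ∀ a b f M → H a (H b f) M ≡ ℕ→ℚ ((a ℕ.+ b) C a) * H (a ℕ.+ b) f M
H-H zero    b       f M = sym (ℚₚ.*-identityˡ (H b f M))
H-H (suc a) zero    f M = sym (trans (cong (λ k → ℕ→ℚ (k C suc a) * H k f M) (ℕₚ.+-identityʳ (suc a)))
  (trans (cong (λ k → ℕ→ℚ k * H (suc a) f M) (nCn≡1 (suc a))) (trans (ℚₚ.*-identityˡ (H (suc a) f M)) refl)))
H-H (suc a) (suc b) f zero = sym (ℚₚ.*-zeroʳ (ℕ→ℚ ((suc a ℕ.+ suc b) C suc a)))
H-H (suc a) (suc b) f (suc M) = begin
  H a (H (suc b) f) M + H (suc a) (D (H (suc b) f)) M
    ≡⟨ cong₂ _+_ (H-H a (suc b) f M) (H-+ (suc a) (H b f) (H (suc b) (D f)) M) ⟩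
  ℕ→ℚ (n C a) * h + (H (suc a) (H b f) M + H (suc a) (H (suc b) (D f)) M)
    ≡⟨ cong₂ (λ x y → ℕ→ℚ (n C a) * h + (x + y)) (trans (H-H (suc a) b f M) (cong (λ k → ℕ→ℚ (k C suc a) * H k f M) (sym (ℕₚ.+-suc a b)))) (H-H (suc a) (suc b) (D f) M) ⟩
  ℕ→ℚ (n C a) * h + (ℕ→ℚ (n C suc a) * h + ℕ→ℚ (suc n C suc a) * h′)
    ≡⟨ lemma (ℕ→ℚ (n C a)) (ℕ→ℚ (n C suc a)) (ℕ→ℚ (suc n C suc a)) h h′ ⟩
  (ℕ→ℚ (n C a) + ℕ→ℚ (n C suc a)) * h + ℕ→ℚ (suc n C suc a) * h′
    ≡⟨ cong (λ x → x * h + ℕ→ℚ (suc n C suc a) * h′) (trans (sym (ℕ→ℚ-+ (n C a) (n C suc a))) (cong ℕ→ℚ (nCk+nC[k+1]≡[n+1]C[k+1] n a))) ⟩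
  ℕ→ℚ (suc n C suc a) * h + ℕ→ℚ (suc n C suc a) * h′
    ≡⟨ ℚₚ.*-distribˡ-+ (ℕ→ℚ (suc n C suc a)) h h′ ⟨
  ℕ→ℚ (suc n C suc a) * (h + h′) ∎
  where
  n = a ℕ.+ suc b
  h = H n f M
  h′ = H (suc n) (D f) M
  lemma : ∀ x y z h k → x * h + (y * h + z * k) ≡ (x + y) * h + z * k
  lemma = solve-∀ ℚ-ring

dbl-+ : ∀ m n → dbl (m ℕ.+ n) ≡ dbl m ℕ.+ dbl n
dbl-+ zero    n = refl
dbl-+ (suc m) n = cong (λ k → suc (suc k)) (dbl-+ m n)

-- The coefficient of x^{2n} / (2n)! in weight μ is ⟨(2n)! A_n, p_μ⟩ (scaledA-p).
weight : List ℕ → Seq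
weight [] = 𝟙
weight (i ∷ μ) = ℕ→ℚ (powerSum i) · H (dbl i) (weight μ)

-- Under θ each of p_i, e_m and q_{i,m} is a multiple of a single divided power, of exponent 2i, 2m
-- and 2(i + m). Newton's recursions thus reduce to identities between the scalar factors, and the
-- factor of e_m is 1.
weight-action : NewtonAction ℕ weight
weight-action = record
  { p = λ i f → ℕ→ℚ (powerSum i) · H (dbl i) f
  ; e = λ m → H (dbl m)
  ; q = λ i m f → alternatingSum i m · H (dbl (i ℕ.+ m)) f
  ; p-cong = λ i f≗g M → cong (ℕ→ℚ (powerSum i) *_) (H-cong (dbl i) f≗g M)
  ; p-0 = λ i M → trans (cong (ℕ→ℚ (powerSum i) *_) (H-0 (dbl i) M)) (ℚₚ.*-zeroʳ (ℕ→ℚ (powerSum i)))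
  ; p-linear = λ i c f g M → trans (cong (ℕ→ℚ (powerSum i) *_) (trans (H-+ (dbl i) (c · f) g M) (cong (_+ H (dbl i) g M) (H-scale (dbl i) c f M))))
                                   (lemma (ℕ→ℚ (powerSum i)) c (H (dbl i) f M) _)
  ; w-∷ = λ i μ M → refl
  ; e-0 = λ f M → refl
  ; e-suc = λ m f M → cong (_* H (dbl (suc m)) f M) (sym (alternatingSum-1 m))
  ; q-0 = λ i f M → cong (λ k → ℕ→ℚ (powerSum (suc i)) * H (dbl k) f M) (ℕₚ.+-identityʳ (suc i))
  ; q-suc = λ i m f M → q-suc i m f M
  }
  where
  lemma : ∀ p c x y → p * (c * x + y) ≡ c * (p * x) + p * y
  lemma = solve-∀ ℚ-ring
  q-suc : ∀ i m f M → let N = suc i ℕ.+ suc m in alternatingSum (suc i) (suc m) * H (dbl N) f M ≡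
          ℕ→ℚ (powerSum (suc i)) * H (dbl (suc i)) (H (dbl (suc m)) f) M - alternatingSum (suc (suc i)) m * H (dbl (suc (suc i) ℕ.+ m)) f M
  q-suc i m f M = begin
    (p * c - z) * h ≡⟨ distr p c z h ⟩
    p * (c * h) - z * h ≡⟨ cong₂ (λ x y → p * x - z * y) inner (cong (λ k → H (dbl k) f M) (ℕₚ.+-suc (suc i) m)) ⟩
    p * H (dbl (suc i)) (H (dbl (suc m)) f) M - z * H (dbl (suc (suc i) ℕ.+ m)) f M ∎
    where
    p = ℕ→ℚ (powerSum (suc i))
    N = suc i ℕ.+ suc m
    c = ℕ→ℚ (dbl N C dbl (suc i))
    z = alternatingSum (suc (suc i)) m
    h = H (dbl N) f M
    distr : ∀ p c z h → (p * c - z) * h ≡ p * (c * h) - z * h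
    distr = solve-∀ ℚ-ring
    inner : c * h ≡ H (dbl (suc i)) (H (dbl (suc m)) f) M
    inner = trans (cong (λ k → ℕ→ℚ (k C dbl (suc i)) * H k f M) (dbl-+ (suc i) (suc m)))
                  (sym (H-H (dbl (suc i)) (dbl (suc m)) f M))

H-𝟙-≡ : ∀ d → H d 𝟙 d ≡ 1ℚ
H-𝟙-≡ zero = refl
H-𝟙-≡ (suc d) = trans (cong₂ _+_ (H-𝟙-≡ d) (H-0 (suc d) d)) (ℚₚ.+-identityʳ 1ℚ)

H-𝟙-≢ : ∀ d M → d ≢ M → H d 𝟙 M ≡ 0ℚ
H-𝟙-≢ zero    zero    d≢M = ⊥-elim (d≢M refl)
H-𝟙-≢ zero    (suc M) d≢M = refl
H-𝟙-≢ (suc d) zero    d≢M = refl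
H-𝟙-≢ (suc d) (suc M) d≢M = 0+0 (H-𝟙-≢ d M (λ eq → d≢M (cong suc eq))) (H-0 (suc d) M)

-- The value θ(p_k) itself, without the factor (2k)! that `powerSum` carries.
part : ℕ → ℚ
part k = ℕ→ℚ k * ∣ tanCoeff k ∣

nCk*k!*[n-k]! : ∀ a b → ((a ℕ.+ b) C a) ℕ.* (a ! ℕ.* b !) ≡ (a ℕ.+ b) !
nCk*k!*[n-k]! a b = trans (cong (λ k → ((a ℕ.+ b) C a) ℕ.* (a ! ℕ.* k !)) (sym (ℕₚ.m+n∸m≡n a b)))
  (trans (cong (ℕ._* (a ! ℕ.* (a ℕ.+ b ∸ a) !)) (nCk≡n!/k![n-k]! a≤n)) (m/n*n≡m (k![n∸k]!∣n! a≤n)))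
  where
  a≤n : a ≤ a ℕ.+ b
  a≤n = ℕₚ.m≤m+n a b
  instance
    nz : ℕ.NonZero (a ! ℕ.* (a ℕ.+ b ∸ a) !)
    nz = ℕₚ.m*n≢0 (a !) ((a ℕ.+ b ∸ a) !) {{ℕₚ._!≢0 a}} {{ℕₚ._!≢0 (a ℕ.+ b ∸ a)}}

weight-closed : ∀ μ → All (1 ≤_) μ →
  weight μ ≗ (ℕ→ℚ (dbl (sum μ) !) * productℚ (map part μ)) · H (dbl (sum μ)) 𝟙
weight-closed []          []       M = sym (trans (cong (_* 𝟙 M) (ℚₚ.*-identityˡ 1ℚ)) (ℚₚ.*-identityˡ (𝟙 M)))
weight-closed (suc i ∷ μ) (_ ∷ μ≥1) M = begin
  ℕ→ℚ (k ℕ.* tangent i) * H (dbl k) (weight μ) M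
    ≡⟨ cong (ℕ→ℚ (k ℕ.* tangent i) *_) (trans (H-cong (dbl k) (weight-closed μ μ≥1) M) (H-scale (dbl k) (f * π) (H (dbl s) 𝟙) M)) ⟩
  ℕ→ℚ (k ℕ.* tangent i) * (f * π * H (dbl k) (H (dbl s) 𝟙) M)
    ≡⟨ cong₂ (λ a b → a * (f * π * b)) (trans (ℕ→ℚ-* k (tangent i)) (cong (ℕ→ℚ k *_) (sym (∣tanCoeff∣*! i)))) (H-H (dbl k) (dbl s) 𝟙 M) ⟩
  (ℕ→ℚ k * (t * ℕ→ℚ ((2 ℕ.* k) !))) * (f * π * (ℕ→ℚ C′ * H (dbl k ℕ.+ dbl s) 𝟙 M))
    ≡⟨ cong₂ (λ a b → (ℕ→ℚ k * (t * ℕ→ℚ (a !))) * (f * π * (ℕ→ℚ C′ * H b 𝟙 M))) (sym (dbl≡2* k)) (sym (dbl-+ k s)) ⟩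
  (ℕ→ℚ k * (t * ℕ→ℚ (dbl k !))) * (f * π * (ℕ→ℚ C′ * h))
    ≡⟨ lemma (ℕ→ℚ k) t (ℕ→ℚ (dbl k !)) f π (ℕ→ℚ C′) h ⟩
  ((ℕ→ℚ C′ * (ℕ→ℚ (dbl k !) * f)) * (ℕ→ℚ k * t * π)) * h
    ≡⟨ cong (λ a → (a * (ℕ→ℚ k * t * π)) * h) factorials ⟩
  (ℕ→ℚ (dbl (k ℕ.+ s) !) * (ℕ→ℚ k * t * π)) * h ∎
  where
  k = suc i
  s = sum μ
  t = ∣ tanCoeff k ∣
  f = ℕ→ℚ (dbl s !)
  π = productℚ (map part μ)
  C′ = (dbl k ℕ.+ dbl s) C dbl k
  h = H (dbl (k ℕ.+ s)) 𝟙 M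
  lemma : ∀ k t d f π c h → (k * (t * d)) * (f * π * (c * h)) ≡ ((c * (d * f)) * (k * t * π)) * h
  lemma = solve-∀ ℚ-ring
  factorials : ℕ→ℚ C′ * (ℕ→ℚ (dbl k !) * f) ≡ ℕ→ℚ (dbl (k ℕ.+ s) !)
  factorials = trans (cong (ℕ→ℚ C′ *_) (sym (ℕ→ℚ-* (dbl k !) (dbl s !))))
    (trans (sym (ℕ→ℚ-* C′ (dbl k ! ℕ.* dbl s !)))
           (cong ℕ→ℚ (trans (nCk*k!*[n-k]! (dbl k) (dbl s)) (cong _! (sym (dbl-+ k s))))))

-- Partitions and the Hall pairing on power sums

sumℚ-indicator : ∀ (F : List ℕ → ℚ) κ {xs} → Unique xs → κ ∈ xs →
  sumℚ (map (λ ν → if does (≡-dec ℕ._≟_ ν κ) then F ν else 0ℚ) xs) ≡ F κ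
sumℚ-indicator F κ = go
  where
  I′ : List ℕ → ℚ
  I′ ν = if does (≡-dec ℕ._≟_ ν κ) then F ν else 0ℚ
  absent : ∀ {xs} → All (κ ≢_) xs → sumℚ (map I′ xs) ≡ 0ℚ
  absent [] = refl
  absent {x ∷ xs} (p ∷ ps) with ≡-dec ℕ._≟_ x κ
  ... | yes eq = ⊥-elim (p (sym eq))
  ... | no  _  = trans (ℚₚ.+-identityˡ _) (absent ps)
  go : ∀ {xs} → Unique xs → κ ∈ xs → sumℚ (map I′ xs) ≡ F κ
  go {x ∷ xs} (x∉ ∷ u) κ∈ with ≡-dec ℕ._≟_ x κ
  ... | yes refl = trans (cong (F κ +_) (absent x∉)) (ℚₚ.+-identityʳ (F κ))
  go {x ∷ xs} (x∉ ∷ u) (here eq)  | no x≢κ = ⊥-elim (x≢κ (sym eq))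
  go {x ∷ xs} (x∉ ∷ u) (there κ∈) | no x≢κ = trans (ℚₚ.+-identityˡ _) (go u κ∈)

oneTo-unique : ∀ n → Unique (oneTo n)
oneTo-unique n = Uniqueₚ.map⁺ ℕₚ.suc-injective (Uniqueₚ.upTo⁺ n)

∈-oneTo⁺ : ∀ {n k} → 1 ≤ k → k ≤ n → k ∈ oneTo n
∈-oneTo⁺ {k = suc k} _ k≤n = ∈-map⁺ suc (∈-upTo⁺ k≤n)

∈-oneTo⁻ : ∀ {n k} → k ∈ oneTo n → 1 ≤ k × k ≤ n
∈-oneTo⁻ k∈ with ∈-map⁻ suc k∈
... | i , i∈ , refl = s≤s z≤n , ∈-upTo⁻ i∈

-- Follows the recursion of `partsB`, in which every part bounds the next.
Bounded : ℕ → List ℕ → Set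
Bounded m [] = ⊤
Bounded m (k ∷ κ) = 1 ≤ k × k ≤ m × Bounded k κ

Bounded-positive : ∀ {m} κ → Bounded m κ → All (1 ≤_) κ
Bounded-positive []      _ = []
Bounded-positive (k ∷ κ) (k≥1 , _ , b) = k≥1 ∷ Bounded-positive κ b

partSizes : ℕ → ℕ → List ℕ
partSizes n m = filter (λ k → k ≤? m) (oneTo (suc n))

partsB-sound : ∀ f n m {ν} → ν ∈ partsB f n m → Bounded m ν × sum ν ≡ n
partsB-sound f       zero    m (here refl) = tt , refl
partsB-sound (suc f) (suc n) m ν∈
  with find (∈-concatMap⁻ (λ k → map (k ∷_) (partsB f (suc n ∸ k) k)) {partSizes n m} ν∈)
... | k , k∈ , ν∈′ with ∈-filter⁻ (λ k → k ≤? m) {xs = oneTo (suc n)} k∈ | ∈-map⁻ (k ∷_) ν∈′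
... | k∈oneTo , k≤m | κ , κ∈ , refl with ∈-oneTo⁻ k∈oneTo | partsB-sound f (suc n ∸ k) k κ∈
... | k≥1 , k≤n | b , s = (k≥1 , k≤m , b) , trans (cong (k ℕ.+_) s) (ℕₚ.m+[n∸m]≡n k≤n)

partsB-complete : ∀ f m κ → Bounded m κ → sum κ ≤ f → κ ∈ partsB f (sum κ) m
partsB-complete f       m []          _                  _ = here refl
partsB-complete (suc f) m (suc k ∷ κ) (k≥1 , k≤m , b)  (s≤s s≤f) =
  ∈-concatMap⁺ _ {xs = partSizes (k ℕ.+ sum κ) m}
    (lose (∈-filter⁺ (λ k → k ≤? m) (∈-oneTo⁺ (s≤s z≤n) (s≤s (ℕₚ.m≤m+n k (sum κ)))) k≤m)
          (∈-map⁺ (suc k ∷_) (subst (λ s → κ ∈ partsB f s (suc k)) (sym (ℕₚ.m+n∸m≡n k (sum κ)))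
            (partsB-complete f (suc k) κ b (ℕₚ.≤-trans (ℕₚ.m≤n+m (sum κ) k) s≤f)))))

partsB-unique : ∀ f n m → Unique (partsB f n m)
partsB-unique f       zero    m = [] ∷ []
partsB-unique zero    (suc n) m = []
partsB-unique (suc f) (suc n) m = Uniqueₚ.concat⁺
  (Allₚ.map⁺ (All.universal (λ k → Uniqueₚ.map⁺ ∷-injectiveʳ (partsB-unique f (suc n ∸ k) k)) (partSizes n m)))
  (AllPairsₚ.map⁺ (AllPairs.map disjoint (Uniqueₚ.filter⁺ (λ k → k ≤? m) (oneTo-unique (suc n)))))
  where
  disjoint : ∀ {k l} {X Y : List (List ℕ)} → k ≢ l → ∀ {ν} → ¬ (ν ∈ map (k ∷_) X × ν ∈ map (l ∷_) Y)
  disjoint k≢l (p , q) with ∈-map⁻ _ p | ∈-map⁻ _ q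
  ... | _ , _ , refl | _ , _ , eq = k≢l (∷-injectiveˡ eq)

insD-Bounded : ∀ {m} x ys → 1 ≤ x → x ≤ m → Bounded m ys → Bounded m (insD x ys)
insD-Bounded x []       x≥1 x≤m _ = x≥1 , x≤m , tt
insD-Bounded x (y ∷ ys) x≥1 x≤m (y≥1 , y≤m , b) with y ≤ᵇ x in eq
... | true  = x≥1 , x≤m , y≥1 , ℕₚ.≤ᵇ⇒≤ y x (subst T (sym eq) tt) , b
... | false = y≥1 , y≤m , insD-Bounded x ys x≥1 (ℕₚ.<⇒≤ (ℕₚ.≰⇒> (λ y≤x → subst T eq (ℕₚ.≤⇒≤ᵇ y≤x)))) b

insD-head : ∀ x κ → Bounded x κ → insD x κ ≡ x ∷ κ
insD-head x []      _ = refl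
insD-head x (k ∷ κ) (_ , k≤x , _) with k ≤ᵇ x in eq
... | true  = refl
... | false = ⊥-elim (subst T eq (ℕₚ.≤⇒≤ᵇ k≤x))

sortD-Bounded : ∀ {m} μ → All (λ k → 1 ≤ k × k ≤ m) μ → Bounded m (sortD μ)
sortD-Bounded []      [] = tt
sortD-Bounded (k ∷ μ) ((p , q) ∷ ps) = insD-Bounded k (sortD μ) p q (sortD-Bounded μ ps)

sortD-sorted : ∀ {m} κ → Bounded m κ → sortD κ ≡ κ
sortD-sorted []      _ = refl
sortD-sorted (k ∷ κ) (_ , _ , b) = trans (cong (insD k) (sortD-sorted κ b)) (insD-head k κ b)

sum-sortD : ∀ μ → sum (sortD μ) ≡ sum μ
sum-sortD [] = refl
sum-sortD (k ∷ μ) = trans (sum-insD k (sortD μ)) (cong (k ℕ.+_) (sum-sortD μ))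
  where
  sum-insD : ∀ x ys → sum (insD x ys) ≡ x ℕ.+ sum ys
  sum-insD x [] = refl
  sum-insD x (y ∷ ys) with y ≤ᵇ x
  ... | true  = refl
  ... | false = trans (cong (y ℕ.+_) (sum-insD x ys))
    (trans (sym (ℕₚ.+-assoc y x (sum ys))) (trans (cong (ℕ._+ sum ys) (ℕₚ.+-comm y x)) (ℕₚ.+-assoc x y (sum ys))))

product-sortD : ∀ (r : ℕ → ℚ) μ → productℚ (map r (sortD μ)) ≡ productℚ (map r μ)
product-sortD r [] = refl
product-sortD r (k ∷ μ) = trans (product-insD k (sortD μ)) (cong (r k *_) (product-sortD r μ))
  where
  swap : ∀ x y z → x * (y * z) ≡ y * (x * z)
  swap = solve-∀ ℚ-ring
  product-insD : ∀ x ys → productℚ (map r (insD x ys)) ≡ r x * productℚ (map r ys)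
  product-insD x [] = refl
  product-insD x (y ∷ ys) with y ≤ᵇ x
  ... | true  = refl
  ... | false = trans (cong (r y *_) (product-insD x ys)) (swap (r y) (r x) _)

≤sum : ∀ μ → All (_≤ sum μ) μ
≤sum [] = []
≤sum (k ∷ μ) = ℕₚ.m≤m+n k (sum μ) ∷ All.map (λ p → ℕₚ.≤-trans p (ℕₚ.m≤n+m (sum μ) k)) (≤sum μ)

productℚ-* : ∀ (f g : ℕ → ℚ) ks → productℚ (map f ks) * productℚ (map g ks) ≡ productℚ (map (λ k → f k * g k) ks)
productℚ-* f g [] = ℚₚ.*-identityˡ 1ℚ
productℚ-* f g (k ∷ ks) = trans (*-interchange (f k) _ (g k) _) (cong (f k * g k *_) (productℚ-* f g ks))

powℚ-* : ∀ a b m → powℚ (a * b) m ≡ powℚ a m * powℚ b m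
powℚ-* a b zero = sym (ℚₚ.*-identityˡ 1ℚ)
powℚ-* a b (suc m) = trans (cong (a * b *_) (powℚ-* a b m)) (*-interchange a b (powℚ a m) (powℚ b m))

∣powℚ∣ : ∀ a m → ∣ powℚ a m ∣ ≡ powℚ ∣ a ∣ m
∣powℚ∣ a zero = refl
∣powℚ∣ a (suc m) = trans (ℚₚ.∣p*q∣≡∣p∣*∣q∣ a (powℚ a m)) (cong (∣ a ∣ *_) (∣powℚ∣ a m))

ℕ→ℚ-^ : ∀ k m → ℕ→ℚ (k ^ m) ≡ powℚ (ℕ→ℚ k) m
ℕ→ℚ-^ k zero = refl
ℕ→ℚ-^ k (suc m) = trans (ℕ→ℚ-* k (k ^ m)) (cong (ℕ→ℚ k *_) (ℕ→ℚ-^ k m))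

ℕ→ℚ-product : ∀ (f : ℕ → ℕ) ks → ℕ→ℚ (product (map f ks)) ≡ productℚ (map (λ k → ℕ→ℚ (f k)) ks)
ℕ→ℚ-product f [] = refl
ℕ→ℚ-product f (k ∷ ks) = trans (ℕ→ℚ-* (f k) _) (cong (ℕ→ℚ (f k) *_) (ℕ→ℚ-product f ks))

∣productℚ∣ : ∀ (f : ℕ → ℚ) ks → ∣ productℚ (map f ks) ∣ ≡ productℚ (map (λ k → ∣ f k ∣) ks)
∣productℚ∣ f [] = refl
∣productℚ∣ f (k ∷ ks) = trans (ℚₚ.∣p*q∣≡∣p∣*∣q∣ (f k) _) (cong (∣ f k ∣ *_) (∣productℚ∣ f ks))

product-powℚ-count : ∀ (r : ℕ → ℚ) n ν → All (λ k → 1 ≤ k × k ≤ n) ν →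
  productℚ (map (λ k → powℚ (r k) (count k ν)) (oneTo n)) ≡ productℚ (map r ν)
product-powℚ-count r n []      [] = ones (oneTo n)
  where
  ones : ∀ ks → productℚ (map (λ _ → 1ℚ) ks) ≡ 1ℚ
  ones [] = refl
  ones (k ∷ ks) = trans (ℚₚ.*-identityˡ _) (ones ks)
product-powℚ-count r n (i ∷ ν) ((p , q) ∷ ps) =
  trans (trans (cong productℚ (map-cong step (oneTo n)))
               (sym (productℚ-* (λ k → if does (k ℕ.≟ i) then r k else 1ℚ) (λ k → powℚ (r k) (count k ν)) (oneTo n))))
        (cong₂ _*_ (indicator (oneTo-unique n) (∈-oneTo⁺ p q)) (product-powℚ-count r n ν ps))
  where
  step : ∀ k → powℚ (r k) (count k (i ∷ ν)) ≡ (if does (k ℕ.≟ i) then r k else 1ℚ) * powℚ (r k) (count k ν)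
  step k with does (k ℕ.≟ i)
  ... | true  = refl
  ... | false = sym (ℚₚ.*-identityˡ _)
  f : ℕ → ℚ
  f k = if does (k ℕ.≟ i) then r k else 1ℚ
  f-≡ : f i ≡ r i
  f-≡ rewrite dec-true (i ℕ.≟ i) refl = refl
  f-≢ : ∀ {x} → i ≢ x → f x ≡ 1ℚ
  f-≢ {x} i≢x rewrite dec-false (x ℕ.≟ i) (≢-sym i≢x) = refl
  absent : ∀ {xs} → All (i ≢_) xs → productℚ (map f xs) ≡ 1ℚ
  absent [] = refl
  absent (p ∷ ps) = trans (cong₂ _*_ (f-≢ p) (absent ps)) (ℚₚ.*-identityˡ 1ℚ)
  indicator : ∀ {xs} → Unique xs → i ∈ xs → productℚ (map f xs) ≡ r i
  indicator (x∉ ∷ u) (here refl) = trans (cong₂ _*_ f-≡ (absent x∉)) (ℚₚ.*-identityʳ (r i))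
  indicator {x ∷ _} (x∉ ∷ u) (there i∈) = trans (cong₂ _*_ (f-≢ {x} (λ { refl → All.lookup x∉ i∈ refl })) (indicator u i∈)) (ℚₚ.*-identityˡ (r i))

-- For a part size k of multiplicity m, `zee` contributes k^m m!. The factorial cancels the one in
-- `φ`, and k^m completes the power of the coefficient to `part k` to the m, so the result is
-- multiplicative in the parts.
φ-zee : ∀ ν → All (1 ≤_) ν → let n = sum ν in
  ∣ φ n ν ∣ * ℕ→ℚ (zee ν) ≡ ℕ→ℚ ((2 ℕ.* n) !) * productℚ (map part ν)
φ-zee ν ν≥1 = begin
  ∣ ℕ→ℚ F * productℚ (map d ks) ∣ * ℕ→ℚ (zee ν)
    ≡⟨ cong₂ _*_ (trans (ℚₚ.∣p*q∣≡∣p∣*∣q∣ (ℕ→ℚ F) (productℚ (map d ks))) (cong₂ _*_ (∣ℕ→ℚ∣ F) (∣productℚ∣ d ks))) (ℕ→ℚ-product (λ k → k ^ mult ν k ℕ.* mult ν k !) ks) ⟩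
  ℕ→ℚ F * productℚ (map (λ k → ∣ d k ∣) ks) * productℚ (map z ks)
    ≡⟨ ℚₚ.*-assoc (ℕ→ℚ F) (productℚ (map (λ k → ∣ d k ∣) ks)) (productℚ (map z ks)) ⟩
  ℕ→ℚ F * (productℚ (map (λ k → ∣ d k ∣) ks) * productℚ (map z ks))
    ≡⟨ cong (ℕ→ℚ F *_) (trans (productℚ-* (λ k → ∣ d k ∣) z ks) (cong productℚ (map-cong factor ks))) ⟩
  ℕ→ℚ F * productℚ (map (λ k → powℚ (part k) (mult ν k)) ks)
    ≡⟨ cong (ℕ→ℚ F *_) (product-powℚ-count part n ν (All.zip (ν≥1 , ≤sum ν))) ⟩
  ℕ→ℚ F * productℚ (map part ν) ∎
  where
  n = sum ν
  ks = oneTo n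
  F = (2 ℕ.* n) !
  d : ℕ → ℚ
  d k = divℕ (powℚ (tanCoeff k) (mult ν k)) (mult ν k !)
  z : ℕ → ℚ
  z k = ℕ→ℚ (k ^ mult ν k ℕ.* mult ν k !)
  factor : ∀ k → ∣ d k ∣ * z k ≡ powℚ (part k) (mult ν k)
  factor k = begin
    ∣ d k ∣ * ℕ→ℚ (k ^ m ℕ.* m !) ≡⟨ cong (∣ d k ∣ *_) (ℕ→ℚ-* (k ^ m) (m !)) ⟩
    ∣ d k ∣ * (ℕ→ℚ (k ^ m) * ℕ→ℚ (m !)) ≡⟨ lemma ∣ d k ∣ (ℕ→ℚ (k ^ m)) (ℕ→ℚ (m !)) ⟩
    ℕ→ℚ (k ^ m) * (∣ d k ∣ * ℕ→ℚ (m !)) ≡⟨ cong (λ a → ℕ→ℚ (k ^ m) * (∣ d k ∣ * a)) (∣ℕ→ℚ∣ (m !)) ⟨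
    ℕ→ℚ (k ^ m) * (∣ d k ∣ * ∣ ℕ→ℚ (m !) ∣) ≡⟨ cong (ℕ→ℚ (k ^ m) *_) (sym (ℚₚ.∣p*q∣≡∣p∣*∣q∣ (d k) (ℕ→ℚ (m !)))) ⟩
    ℕ→ℚ (k ^ m) * ∣ d k * ℕ→ℚ (m !) ∣ ≡⟨ cong₂ (λ a b → a * ∣ b ∣) (ℕ→ℚ-^ k m) (divℕ-* (powℚ (tanCoeff k) m) (m !) {{ℕₚ._!≢0 m}}) ⟩
    powℚ (ℕ→ℚ k) m * ∣ powℚ (tanCoeff k) m ∣ ≡⟨ cong (powℚ (ℕ→ℚ k) m *_) (∣powℚ∣ (tanCoeff k) m) ⟩
    powℚ (ℕ→ℚ k) m * powℚ ∣ tanCoeff k ∣ m ≡⟨ powℚ-* (ℕ→ℚ k) ∣ tanCoeff k ∣ m ⟨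
    powℚ (part k) m ∎
    where
    m = mult ν k
    lemma : ∀ a b c → a * (b * c) ≡ b * (a * c)
    lemma = solve-∀ ℚ-ring

dbl-injective : ∀ {m n} → dbl m ≡ dbl n → m ≡ n
dbl-injective {zero}  {zero}  _  = refl
dbl-injective {suc m} {suc n} eq = cong suc (dbl-injective (ℕₚ.suc-injective (ℕₚ.suc-injective eq)))

sumℚ-cong-∈ : ∀ {A : Set} {f g : A → ℚ} xs → (∀ {x} → x ∈ xs → f x ≡ g x) → sumℚ (map f xs) ≡ sumℚ (map g xs)
sumℚ-cong-∈ []       f≡g = refl
sumℚ-cong-∈ (x ∷ xs) f≡g = cong₂ _+_ (f≡g (here refl)) (sumℚ-cong-∈ xs (f≡g ∘ there))

sumℚ-0 : ∀ {A : Set} (xs : List A) → sumℚ (map (λ _ → 0ℚ) xs) ≡ 0ℚ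
sumℚ-0 [] = refl
sumℚ-0 (x ∷ xs) = trans (ℚₚ.+-identityˡ _) (sumℚ-0 xs)

hallP-sorted : ∀ {m} ν μ → Bounded m ν →
  hallP ν μ ≡ (if does (≡-dec ℕ._≟_ ν (sortD μ)) then ℕ→ℚ (zee ν) else 0ℚ)
hallP-sorted ν μ b = cong (λ κ → if does (≡-dec ℕ._≟_ κ (sortD μ)) then ℕ→ℚ (zee ν) else 0ℚ) (sortD-sorted ν b)

hallP-≢ : ∀ ν μ → sum ν ≢ sum μ → hallP ν μ ≡ 0ℚ
hallP-≢ ν μ s≢ = cong (λ b → if b then ℕ→ℚ (zee ν) else 0ℚ)
  (dec-false (≡-dec ℕ._≟_ (sortD ν) (sortD μ)) (λ eq → s≢ (trans (sym (sum-sortD ν)) (trans (cong sum eq) (sum-sortD μ)))))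

scaledA-p-≡ : ∀ μ → All (1 ≤_) μ → let n = sum μ in
  sumℚ (map (λ ν → ∣ φ n ν ∣ * hallP ν μ) (partitions n)) ≡ weight μ (dbl n)
scaledA-p-≡ μ μ≥1 = begin
  sumℚ (map (λ ν → ∣ φ n ν ∣ * hallP ν μ) (partitions n))
    ≡⟨ sumℚ-cong-∈ (partitions n) (λ {ν} ν∈ → trans (cong (∣ φ n ν ∣ *_) (hallP-sorted ν μ (proj₁ (partsB-sound n n n ν∈))))
                                                     (*-if ∣ φ n ν ∣ (ℕ→ℚ (zee ν)) (does (≡-dec ℕ._≟_ ν κ)))) ⟩
  sumℚ (map (λ ν → if does (≡-dec ℕ._≟_ ν κ) then G ν else 0ℚ) (partitions n))
    ≡⟨ sumℚ-indicator G κ (partsB-unique n n n) κ∈ ⟩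
  ∣ φ n κ ∣ * ℕ→ℚ (zee κ)
    ≡⟨ subst (λ s → ∣ φ s κ ∣ * ℕ→ℚ (zee κ) ≡ ℕ→ℚ ((2 ℕ.* s) !) * productℚ (map part κ)) (sum-sortD μ) (φ-zee κ (Bounded-positive κ κ-bounded)) ⟩
  ℕ→ℚ ((2 ℕ.* n) !) * productℚ (map part κ)
    ≡⟨ cong₂ (λ a b → ℕ→ℚ (a !) * b) (sym (dbl≡2* n)) (product-sortD part μ) ⟩
  ℕ→ℚ (dbl n !) * productℚ (map part μ)
    ≡⟨ trans (cong (ℕ→ℚ (dbl n !) * productℚ (map part μ) *_) (H-𝟙-≡ (dbl n))) (ℚₚ.*-identityʳ (ℕ→ℚ (dbl n !) * productℚ (map part μ))) ⟨
  ℕ→ℚ (dbl n !) * productℚ (map part μ) * H (dbl n) 𝟙 (dbl n)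
    ≡⟨ weight-closed μ μ≥1 (dbl n) ⟨
  weight μ (dbl n) ∎
  where
  n = sum μ
  κ = sortD μ
  G : List ℕ → ℚ
  G ν = ∣ φ n ν ∣ * ℕ→ℚ (zee ν)
  κ-bounded : Bounded n κ
  κ-bounded = sortD-Bounded μ (All.zip (μ≥1 , ≤sum μ))
  κ∈ : κ ∈ partitions n
  κ∈ = subst (λ s → κ ∈ partsB n s n) (sum-sortD μ) (partsB-complete n n κ κ-bounded (ℕₚ.≤-reflexive (sum-sortD μ)))
  *-if : ∀ q x b → q * (if b then x else 0ℚ) ≡ (if b then q * x else 0ℚ)
  *-if q x true  = refl
  *-if q x false = ℚₚ.*-zeroʳ q

scaledA-p-≢ : ∀ n μ → All (1 ≤_) μ → sum μ ≢ n →
  sumℚ (map (λ ν → ∣ φ n ν ∣ * hallP ν μ) (partitions n)) ≡ weight μ (dbl n)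
scaledA-p-≢ n μ μ≥1 s≢n = begin
  sumℚ (map (λ ν → ∣ φ n ν ∣ * hallP ν μ) (partitions n))
    ≡⟨ sumℚ-cong-∈ (partitions n) (λ {ν} ν∈ → trans
         (cong (∣ φ n ν ∣ *_) (hallP-≢ ν μ (λ eq → s≢n (trans (sym eq) (proj₂ (partsB-sound n n n ν∈))))))
         (ℚₚ.*-zeroʳ ∣ φ n ν ∣)) ⟩
  sumℚ (map (λ ν → 0ℚ) (partitions n))
    ≡⟨ sumℚ-0 (partitions n) ⟩
  0ℚ
    ≡⟨ trans (cong (c *_) (H-𝟙-≢ (dbl (sum μ)) (dbl n) (s≢n ∘ dbl-injective))) (ℚₚ.*-zeroʳ c) ⟨
  c * H (dbl (sum μ)) 𝟙 (dbl n)
    ≡⟨ weight-closed μ μ≥1 (dbl n) ⟨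
  weight μ (dbl n) ∎
  where
  c = ℕ→ℚ (dbl (sum μ) !) * productℚ (map part μ)

-- All degrees are covered: if `sum μ` differs from `n`, the pairing vanishes by orthogonality, and
-- a multiple of x^{2|μ|} has coefficient 0 in degree 2n. An expansion can therefore be paired term
-- by term.
scaledA-p : ∀ n μ → All (1 ≤_) μ →
  sumℚ (map (λ ν → ∣ φ n ν ∣ * hallP ν μ) (partitions n)) ≡ weight μ (dbl n)
scaledA-p n μ μ≥1 = split (sum μ ℕ.≟ n)
  where
  split : Dec (sum μ ≡ n) → sumℚ (map (λ ν → ∣ φ n ν ∣ * hallP ν μ) (partitions n)) ≡ weight μ (dbl n)
  split (yes refl) = scaledA-p-≡ μ μ≥1
  split (no s≢n)   = scaledA-p-≢ n μ μ≥1 s≢n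

sumℚ-map-+ : ∀ {A : Set} (f g : A → ℚ) xs → sumℚ (map (λ x → f x + g x) xs) ≡ sumℚ (map f xs) + sumℚ (map g xs)
sumℚ-map-+ f g [] = refl
sumℚ-map-+ f g (x ∷ xs) = trans (cong (f x + g x +_) (sumℚ-map-+ f g xs)) (+-interchange (f x) (g x) _ _)

sumℚ-map-* : ∀ {A : Set} c (f : A → ℚ) xs → sumℚ (map (λ x → c * f x) xs) ≡ c * sumℚ (map f xs)
sumℚ-map-* c f [] = sym (ℚₚ.*-zeroʳ c)
sumℚ-map-* c f (x ∷ xs) = trans (cong (c * f x +_) (sumℚ-map-* c f xs)) (sym (ℚₚ.*-distribˡ-+ c (f x) _))

scaledA-pairing : ∀ n G → PosIndexed G → ⟨ scaledA n , G ⟩ ≡ NewtonAction.value weight-action G (dbl n)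
scaledA-pairing n []            _ = sumℚ-0 (scaledA n)
scaledA-pairing n ((c , μ) ∷ G) (μ≥1 ∷ G≥1) = trans
  (sumℚ-map-+ (λ s → proj₁ s * c * hallP (proj₂ s) μ)
              (λ s → sumℚ (map (λ t → proj₁ s * proj₁ t * hallP (proj₂ s) (proj₂ t)) G)) (scaledA n))
  (cong₂ _+_ first (scaledA-pairing n G G≥1))
  where
  lemma : ∀ a c h → a * c * h ≡ c * (a * h)
  lemma = solve-∀ ℚ-ring
  first : sumℚ (map (λ s → proj₁ s * c * hallP (proj₂ s) μ) (scaledA n)) ≡ c * weight μ (dbl n)
  first = begin
    sumℚ (map (λ s → proj₁ s * c * hallP (proj₂ s) μ) (scaledA n))
      ≡⟨ cong sumℚ (map-∘ (partitions n)) ⟨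
    sumℚ (map (λ ν → ∣ φ n ν ∣ * c * hallP ν μ) (partitions n))
      ≡⟨ cong sumℚ (map-cong (λ ν → lemma ∣ φ n ν ∣ c (hallP ν μ)) (partitions n)) ⟩
    sumℚ (map (λ ν → c * (∣ φ n ν ∣ * hallP ν μ)) (partitions n))
      ≡⟨ sumℚ-map-* c (λ ν → ∣ φ n ν ∣ * hallP ν μ) (partitions n) ⟩
    c * sumℚ (map (λ ν → ∣ φ n ν ∣ * hallP ν μ) (partitions n))
      ≡⟨ cong (c *_) (scaledA-p n μ μ≥1) ⟩
    c * weight μ (dbl n) ∎

-- Skew tableaux

HasCard-⇔ : ∀ {A : Set} {P Q : A → Set} {k} → (∀ x → P x → Q x) → (∀ x → Q x → P x) → HasCard P k → HasCard Q k
HasCard-⇔ to from (xs , u , all , complete , len) =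
  xs , u , All.map (λ {x} → to x) all , (λ x q → complete x (from x q)) , len

-- Counting by fibres. Since `g` recovers both the index and the element, every `f i` is injective
-- on its fibre and the images for different indices are disjoint.
HasCard-⋃ : ∀ {J X Y : Set} {P : J → X → Set} {Q : Y → Set} {c : J → ℕ} (f : J → X → Y) (g : Y → J × X) (is : List J) →
  Unique is → (∀ i → i ∈ is → HasCard (P i) (c i)) →
  (∀ i x → i ∈ is → P i x → Q (f i x)) →
  (∀ i x → i ∈ is → P i x → g (f i x) ≡ (i , x)) →
  (∀ y → Q y → proj₁ (g y) ∈ is × P (proj₁ (g y)) (proj₂ (g y)) × f (proj₁ (g y)) (proj₂ (g y)) ≡ y) →
  HasCard Q (sum (map c is))
HasCard-⋃ {J} {X} {Y} {P} {Q} {c} f g is u cards to inv from =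
  HasCard-⇔ (λ y (i∈ , p , eq) → subst Q eq (to _ _ i∈ p)) from (go is u (λ i∈ → i∈))
  where
  -- The part of `Q` whose index lies in a sublist, which is the form that an induction on the index
  -- list can carry.
  R : List J → Y → Set
  R js y = proj₁ (g y) ∈ js × P (proj₁ (g y)) (proj₂ (g y)) × f (proj₁ (g y)) (proj₂ (g y)) ≡ y
  go : ∀ js → Unique js → (∀ {i} → i ∈ js → i ∈ is) → HasCard (R js) (sum (map c js))
  go []       _         _   = [] , [] , [] , (λ y ()) , refl
  go (j ∷ js) (j∉ ∷ u) sub with cards j (sub (here refl)) | go js u (sub ∘ there)
  ... | xs , xs-u , xs-P , xs-all , xs-len | ys , ys-u , ys-R , ys-all , ys-len =
    map (f j) xs ++ ys
    , Uniqueₚ.++⁺ (Uniqueₚ.map⁻ {f = g} (subst Unique (sym (gf xs xs-P)) (Uniqueₚ.map⁺ (cong proj₂) xs-u))) ys-u disjoint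
    , Allₚ.++⁺ (Allₚ.map⁺ (All.map inR xs-P)) (All.map (λ (i∈ , r) → there i∈ , r) ys-R)
    , complete
    , trans (length-++ (map (f j) xs)) (cong₂ ℕ._+_ (trans (length-map (f j) xs) xs-len) ys-len)
    where
    j∈ = sub (here refl)
    gf : ∀ xs → All (P j) xs → map g (map (f j) xs) ≡ map (j ,_) xs
    gf []       [] = refl
    gf (x ∷ xs) (p ∷ ps) = cong₂ _∷_ (inv j x j∈ p) (gf xs ps)
    inR : ∀ {x} → P j x → R (j ∷ js) (f j x)
    inR {x} p rewrite inv j x j∈ p = here refl , p , refl
    disjoint : ∀ {y} → ¬ (y ∈ map (f j) xs × y ∈ ys)
    disjoint (y∈₁ , y∈₂) with ∈-map⁻ (f j) y∈₁
    ... | x , x∈ , refl = All.lookup j∉ (subst (_∈ js) (cong proj₁ (inv j x j∈ (All.lookup xs-P x∈))) (proj₁ (All.lookup ys-R y∈₂))) refl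
    complete : ∀ y → R (j ∷ js) y → y ∈ map (f j) xs ++ ys
    complete y (there i∈ , r) = ∈-++⁺ʳ _ (ys-all y (i∈ , r))
    complete y (here eq , p , fgy) = ∈-++⁺ˡ (subst (_∈ map (f j) xs) (trans (cong (λ i → f i (proj₂ (g y))) (sym eq)) fgy)
      (∈-map⁺ (f j) (xs-all (proj₂ (g y)) (subst (λ i → P i (proj₂ (g y))) eq p))))

-- the entry in column j of a row that starts in column t
get : ℕ → List ℕ → ℕ → Maybe ℕ
get zero    r j = nth r j
get (suc t) r zero = nothing
get (suc t) r (suc j) = get t r j

Adj : ℕ → List ℕ → ℕ → List ℕ → Set
Adj t r t′ r′ = ∀ j a b → get t r j ≡ just a → get t′ r′ j ≡ just b → a < b

-- Inverse to deleting the entries 1 of a row and lowering all the others by one.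
glue : ℕ → List ℕ → List ℕ
glue zero    r = map suc r
glue (suc d) r = 1 ∷ glue d r

ones : List ℕ → ℕ
ones [] = 0
ones (1 ∷ r) = suc (ones r)
ones (_ ∷ r) = 0

-- A weakly increasing positive row has its entries 1 in front, so all that follows them can be
-- lowered by one.
rest : List ℕ → List ℕ
rest [] = []
rest (1 ∷ r) = rest r
rest (x ∷ r) = map ℕ.pred (x ∷ r)

get-glue : ∀ t d r j {a} → get t (glue d r) j ≡ just a →
           (j < t ℕ.+ d × a ≡ 1) ⊎ (∃ λ a′ → a ≡ suc a′ × get (t ℕ.+ d) r j ≡ just a′)
get-glue zero    zero    (x ∷ r) zero    refl = inj₂ (x , refl , refl)
get-glue zero    zero    (x ∷ r) (suc j) eq   with get-glue zero zero r j eq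
... | inj₂ p = inj₂ p
get-glue zero    (suc d) r       zero    refl = inj₁ (s≤s z≤n , refl)
get-glue zero    (suc d) r       (suc j) eq   with get-glue zero d r j eq
... | inj₁ (j< , a≡1) = inj₁ (s≤s j< , a≡1)
... | inj₂ p = inj₂ p
get-glue (suc t) d       r       (suc j) eq   with get-glue t d r j eq
... | inj₁ (j< , a≡1) = inj₁ (s≤s j< , a≡1)
... | inj₂ p = inj₂ p

get-glue-suc : ∀ t d r j {a} → get (t ℕ.+ d) r j ≡ just a → get t (glue d r) j ≡ just (suc a)
get-glue-suc zero    zero    (x ∷ r) zero    refl = refl
get-glue-suc zero    zero    (x ∷ r) (suc j) eq   = get-glue-suc zero zero r j eq
get-glue-suc zero    (suc d) r       (suc j) eq   = get-glue-suc zero d r j eq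
get-glue-suc (suc t) d       r       (suc j) eq   = get-glue-suc t d r j eq

get-glue-1 : ∀ t d r j → t ≤ j → j < t ℕ.+ d → get t (glue d r) j ≡ just 1
get-glue-1 zero    (suc d) r zero    _         _ = refl
get-glue-1 zero    (suc d) r (suc j) _         (s≤s j<)  = get-glue-1 zero d r j z≤n j<
get-glue-1 (suc t) d       r (suc j) (s≤s t≤j) (s≤s j<)  = get-glue-1 t d r j t≤j j<

get-≥ : ∀ t r j {a} → get t r j ≡ just a → t ≤ j
get-≥ zero    r j       _  = z≤n
get-≥ (suc t) r (suc j) eq = s≤s (get-≥ t r j eq)

get-defined : ∀ t r j → t ≤ j → j < t ℕ.+ length r → ∃ λ a → get t r j ≡ just a
get-defined zero    (x ∷ r) zero    _         _ = x , refl
get-defined zero    (x ∷ r) (suc j) _         (s≤s j<) = get-defined zero r j z≤n j<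
get-defined (suc t) r       (suc j) (s≤s t≤j) (s≤s j<) = get-defined t r j t≤j j<

get-positive : ∀ t r j {a} → All (1 ≤_) r → get t r j ≡ just a → 1 ≤ a
get-positive zero    (x ∷ r) zero    (p ∷ _)  refl = p
get-positive zero    (x ∷ r) (suc j) (_ ∷ ps) eq   = get-positive zero r j ps eq
get-positive (suc t) r       (suc j) ps       eq   = get-positive t r j ps eq

-- The bound is the horizontal strip condition: the new entries 1 of the lower row end before the
-- upper row begins, so none has a cell above it, while a new 1 of the upper row stands over entries
-- that are at least 2.
Adj-glue : ∀ t d r t′ d′ r′ → All (1 ≤_) r′ → t′ ℕ.+ d′ ≤ t →
           Adj (t ℕ.+ d) r (t′ ℕ.+ d′) r′ → Adj t (glue d r) t′ (glue d′ r′)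
Adj-glue t d r t′ d′ r′ r′≥1 bound adj j a b eqa eqb with get-glue t′ d′ r′ j eqb | get-glue t d r j eqa
... | inj₁ (j< , _)       | _ = ⊥-elim (ℕₚ.<-irrefl refl (ℕₚ.<-≤-trans j< (ℕₚ.≤-trans bound (get-≥ t _ j eqa))))
... | inj₂ (b′ , refl , eqb′) | inj₁ (_ , refl) = s≤s (get-positive (t′ ℕ.+ d′) r′ j r′≥1 eqb′)
... | inj₂ (b′ , refl , eqb′) | inj₂ (a′ , refl , eqa′) = s≤s (adj j a′ b′ eqa′ eqb′)

Adj-unglue : ∀ t d r t′ d′ r′ → Adj t (glue d r) t′ (glue d′ r′) → Adj (t ℕ.+ d) r (t′ ℕ.+ d′) r′
Adj-unglue t d r t′ d′ r′ adj j a b eqa eqb =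
  ℕ.s<s⁻¹ (adj j (suc a) (suc b) (get-glue-suc t d r j eqa) (get-glue-suc t′ d′ r′ j eqb))

-- An initial 1 of the lower row under an entry of the upper row would violate column strictness.
Adj-bound : ∀ t r t′ d′ r′ → All (1 ≤_) r → t′ ≤ t → t′ ℕ.+ length (glue d′ r′) ≤ t ℕ.+ length r →
            Adj t r t′ (glue d′ r′) → t′ ℕ.+ d′ ≤ t
Adj-bound t r t′ zero     r′ r≥1 t′≤t _   _   = subst (_≤ t) (sym (ℕₚ.+-identityʳ t′)) t′≤t
Adj-bound t r t′ (suc d′) r′ r≥1 t′≤t len adj with t′ ℕ.+ suc d′ ℕ.≤? t
... | yes p = p
... | no ¬p = ⊥-elim (ℕₚ.<-irrefl refl (ℕₚ.<-≤-trans (adj j a 1 eqa eqb) (get-positive t r j r≥1 eqa)))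
  where
  j = t′ ℕ.+ d′
  t≤j : t ≤ j
  t≤j = ℕ.s≤s⁻¹ (subst (t <_) (ℕₚ.+-suc t′ d′) (ℕₚ.≰⇒> ¬p))
  length-glue-≥ : ∀ d → d ≤ length (glue d r′)
  length-glue-≥ zero = z≤n
  length-glue-≥ (suc d) = s≤s (length-glue-≥ d)
  j<end : j < t ℕ.+ length r
  j<end = ℕₚ.<-≤-trans (ℕₚ.<-≤-trans (subst (j <_) (sym (ℕₚ.+-suc t′ d′)) (ℕₚ.n<1+n j)) (ℕₚ.+-monoʳ-≤ t′ (length-glue-≥ (suc d′)))) len
  a = proj₁ (get-defined t r j t≤j j<end)
  eqa = proj₂ (get-defined t r j t≤j j<end)
  eqb = get-glue-1 t′ (suc d′) r′ j (ℕₚ.m≤m+n t′ d′) (subst (j <_) (sym (ℕₚ.+-suc t′ d′)) (ℕₚ.n<1+n j))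

Row : ℕ → ℕ → List ℕ → Set
Row s t r = t ℕ.+ length r ≡ s × Linked _≤_ r × All (1 ≤_) r

length-glue : ∀ d r → length (glue d r) ≡ d ℕ.+ length r
length-glue zero    r = length-map suc r
length-glue (suc d) r = cong suc (length-glue d r)

glue-positive : ∀ d r → All (1 ≤_) (glue d r)
glue-positive zero    r = Allₚ.map⁺ (All.universal (λ _ → s≤s z≤n) r)
glue-positive (suc d) r = s≤s z≤n ∷ glue-positive d r

Linked-∷ : ∀ {x r} → All (x ≤_) r → Linked _≤_ r → Linked _≤_ (x ∷ r)
Linked-∷ []      [] = [-]
Linked-∷ (p ∷ _) l = p ∷ l

Row-glue : ∀ s t d r → Row s (t ℕ.+ d) r → Row s t (glue d r)
Row-glue s t d r (len , l , _) = trans (cong (t ℕ.+_) (length-glue d r)) (trans (sym (ℕₚ.+-assoc t d (length r))) len)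
  , linked d , glue-positive d r
  where
  linked : ∀ d → Linked _≤_ (glue d r)
  linked zero = Linkedₚ.map⁺ (Linked.map s≤s l)
  linked (suc d) = Linked-∷ (glue-positive d r) (linked d)

Row-unglue : ∀ s t d r → All (1 ≤_) r → Row s t (glue d r) → Row s (t ℕ.+ d) r
Row-unglue s t d r r≥1 (len , l , _) =
  trans (ℕₚ.+-assoc t d (length r)) (trans (cong (t ℕ.+_) (sym (length-glue d r))) len) , linked d l , r≥1
  where
  linked : ∀ d → Linked _≤_ (glue d r) → Linked _≤_ r
  linked zero    l = Linked.map ℕ.s≤s⁻¹ (Linkedₚ.map⁻ l)
  linked (suc d) l = linked d (Linked.tail l)

glue-ones-rest : ∀ r → Linked _≤_ r → All (1 ≤_) r → glue (ones r) (rest r) ≡ r × All (1 ≤_) (rest r)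
glue-ones-rest []                _ _ = refl , []
glue-ones-rest (zero ∷ r)        _ (() ∷ _)
glue-ones-rest (suc zero ∷ r)    l (_ ∷ ps) with glue-ones-rest r (Linked.tail l) ps
... | eq , pos = cong (1 ∷_) eq , pos
glue-ones-rest (suc (suc x) ∷ r) l _ = cong (suc (suc x) ∷_) (suc-pred r big) , s≤s z≤n ∷ pos r big
  where
  big : All (2 ≤_) r
  big with Linkedₚ.Linked⇒AllPairs ℕₚ.≤-trans l
  ... | ps ∷ _ = All.map (ℕₚ.≤-trans (s≤s (s≤s z≤n))) ps
  suc-pred : ∀ r → All (2 ≤_) r → map suc (map ℕ.pred r) ≡ r
  suc-pred []          [] = refl
  suc-pred (suc y ∷ r) (_ ∷ ps) = cong (suc y ∷_) (suc-pred r ps)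
  pos : ∀ r → All (2 ≤_) r → All (1 ≤_) (map ℕ.pred r)
  pos []          [] = []
  pos (suc y ∷ r) (s≤s p ∷ ps) = p ∷ pos r ps

ones-glue : ∀ d r → All (1 ≤_) r → ones (glue d r) ≡ d
ones-glue zero    []          _ = refl
ones-glue zero    (suc x ∷ r) _ = refl
ones-glue zero    (zero ∷ r)  (() ∷ _)
ones-glue (suc d) r           ps = cong suc (ones-glue d r ps)

rest-glue : ∀ d r → All (1 ≤_) r → rest (glue d r) ≡ r
rest-glue zero    []          _ = refl
rest-glue zero    (suc x ∷ r) _ = cong (suc x ∷_) (trans (sym (map-∘ r)) (map-id r))
rest-glue zero    (zero ∷ r)  (() ∷ _)
rest-glue (suc d) r           ps = rest-glue d r ps

data Below (t : ℕ) (r : List ℕ) : List ℕ → Filling → Set where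
  none : Below t r [] []
  next : ∀ {t′ r′ τ T} → Adj t r t′ r′ → Below t r (t′ ∷ τ) (r′ ∷ T)

data Skew : List ℕ → List ℕ → Filling → Set where
  []   : Skew [] [] []
  cons : ∀ {s t r σ τ T} → Row s t r → Below t r τ T → Skew σ τ T → Skew (s ∷ σ) (t ∷ τ) (r ∷ T)

-- Strip b τ τ′: the skew shape τ′/τ is a horizontal strip and the first row of τ′ has length at most b.
data Strip (b : ℕ) : List ℕ → List ℕ → Set where
  []   : Strip b [] []
  cons : ∀ {t τ τ′} d → t ℕ.+ d ≤ b → Strip t τ τ′ → Strip b (t ∷ τ) ((t ℕ.+ d) ∷ τ′)

Dec≤ : ℕ → List ℕ → Set
Dec≤ b [] = ⊤
Dec≤ b (t ∷ τ) = t ≤ b × Dec≤ t τ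

Dec≤-mono : ∀ {b b′} τ → b ≤ b′ → Dec≤ b τ → Dec≤ b′ τ
Dec≤-mono []      _    _ = tt
Dec≤-mono (t ∷ τ) b≤b′ (p , q) = ℕₚ.≤-trans p b≤b′ , q

Strip-Dec≤ : ∀ {b τ τ′} → Strip b τ τ′ → Dec≤ b τ′
Strip-Dec≤ [] = tt
Strip-Dec≤ (cons {t} {τ} {τ′} d p s) = p , Dec≤-mono τ′ (ℕₚ.m≤m+n t d) (Strip-Dec≤ s)

glueT : List ℕ → List ℕ → Filling → Filling
glueT (t ∷ τ) (t′ ∷ τ′) (r ∷ T) = glue (t′ ∸ t) r ∷ glueT τ τ′ T
glueT _       _         _ = []

peelτ : List ℕ → Filling → List ℕ
peelτ = zipWith (λ t r → t ℕ.+ ones r)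

peelT : Filling → Filling
peelT = map rest

glueT-Skew : ∀ {b σ τ τ′ T} → Strip b τ τ′ → Skew σ τ′ T → Skew σ τ (glueT τ τ′ T)
glueT-Skew [] [] = []
glueT-Skew (cons {t} d t+d≤b strip) (cons {s} {r = r} row below skew) rewrite ℕₚ.m+n∸m≡n t d =
  cons (Row-glue s t d r row) (below′ strip below skew) (glueT-Skew strip skew)
  where
  below′ : ∀ {σ τ τ′ T} → Strip t τ τ′ → Below (t ℕ.+ d) r τ′ T → Skew σ τ′ T → Below t (glue d r) τ (glueT τ τ′ T)
  below′ []                     none       [] = none
  below′ (cons {t₂} d₂ bound _) (next adj) (cons {r = r₂} (_ , _ , r₂≥1) _ _) rewrite ℕₚ.m+n∸m≡n t₂ d₂ =
    next (Adj-glue t d r t₂ d₂ r₂ r₂≥1 bound adj)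

peel-glueT : ∀ {b σ τ τ′ T} → Strip b τ τ′ → Skew σ τ′ T →
             peelτ τ (glueT τ τ′ T) ≡ τ′ × peelT (glueT τ τ′ T) ≡ T
peel-glueT [] [] = refl , refl
peel-glueT (cons {t} d _ strip) (cons {r = r} (_ , _ , r≥1) _ skew) rewrite ℕₚ.m+n∸m≡n t d
  with peel-glueT strip skew
... | eqτ , eqT = cong₂ _∷_ (cong (t ℕ.+_) (ones-glue d r r≥1)) eqτ , cong₂ _∷_ (rest-glue d r r≥1) eqT

HeadBound : ℕ → List ℕ → Filling → Set
HeadBound b (t ∷ τ) (r ∷ T) = t ℕ.+ ones r ≤ b
HeadBound b _       _ = ⊤

peel-head-bound : ∀ {s t r σ τ T} → Dec≤ s σ → Dec≤ t τ → Row s t r → Below t r τ T → Skew σ τ T → HeadBound t τ T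
peel-head-bound _ _ _ none [] = tt
peel-head-bound {t = t} {r} (s₂≤s , _) (t₂≤t , _) (len , _ , r≥1) (next {t₂} {r₂} adj) (cons (len₂ , l₂ , r₂≥1) _ _) =
  Adj-bound t r t₂ (ones r₂) (rest r₂) r≥1 t₂≤t
    (subst₂ _≤_ (trans (sym len₂) (cong (λ x → t₂ ℕ.+ length x) (sym eq₂))) (sym len) s₂≤s)
    (subst (Adj t r t₂) (sym eq₂) adj)
  where eq₂ = proj₁ (glue-ones-rest r₂ l₂ r₂≥1)

peel-Below : ∀ {s t r σ τ T} → Row s t r → Below t r τ T → Skew σ τ T →
             Below (t ℕ.+ ones r) (rest r) (peelτ τ T) (peelT T)
peel-Below _ none [] = none
peel-Below {t = t} {r} (_ , l , r≥1) (next {t₂} {r₂} adj) (cons (_ , l₂ , r₂≥1) _ _) =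
  next (Adj-unglue t (ones r) (rest r) t₂ (ones r₂) (rest r₂)
    (subst₂ (λ x y → Adj t x t₂ y) (sym (proj₁ (glue-ones-rest r l r≥1))) (sym (proj₁ (glue-ones-rest r₂ l₂ r₂≥1))) adj))

-- No row lies above the first one, so its bound `c` is supplied by `HeadBound`; for each later row
-- `peel-head-bound` obtains the bound from column strictness.
peel-Skew : ∀ {b b′ c σ τ T} → Dec≤ b σ → Dec≤ b′ τ → HeadBound c τ T → Skew σ τ T →
            Strip c τ (peelτ τ T) × Skew σ (peelτ τ T) (peelT T) × glueT τ (peelτ τ T) (peelT T) ≡ T
peel-Skew _ _ _ [] = [] , [] , refl
peel-Skew {σ = s ∷ σ} {t ∷ τ} {r ∷ T} (_ , Dσ) (_ , Dτ) hb (cons row@(len , l , r≥1) below skew)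
  with glue-ones-rest r l r≥1 | peel-Skew Dσ Dτ (peel-head-bound Dσ Dτ row below skew) skew
... | eq , rest≥1 | strip , skew′ , eqT =
    cons (ones r) hb strip
  , cons (Row-unglue s t (ones r) (rest r) rest≥1 (subst (Row s t) (sym eq) row)) (peel-Below row below skew) skew′
  , cong₂ _∷_ (trans (cong (λ d → glue d (rest r)) (ℕₚ.m+n∸m≡n t (ones r))) eq) eqT

-- Contents under removal of the entries 1

count-++ : ∀ k xs ys → count k (xs ++ ys) ≡ count k xs ℕ.+ count k ys
count-++ k xs ys = trans (cong length (filter-++ (λ x → k ℕ.≟ x) xs ys)) (length-++ (filter (λ x → k ℕ.≟ x) xs))

count-∷-≡ : ∀ k xs → count k (k ∷ xs) ≡ suc (count k xs)
count-∷-≡ k xs rewrite dec-true (k ℕ.≟ k) refl = refl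

count-∷-≢ : ∀ {k x} xs → k ≢ x → count k (x ∷ xs) ≡ count k xs
count-∷-≢ {k} {x} xs k≢x rewrite dec-false (k ℕ.≟ x) k≢x = refl

count-suc-map : ∀ k xs → count (suc k) (map suc xs) ≡ count k xs
count-suc-map k [] = refl
count-suc-map k (x ∷ xs) with k ℕ.≟ x
... | yes refl = trans (count-∷-≡ (suc k) (map suc xs)) (trans (cong suc (count-suc-map k xs)) (sym (count-∷-≡ k xs)))
... | no k≢x   = trans (count-∷-≢ (map suc xs) (k≢x ∘ ℕₚ.suc-injective)) (trans (count-suc-map k xs) (sym (count-∷-≢ xs k≢x)))

count-0 : ∀ xs → All (1 ≤_) xs → count 0 xs ≡ 0
count-0 []           [] = refl
count-0 (suc x ∷ xs) (_ ∷ ps) = count-0 xs ps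

count-glue-1 : ∀ d r → All (1 ≤_) r → count 1 (glue d r) ≡ d
count-glue-1 zero    r ps = trans (count-suc-map 0 r) (count-0 r ps)
count-glue-1 (suc d) r ps = cong suc (count-glue-1 d r ps)

count-glue-suc : ∀ k d r → count (suc (suc k)) (glue d r) ≡ count (suc k) r
count-glue-suc k zero    r = count-suc-map (suc k) r
count-glue-suc k (suc d) r = count-glue-suc k d r

count-glueT-1 : ∀ {b σ τ τ′ T} → Strip b τ τ′ → Skew σ τ′ T → count 1 (concat (glueT τ τ′ T)) ℕ.+ sum τ ≡ sum τ′
count-glueT-1 [] [] = refl
count-glueT-1 {τ = t ∷ τ} {_ ∷ τ′} (cons d _ strip) (cons {r = r} {T = T} (_ , _ , r≥1) _ skew) rewrite ℕₚ.m+n∸m≡n t d = begin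
  count 1 (glue d r ++ U) ℕ.+ (t ℕ.+ sum τ) ≡⟨ cong (ℕ._+ (t ℕ.+ sum τ)) (count-++ 1 (glue d r) U) ⟩
  count 1 (glue d r) ℕ.+ count 1 U ℕ.+ (t ℕ.+ sum τ) ≡⟨ cong (λ x → x ℕ.+ count 1 U ℕ.+ (t ℕ.+ sum τ)) (count-glue-1 d r r≥1) ⟩
  d ℕ.+ count 1 U ℕ.+ (t ℕ.+ sum τ) ≡⟨ solve 4 (λ d u t s → d :+ u :+ (t :+ s) := t :+ d :+ (u :+ s)) refl d (count 1 U) t (sum τ) ⟩
  t ℕ.+ d ℕ.+ (count 1 U ℕ.+ sum τ) ≡⟨ cong (t ℕ.+ d ℕ.+_) (count-glueT-1 strip skew) ⟩
  t ℕ.+ d ℕ.+ sum τ′ ∎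
  where
  open +-*-Solver
  U = concat (glueT τ τ′ T)

count-glueT-suc : ∀ k {b σ τ τ′ T} → Strip b τ τ′ → Skew σ τ′ T →
                  count (suc (suc k)) (concat (glueT τ τ′ T)) ≡ count (suc k) (concat T)
count-glueT-suc k [] [] = refl
count-glueT-suc k {τ = t ∷ τ} {_ ∷ τ′} (cons d _ strip) (cons {r = r} {T = T} _ _ skew) rewrite ℕₚ.m+n∸m≡n t d =
  trans (count-++ (suc (suc k)) (glue d r) (concat (glueT τ τ′ T)))
    (trans (cong₂ ℕ._+_ (count-glue-suc k d r) (count-glueT-suc k strip skew)) (sym (count-++ (suc k) r (concat T))))

HasContent : List ℕ → Filling → Set
HasContent α T = ∀ k → count (suc k) (concat T) ≡ nthℕ α k

Tab : List ℕ → List ℕ → List ℕ → Filling → Set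
Tab σ τ α T = Skew σ τ T × HasContent α T

Tab-[] : ∀ {σ τ T} → Skew σ τ T → HasContent [] T → τ ≡ σ × T ≡ map (λ _ → []) σ
Tab-[] []                                             _ = refl , refl
Tab-[] (cons {r = []} (len , _ , _) _ skew)           c with Tab-[] skew c
... | eqτ , eqT = cong₂ _∷_ (trans (sym (ℕₚ.+-identityʳ _)) len) eqτ , cong ([] ∷_) eqT
Tab-[] (cons {r = zero ∷ r} (_ , _ , () ∷ _) _ _)     c
Tab-[] (cons {r = suc x ∷ r} {T = T} _ _ _)           c with trans (sym (count-∷-≡ (suc x) (r ++ concat T))) (c x)
... | ()

empty-Skew : ∀ σ → Skew σ σ (map (λ _ → []) σ)
empty-Skew [] = []
empty-Skew (s ∷ σ) = cons (ℕₚ.+-identityʳ s , [] , []) (below σ) (empty-Skew σ)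
  where
  get-[] : ∀ t j {a} → get t [] j ≢ just a
  get-[] (suc t) (suc j) eq = get-[] t j eq
  below : ∀ σ → Below s [] σ (map (λ _ → []) σ)
  below [] = none
  below (s′ ∷ σ) = next (λ j a b eqa _ → ⊥-elim (get-[] s j eqa))

empty-Content : ∀ (σ : List ℕ) → HasContent [] (map (λ _ → []) σ)
empty-Content []      k = refl
empty-Content (s ∷ σ) k = empty-Content σ k

-- An index shift that is empty below `d`, where truncated subtraction would wrongly return `f 0`.
delay : {A : Set} → ℕ → (ℕ → List A) → ℕ → List A
delay zero    f k = f k
delay (suc d) f zero = []
delay (suc d) f (suc k) = delay d f k

mutual
  strips : ℕ → List ℕ → ℕ → List (List ℕ)
  strips b []      zero = [] ∷ []
  strips b []      (suc k) = []
  strips b (t ∷ τ) k = stripsUpTo (b ∸ t) t τ k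

  -- The first row grows by 0, ..., m. Building the list by increasing m lets an induction split off
  -- the strips in which this row grows by exactly m.
  stripsUpTo : ℕ → ℕ → List ℕ → ℕ → List (List ℕ)
  stripsUpTo zero    t τ k = map (t ℕ.+ 0 ∷_) (strips t τ k)
  stripsUpTo (suc m) t τ k = stripsUpTo m t τ k ++ map (t ℕ.+ suc m ∷_) (delay (suc m) (strips t τ) k)

+-rearrange : ∀ t d k s → (t ℕ.+ d) ℕ.+ (k ℕ.+ s) ≡ (d ℕ.+ k) ℕ.+ (t ℕ.+ s)
+-rearrange = solve 4 (λ t d k s → (t :+ d) :+ (k :+ s) := (d :+ k) :+ (t :+ s)) refl
  where
  open +-*-Solver

∈-delay⁻ : ∀ {A : Set} d (f : ℕ → List A) k {x} → x ∈ delay d f k → ∃ λ k′ → k ≡ d ℕ.+ k′ × x ∈ f k′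
∈-delay⁻ zero    f k       x∈ = k , refl , x∈
∈-delay⁻ (suc d) f (suc k) x∈ with ∈-delay⁻ d f k x∈
... | k′ , eq , x∈′ = k′ , cong suc eq , x∈′

∈-delay⁺ : ∀ {A : Set} d (f : ℕ → List A) k {x} → x ∈ f k → x ∈ delay d f (d ℕ.+ k)
∈-delay⁺ zero    f k x∈ = x∈
∈-delay⁺ (suc d) f k x∈ = ∈-delay⁺ d f k x∈

mutual
  strips-sound : ∀ {b} τ k {τ′} → Dec≤ b τ → τ′ ∈ strips b τ k → Strip b τ τ′ × sum τ′ ≡ k ℕ.+ sum τ
  strips-sound         []      zero _           (here refl) = [] , refl
  strips-sound {b} (t ∷ τ) k    (t≤b , Dτ) τ′∈ with stripsUpTo-sound (b ∸ t) t τ k Dτ τ′∈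
  ... | d , τ″ , d≤ , refl , strip , eq = cons d (ℕₚ.≤-trans (ℕₚ.+-monoʳ-≤ t d≤) (ℕₚ.≤-reflexive (ℕₚ.m+[n∸m]≡n t≤b))) strip , eq

  stripsUpTo-sound : ∀ m t τ k {τ′} → Dec≤ t τ → τ′ ∈ stripsUpTo m t τ k →
    ∃ λ d → ∃ λ τ″ → d ≤ m × τ′ ≡ t ℕ.+ d ∷ τ″ × Strip t τ τ″ × sum τ′ ≡ k ℕ.+ (t ℕ.+ sum τ)
  stripsUpTo-sound zero t τ k Dτ τ′∈ with ∈-map⁻ _ τ′∈
  ... | τ″ , τ″∈ , refl with strips-sound τ k Dτ τ″∈
  ... | strip , eq = 0 , τ″ , z≤n , refl , strip , trans (cong (t ℕ.+ 0 ℕ.+_) eq) (+-rearrange t 0 k (sum τ))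
  stripsUpTo-sound (suc m) t τ k Dτ τ′∈ with ∈-++⁻ (stripsUpTo m t τ k) τ′∈
  ... | inj₁ p with stripsUpTo-sound m t τ k Dτ p
  ...   | d , τ″ , d≤ , r = d , τ″ , ℕₚ.m≤n⇒m≤1+n d≤ , r
  stripsUpTo-sound (suc m) t τ k Dτ τ′∈ | inj₂ p with ∈-map⁻ _ p
  ...   | τ″ , τ″∈ , refl with ∈-delay⁻ (suc m) (strips t τ) k τ″∈
  ...     | k′ , refl , τ″∈′ with strips-sound τ k′ Dτ τ″∈′
  ...       | strip , eq = suc m , τ″ , ℕₚ.≤-refl , refl , strip , trans (cong (t ℕ.+ suc m ℕ.+_) eq) (+-rearrange t (suc m) k′ (sum τ))

sum-Strip : ∀ {b τ τ′} → Strip b τ τ′ → ∃ λ k → sum τ′ ≡ k ℕ.+ sum τ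
sum-Strip [] = 0 , refl
sum-Strip (cons {t} {τ} d _ strip) with sum-Strip strip
... | k , eq = d ℕ.+ k , trans (cong (t ℕ.+ d ℕ.+_) eq) (+-rearrange t d k (sum τ))

stripsUpTo-∈ : ∀ m t τ {d k τ′} → d ≤ m → τ′ ∈ strips t τ k → t ℕ.+ d ∷ τ′ ∈ stripsUpTo m t τ (d ℕ.+ k)
stripsUpTo-∈ zero    t τ         z≤n  τ′∈ = ∈-map⁺ _ τ′∈
stripsUpTo-∈ (suc m) t τ {d} {k} d≤sm τ′∈ with ℕₚ.m≤n⇒m<n∨m≡n d≤sm
... | inj₁ (s≤s d≤m) = ∈-++⁺ˡ (stripsUpTo-∈ m t τ d≤m τ′∈)
... | inj₂ refl = ∈-++⁺ʳ (stripsUpTo m t τ (suc m ℕ.+ k)) (∈-map⁺ _ (∈-delay⁺ (suc m) (strips t τ) k τ′∈))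

strips-complete : ∀ {b τ τ′} k → Strip b τ τ′ → sum τ′ ≡ k ℕ.+ sum τ → τ′ ∈ strips b τ k
strips-complete zero    []       _  = here refl
strips-complete (suc k) []       ()
strips-complete {b} k (cons {t} {τ} {τ′} d t+d≤b strip) eq with sum-Strip strip
... | k′ , eq′ = subst (λ k → t ℕ.+ d ∷ τ′ ∈ strips b (t ∷ τ) k) k≡
                 (stripsUpTo-∈ (b ∸ t) t τ d≤ (strips-complete k′ strip eq′))
  where
  d≤ : d ≤ b ∸ t
  d≤ = subst (_≤ b ∸ t) (ℕₚ.m+n∸m≡n t d) (ℕₚ.∸-monoˡ-≤ t t+d≤b)
  k≡ : d ℕ.+ k′ ≡ k
  k≡ = ℕₚ.+-cancelʳ-≡ (t ℕ.+ sum τ) (d ℕ.+ k′) k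
    (trans (sym (+-rearrange t d k′ (sum τ))) (trans (cong (t ℕ.+ d ℕ.+_) (sym eq′)) eq))

mutual
  strips-unique : ∀ b τ k → Unique (strips b τ k)
  strips-unique b []      zero = [] ∷ []
  strips-unique b []      (suc k) = []
  strips-unique b (t ∷ τ) k = stripsUpTo-unique (b ∸ t) t τ k

  stripsUpTo-unique : ∀ m t τ k → Unique (stripsUpTo m t τ k)
  stripsUpTo-unique zero    t τ k = Uniqueₚ.map⁺ ∷-injectiveʳ (strips-unique t τ k)
  stripsUpTo-unique (suc m) t τ k = Uniqueₚ.++⁺ (stripsUpTo-unique m t τ k)
    (Uniqueₚ.map⁺ ∷-injectiveʳ (delay-unique (suc m) k)) disjoint
    where
    delay-unique : ∀ d k → Unique (delay d (strips t τ) k)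
    delay-unique zero    k = strips-unique t τ k
    delay-unique (suc d) zero = []
    delay-unique (suc d) (suc k) = delay-unique d k
    heads : ∀ m {ν} → ν ∈ stripsUpTo m t τ k → ∃ λ d → d ≤ m × ∃ λ ν′ → ν ≡ t ℕ.+ d ∷ ν′
    heads zero    ν∈ with ∈-map⁻ _ ν∈
    ... | ν′ , _ , refl = 0 , z≤n , ν′ , refl
    heads (suc m) ν∈ with ∈-++⁻ (stripsUpTo m t τ k) ν∈
    ... | inj₁ p with heads m p
    ...   | d , d≤ , r = d , ℕₚ.m≤n⇒m≤1+n d≤ , r
    heads (suc m) ν∈ | inj₂ p with ∈-map⁻ _ p
    ...   | ν′ , _ , refl = suc m , ℕₚ.≤-refl , ν′ , refl
    disjoint : ∀ {ν} → ¬ (ν ∈ stripsUpTo m t τ k × ν ∈ map (t ℕ.+ suc m ∷_) (delay (suc m) (strips t τ) k))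
    disjoint (p , q) with heads m p | ∈-map⁻ _ q
    ... | d , d≤m , _ , refl | _ , _ , eq =
      ℕₚ.<-irrefl (ℕₚ.+-cancelˡ-≡ t d (suc m) (∷-injectiveˡ eq)) (s≤s d≤m)

-- Counts chains of horizontal strips from τ to σ with the sizes α, one strip for each letter. The
-- bound `b` on the number of columns stays fixed along the chain.
tabCount : List ℕ → ℕ → List ℕ → List ℕ → ℕ
tabCount σ b τ [] = if does (≡-dec ℕ._≟_ τ σ) then 1 else 0
tabCount σ b τ (k ∷ α) = sum (map (λ τ′ → tabCount σ b τ′ α) (strips b τ k))

Tab-card : ∀ {b} σ τ α → Dec≤ b σ → Dec≤ b τ → HasCard (Tab σ τ α) (tabCount σ b τ α)
Tab-card σ τ [] Dσ Dτ with ≡-dec ℕ._≟_ τ σ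
... | yes refl = (map (λ _ → []) σ ∷ []) , [] ∷ [] , (empty-Skew σ , empty-Content σ) ∷ []
    , (λ T (skew , c) → here (proj₂ (Tab-[] skew c))) , refl
... | no  τ≢σ  = [] , [] , [] , (λ T (skew , c) → ⊥-elim (τ≢σ (proj₁ (Tab-[] skew c)))) , refl
Tab-card {b} σ τ (k ∷ α) Dσ Dτ = HasCard-⋃ {P = λ τ′ → Tab σ τ′ α} (glueT τ) (λ T → peelτ τ T , peelT T) (strips b τ k)
  (strips-unique b τ k)
  (λ τ′ τ′∈ → Tab-card σ τ′ α Dσ (Strip-Dec≤ (proj₁ (strips-sound τ k Dτ τ′∈))))
  to inv from
  where
  to : ∀ τ′ T → τ′ ∈ strips b τ k → Tab σ τ′ α T → Tab σ τ (k ∷ α) (glueT τ τ′ T)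
  to τ′ T τ′∈ (skew , c) with strips-sound τ k Dτ τ′∈
  ... | strip , eq = glueT-Skew strip skew , content
    where
    content : HasContent (k ∷ α) (glueT τ τ′ T)
    content zero = ℕₚ.+-cancelʳ-≡ (sum τ) _ k (trans (count-glueT-1 strip skew) eq)
    content (suc j) = trans (count-glueT-suc j strip skew) (c j)
  inv : ∀ τ′ T → τ′ ∈ strips b τ k → Tab σ τ′ α T → (peelτ τ (glueT τ τ′ T) , peelT (glueT τ τ′ T)) ≡ (τ′ , T)
  inv τ′ T τ′∈ (skew , _) with peel-glueT (proj₁ (strips-sound τ k Dτ τ′∈)) skew
  ... | eqτ , eqT = cong₂ _,_ eqτ eqT
  head-bound : ∀ {σ τ T} → Dec≤ b σ → Skew σ τ T → HeadBound b τ T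
  head-bound _          [] = tt
  head-bound (s≤b , _) (cons {t = t} {r = r} (len , l , r≥1) _ _) =
    ℕₚ.≤-trans (ℕₚ.+-monoʳ-≤ t (ones≤length r)) (ℕₚ.≤-trans (ℕₚ.≤-reflexive len) s≤b)
    where
    ones≤length : ∀ r → ones r ≤ length r
    ones≤length [] = z≤n
    ones≤length (zero ∷ r) = z≤n
    ones≤length (suc zero ∷ r) = s≤s (ones≤length r)
    ones≤length (suc (suc _) ∷ r) = z≤n
  from : ∀ T → Tab σ τ (k ∷ α) T → peelτ τ T ∈ strips b τ k × Tab σ (peelτ τ T) α (peelT T) × glueT τ (peelτ τ T) (peelT T) ≡ T
  from T (skew , c) with peel-Skew Dσ Dτ (head-bound Dσ skew) skew
  ... | strip , skew′ , eq =
      strips-complete k strip (trans (sym (count-glueT-1 strip skew′)) (cong (ℕ._+ sum τ) (trans (cong (count 1 ∘ concat) eq) (c 0))))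
    , (skew′ , λ j → trans (sym (count-glueT-suc j strip skew′)) (trans (cong (count (suc (suc j)) ∘ concat) eq) (c (suc j))))
    , eq

-- Horizontal strips and alternating functions

Alternating-∷ : ∀ {G} u → Alternating G → Alternating (λ xs → G (u ∷ xs))
Alternating-∷ u alt = alternating (λ xs → repeated alt (u ∷ xs))

Alternating-++ : ∀ {G} us → Alternating G → Alternating (λ xs → G (us ++ xs))
Alternating-++ {G} us alt = alternating (λ xs x ys → trans (cong G (sym (++-assoc us xs (x ∷ x ∷ ys)))) (repeated alt (us ++ xs) x ys))

I-0 : ∀ k {F} → (∀ xs → F xs ≡ 0ℚ) → ∀ us → I k F us ≡ 0ℚ
I-0 zero    F0 us = F0 us
I-0 (suc k) F0 [] = refl
I-0 (suc k) F0 (u ∷ us) = 0+0 (I-0 (suc k) (λ xs → F0 (u ∷ xs)) us) (I-0 k (λ xs → F0 (suc u ∷ xs)) us)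

delayℚ : ℕ → (ℕ → ℚ) → ℕ → ℚ
delayℚ zero    f k = f k
delayℚ (suc d) f zero = 0ℚ
delayℚ (suc d) f (suc k) = delayℚ d f k

delayℚ-cong : ∀ d {f g} → f ≗ g → delayℚ d f ≗ delayℚ d g
delayℚ-cong zero    f≗g k = f≗g k
delayℚ-cong (suc d) f≗g zero = refl
delayℚ-cong (suc d) f≗g (suc k) = delayℚ-cong d f≗g k

delayℚ-0 : ∀ d k → delayℚ d (λ _ → 0ℚ) k ≡ 0ℚ
delayℚ-0 zero    k = refl
delayℚ-0 (suc d) zero = refl
delayℚ-0 (suc d) (suc k) = delayℚ-0 d k

sumℚ-delay : ∀ {A : Set} (F : A → ℚ) d f k → sumℚ (map F (delay d f k)) ≡ delayℚ d (λ k → sumℚ (map F (f k))) k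
sumℚ-delay F zero    f k = refl
sumℚ-delay F (suc d) f zero = refl
sumℚ-delay F (suc d) f (suc k) = sumℚ-delay F d f k

sumℚ-++ : ∀ xs ys → sumℚ (xs ++ ys) ≡ sumℚ xs + sumℚ ys
sumℚ-++ []       ys = sym (ℚₚ.+-identityˡ (sumℚ ys))
sumℚ-++ (x ∷ xs) ys = trans (cong (x +_) (sumℚ-++ xs ys)) (sym (ℚₚ.+-assoc x (sumℚ xs) (sumℚ ys)))

seg : ℕ → ℕ → List ℕ
seg h zero = []
seg h (suc m) = h ∷ seg (suc h) m

-- The shifted column lengths c_j + (b − j), for j = b, …, 1, of the shape with rows τ inside b columns,
-- all increased by h.
cols : ℕ → ℕ → List ℕ → List ℕ
cols b h [] = seg h b
cols b h (t ∷ τ) = seg h (b ∸ t) ++ cols t (suc (h ℕ.+ (b ∸ t))) τ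

seg-++ : ∀ h m n → seg h (m ℕ.+ n) ≡ seg h m ++ seg (h ℕ.+ m) n
seg-++ h zero    n = cong (λ x → seg x n) (sym (ℕₚ.+-identityʳ h))
seg-++ h (suc m) n = cong (h ∷_) (trans (seg-++ (suc h) m n) (cong (λ x → seg (suc h) m ++ seg x n) (sym (ℕₚ.+-suc h m))))

cols-split : ∀ t d h τ → Dec≤ t τ → cols (t ℕ.+ d) h τ ≡ seg h d ++ cols t (h ℕ.+ d) τ
cols-split t d h []       _ = trans (cong (seg h) (ℕₚ.+-comm t d)) (seg-++ h d t)
cols-split t d h (t₂ ∷ τ) (t₂≤t , _) = begin
  seg h (t ℕ.+ d ∸ t₂) ++ cols t₂ (suc (h ℕ.+ (t ℕ.+ d ∸ t₂))) τ
    ≡⟨ cong (λ x → seg h x ++ cols t₂ (suc (h ℕ.+ x)) τ) (trans (cong (_∸ t₂) (ℕₚ.+-comm t d)) (ℕₚ.+-∸-assoc d t₂≤t)) ⟩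
  seg h (d ℕ.+ (t ∸ t₂)) ++ cols t₂ (suc (h ℕ.+ (d ℕ.+ (t ∸ t₂)))) τ
    ≡⟨ cong₂ (λ x y → x ++ cols t₂ (suc y) τ) (seg-++ h d (t ∸ t₂)) (sym (ℕₚ.+-assoc h d (t ∸ t₂))) ⟩
  (seg h d ++ seg (h ℕ.+ d) (t ∸ t₂)) ++ cols t₂ (suc (h ℕ.+ d ℕ.+ (t ∸ t₂))) τ
    ≡⟨ ++-assoc (seg h d) _ _ ⟩
  seg h d ++ cols t (h ℕ.+ d) (t₂ ∷ τ) ∎

cols-suc : ∀ b h t τ → t ≤ b → cols (suc b) h (t ∷ τ) ≡ h ∷ cols b (suc h) (t ∷ τ)
cols-suc b h t τ t≤b rewrite ℕₚ.+-∸-assoc 1 t≤b | ℕₚ.+-suc h (b ∸ t) = refl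

cols-≡ : ∀ b h τ → cols b h (b ∷ τ) ≡ cols b (suc h) τ
cols-≡ b h τ rewrite ℕₚ.n∸n≡0 b | ℕₚ.+-identityʳ h = refl

-- The largest coordinate is that of the first column; it reaches `c` when this column becomes
-- longer than the number of rows. For the determinants this is the case of a zero row.
record Cap (c : ℕ) (G : List ℕ → ℚ) : Set where
  constructor cap
  field capped : ∀ xs → G (xs ++ [ c ]) ≡ 0ℚ

open Cap

Cap-++ : ∀ {c G} us → Cap c G → Cap c (λ xs → G (us ++ xs))
Cap-++ {c} {G} us top = cap (λ xs → trans (cong G (sym (++-assoc us xs [ c ]))) (capped top (us ++ xs)))

-- If the first entry of a run of consecutive numbers is raised, then every entry must be, because
-- otherwise two neighbours become equal.
I-run : ∀ m {G} → Alternating G → ∀ h us k →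
  I k (λ xs → G (h ∷ xs)) (seg h m ++ us) ≡ delayℚ m (λ k → I k (λ xs → G (seg h (suc m) ++ xs)) us) k
I-run zero    alt h us k = refl
I-run (suc m) alt h us zero = repeated alt [] h (seg (suc h) m ++ us)
I-run (suc m) alt h us (suc k) = trans
  (cong₂ _+_ (I-0 (suc k) (repeated alt [] h) (seg (suc h) m ++ us)) (I-run m (Alternating-∷ h alt) (suc h) us k))
  (ℚₚ.+-identityˡ _)

I-seg : ∀ m {G} → Alternating G → ∀ h us k → I k G (h ∷ seg (suc h) m ++ us) ≡
  I k (λ xs → G (h ∷ xs)) (seg (suc h) m ++ us) + delayℚ (suc m) (λ k → I k (λ xs → G (seg (suc h) (suc m) ++ xs)) us) k
I-seg m {G} alt h us zero = sym (ℚₚ.+-identityʳ (G (h ∷ seg (suc h) m ++ us)))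
I-seg m {G} alt h us (suc k) = cong (I (suc k) (λ xs → G (h ∷ xs)) (seg (suc h) m ++ us) +_) (I-run m alt (suc h) us k)

-- Below the last row nothing can be added: by `I-run` a raised coordinate pushes all later ones
-- along, and the last of them reaches the cap.
I-full : ∀ b {G} h k → Alternating G → Cap (h ℕ.+ b) G → I (suc k) G (seg h b) ≡ 0ℚ
I-full zero        h k alt top = refl
I-full (suc b) {G} h k alt top = 0+0
  (I-full b (suc h) k (Alternating-∷ h alt) (Cap-++ [ h ] (subst (λ c → Cap c G) (ℕₚ.+-suc h b) top)))
  (trans (cong (I k (λ xs → G (suc h ∷ xs))) (sym (++-identityʳ (seg (suc h) b))))
    (trans (I-run b alt (suc h) [] k)
      (trans (delayℚ-cong b last k) (delayℚ-0 b k))))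
  where
  last : ∀ k → I k (λ xs → G (seg (suc h) (suc b) ++ xs)) [] ≡ 0ℚ
  last (suc k) = refl
  last zero = trans (cong G eq) (capped top (seg (suc h) b))
    where
    eq : seg (suc h) (suc b) ++ [] ≡ seg (suc h) b ++ [ h ℕ.+ suc b ]
    eq = begin
      seg (suc h) (suc b) ++ [] ≡⟨ ++-identityʳ _ ⟩
      seg (suc h) (suc b) ≡⟨ cong (seg (suc h)) (ℕₚ.+-comm 1 b) ⟩
      seg (suc h) (b ℕ.+ 1) ≡⟨ seg-++ (suc h) b 1 ⟩
      seg (suc h) b ++ [ suc h ℕ.+ b ] ≡⟨ cong (λ x → seg (suc h) b ++ [ x ]) (sym (ℕₚ.+-suc h b)) ⟩
      seg (suc h) b ++ [ h ℕ.+ suc b ] ∎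

mutual
  -- Columns of equal length form a run of consecutive coordinates. By `I-run` only raises of a
  -- final segment of each run survive, and such a segment consists of the leftmost columns of that
  -- length, so that raising it lengthens one row; together these choices are the horizontal strips.
  sum-strips-cols : ∀ {c G} → Alternating G → Cap c G → ∀ b h τ k → Dec≤ b τ → h ℕ.+ b ℕ.+ length τ ≡ c →
    sumℚ (map (λ τ′ → G (cols b h τ′)) (strips b τ k)) ≡ I k G (cols b h τ)
  sum-strips-cols {G = G} alt top b h []      zero    _          _ = ℚₚ.+-identityʳ (G (seg h b))
  sum-strips-cols {G = G} alt top b h []      (suc k) _          refl = sym (I-full b h k alt (subst (λ c → Cap c G) (ℕₚ.+-identityʳ (h ℕ.+ b)) top))
  sum-strips-cols {c} {G} alt top b h (t ∷ τ) k       (t≤b , Dτ) eq   =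
    trans (cong (λ x → sumℚ (map (λ τ′ → G (cols x h τ′)) (stripsUpTo (b ∸ t) t τ k))) (sym (ℕₚ.m+[n∸m]≡n t≤b)))
      (sum-stripsUpTo-cols alt top (b ∸ t) h t τ k Dτ
        (trans (solve 4 (λ h m t l → con 1 :+ (h :+ m) :+ t :+ l := h :+ (t :+ m) :+ (con 1 :+ l)) refl h (b ∸ t) t (length τ))
               (trans (cong (λ x → h ℕ.+ x ℕ.+ suc (length τ)) (ℕₚ.m+[n∸m]≡n t≤b)) eq)))
    where open +-*-Solver

  sum-stripsUpTo-cols : ∀ {c G} → Alternating G → Cap c G → ∀ m h t τ k → Dec≤ t τ →
    suc (h ℕ.+ m) ℕ.+ t ℕ.+ length τ ≡ c →
    sumℚ (map (λ τ′ → G (cols (t ℕ.+ m) h τ′)) (stripsUpTo m t τ k)) ≡ I k G (seg h m ++ cols t (suc (h ℕ.+ m)) τ)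
  sum-stripsUpTo-cols {c} {G} alt top zero h t τ k Dτ eq = begin
    sumℚ (map (λ τ′ → G (cols (t ℕ.+ 0) h τ′)) (map (t ℕ.+ 0 ∷_) (strips t τ k)))
      ≡⟨ cong sumℚ (map-∘ (strips t τ k)) ⟨
    sumℚ (map (λ τ′ → G (cols (t ℕ.+ 0) h (t ℕ.+ 0 ∷ τ′))) (strips t τ k))
      ≡⟨ sumℚ-cong-∈ (strips t τ k) (λ {τ′} _ → cong G (trans (cong (λ x → cols x h (x ∷ τ′)) (ℕₚ.+-identityʳ t))
           (trans (cols-≡ t h τ′) (cong (λ x → cols t (suc x) τ′) (sym (ℕₚ.+-identityʳ h)))))) ⟩
    sumℚ (map (λ τ′ → G (cols t (suc (h ℕ.+ 0)) τ′)) (strips t τ k))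
      ≡⟨ sum-strips-cols alt top t (suc (h ℕ.+ 0)) τ k Dτ eq ⟩
    I k G (cols t (suc (h ℕ.+ 0)) τ) ∎
  sum-stripsUpTo-cols {c} {G} alt top (suc m) h t τ k Dτ eq = begin
    sumℚ (map F (stripsUpTo m t τ k ++ map (t ℕ.+ suc m ∷_) new))
      ≡⟨ trans (cong sumℚ (map-++ F (stripsUpTo m t τ k) _)) (sumℚ-++ (map F (stripsUpTo m t τ k)) _) ⟩
    sumℚ (map F (stripsUpTo m t τ k)) + sumℚ (map F (map (t ℕ.+ suc m ∷_) new))
      ≡⟨ cong₂ _+_ old-sum new-sum ⟩
    I k (λ xs → G (h ∷ xs)) (seg (suc h) m ++ us) + delayℚ (suc m) (λ k → I k (λ xs → G (seg (suc h) (suc m) ++ xs)) us) k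
      ≡⟨ I-seg m alt h us k ⟨
    I k G (h ∷ seg (suc h) m ++ us) ∎
    where
    F : List ℕ → ℚ
    F τ′ = G (cols (t ℕ.+ suc m) h τ′)
    new = delay (suc m) (strips t τ) k
    us = cols t (suc (h ℕ.+ suc m)) τ
    -- The first row stops short of the last column, whose coordinate `h` is therefore unchanged.
    old-sum : sumℚ (map F (stripsUpTo m t τ k)) ≡ I k (λ xs → G (h ∷ xs)) (seg (suc h) m ++ us)
    old-sum = begin
      sumℚ (map F (stripsUpTo m t τ k))
        ≡⟨ sumℚ-cong-∈ (stripsUpTo m t τ k) shorter ⟩
      sumℚ (map (λ τ′ → G (h ∷ cols (t ℕ.+ m) (suc h) τ′)) (stripsUpTo m t τ k))
        ≡⟨ sum-stripsUpTo-cols (Alternating-∷ h alt) (Cap-++ [ h ] top) m (suc h) t τ k Dτ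
             (trans (cong (λ x → suc x ℕ.+ t ℕ.+ length τ) (sym (ℕₚ.+-suc h m))) eq) ⟩
      I k (λ xs → G (h ∷ xs)) (seg (suc h) m ++ cols t (suc (suc h ℕ.+ m)) τ)
        ≡⟨ cong (λ x → I k (λ xs → G (h ∷ xs)) (seg (suc h) m ++ cols t (suc x) τ)) (ℕₚ.+-suc h m) ⟨
      I k (λ xs → G (h ∷ xs)) (seg (suc h) m ++ us) ∎
      where
      shorter : ∀ {τ′} → τ′ ∈ stripsUpTo m t τ k → F τ′ ≡ G (h ∷ cols (t ℕ.+ m) (suc h) τ′)
      shorter τ′∈ with stripsUpTo-sound m t τ k Dτ τ′∈
      ... | d , τ″ , d≤m , refl , _ = cong G (trans (cong (λ x → cols x h (t ℕ.+ d ∷ τ″)) (ℕₚ.+-suc t m))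
                                               (cols-suc (t ℕ.+ m) h (t ℕ.+ d) τ″ (ℕₚ.+-monoʳ-≤ t d≤m)))
    -- The first row reaches the last column, so the whole run is raised.
    new-sum : sumℚ (map F (map (t ℕ.+ suc m ∷_) new)) ≡ delayℚ (suc m) (λ k → I k (λ xs → G (seg (suc h) (suc m) ++ xs)) us) k
    new-sum = begin
      sumℚ (map F (map (t ℕ.+ suc m ∷_) new))
        ≡⟨ cong sumℚ (map-∘ new) ⟨
      sumℚ (map (λ τ′ → F (t ℕ.+ suc m ∷ τ′)) new)
        ≡⟨ sumℚ-delay (λ τ′ → F (t ℕ.+ suc m ∷ τ′)) (suc m) (strips t τ) k ⟩
      delayℚ (suc m) (λ k → sumℚ (map (λ τ′ → F (t ℕ.+ suc m ∷ τ′)) (strips t τ k))) k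
        ≡⟨ delayℚ-cong (suc m) (λ k → trans (sumℚ-cong-∈ (strips t τ k) (split k))
             (sum-strips-cols (Alternating-++ (seg (suc h) (suc m)) alt) (Cap-++ (seg (suc h) (suc m)) top) t (suc (h ℕ.+ suc m)) τ k Dτ eq)) k ⟩
      delayℚ (suc m) (λ k → I k (λ xs → G (seg (suc h) (suc m) ++ xs)) us) k ∎
      where
      split : ∀ k {τ′} → τ′ ∈ strips t τ k →
              F (t ℕ.+ suc m ∷ τ′) ≡ G (seg (suc h) (suc m) ++ cols t (suc (h ℕ.+ suc m)) τ′)
      split k {τ′} τ′∈ = cong G (trans (cols-≡ (t ℕ.+ suc m) h τ′)
        (cols-split t (suc m) (suc h) τ′ (Strip-Dec≤ (proj₁ (strips-sound τ k Dτ τ′∈)))))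

-- the shifted row lengths t_i + (n − i)
rows : ℕ → List ℕ → List ℕ
rows (suc n) (t ∷ τ) = t ℕ.+ n ∷ rows n τ
rows _       _ = []

strips-0 : ∀ b τ → strips b τ 0 ≡ [ τ ]
strips-0 b [] = refl
strips-0 b (t ∷ τ) = go (b ∸ t)
  where
  go : ∀ m → stripsUpTo m t τ 0 ≡ [ t ∷ τ ]
  go zero = trans (cong (map (t ℕ.+ 0 ∷_)) (strips-0 t τ)) (cong (λ x → [ x ∷ τ ]) (ℕₚ.+-identityʳ t))
  go (suc m) = trans (++-identityʳ _) (go m)

-- A strip of size 1 is a single cell. Adding it to a row as long as the one above makes two
-- neighbouring coordinates equal; for the first row, `edge` takes the place of this collision.
sum-strips-rows : ∀ {G} → Alternating G → ∀ b n t τ → length τ ≡ n → Dec≤ b (t ∷ τ) →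
  (b ≡ t → ∀ xs → G (suc (t ℕ.+ n) ∷ xs) ≡ 0ℚ) →
  sumℚ (map (λ τ′ → G (rows (suc n) τ′)) (strips b (t ∷ τ) 1)) ≡ I 1 G (rows (suc n) (t ∷ τ))
sum-strips-rows {G} alt b n t τ len (t≤b , Dτ) edge = trans (go (b ∸ t) refl) (cong (_+ G (suc (t ℕ.+ n) ∷ rows n τ)) (tail τ n len Dτ))
  where
  F : List ℕ → ℚ
  F τ′ = G (rows (suc n) τ′)
  inner : ℚ
  inner = sumℚ (map (λ τ′ → G (t ℕ.+ n ∷ rows n τ′)) (strips t τ 1))
  zero-sum : sumℚ (map F (stripsUpTo 0 t τ 1)) ≡ inner
  zero-sum = trans (cong sumℚ (sym (map-∘ (strips t τ 1))))
    (sumℚ-cong-∈ (strips t τ 1) (λ {τ′} _ → cong (λ x → G (x ℕ.+ n ∷ rows n τ′)) (ℕₚ.+-identityʳ t)))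
  pos-sum : ∀ m → sumℚ (map F (stripsUpTo (suc m) t τ 1)) ≡ inner + G (suc (t ℕ.+ n) ∷ rows n τ)
  pos-sum zero = begin
    sumℚ (map F (stripsUpTo 0 t τ 1 ++ map (t ℕ.+ 1 ∷_) (strips t τ 0)))
      ≡⟨ trans (cong sumℚ (map-++ F (stripsUpTo 0 t τ 1) _)) (sumℚ-++ (map F (stripsUpTo 0 t τ 1)) _) ⟩
    sumℚ (map F (stripsUpTo 0 t τ 1)) + sumℚ (map F (map (t ℕ.+ 1 ∷_) (strips t τ 0)))
      ≡⟨ cong₂ _+_ zero-sum (cong (λ ν → sumℚ (map F (map (t ℕ.+ 1 ∷_) ν))) (strips-0 t τ)) ⟩
    inner + (G (t ℕ.+ 1 ℕ.+ n ∷ rows n τ) + 0ℚ)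
      ≡⟨ cong (inner +_) (trans (ℚₚ.+-identityʳ _) (cong (λ x → G (x ℕ.+ n ∷ rows n τ)) (ℕₚ.+-comm t 1))) ⟩
    inner + G (suc (t ℕ.+ n) ∷ rows n τ) ∎
  pos-sum (suc m) = trans (cong (sumℚ ∘ map F) (++-identityʳ (stripsUpTo (suc m) t τ 1))) (pos-sum m)
  go : ∀ m → b ∸ t ≡ m → sumℚ (map F (stripsUpTo m t τ 1)) ≡ inner + G (suc (t ℕ.+ n) ∷ rows n τ)
  go (suc m) _  = pos-sum m
  go zero    eq = trans zero-sum (sym (trans (cong (inner +_) (edge (ℕₚ.≤-antisym (ℕₚ.m∸n≡0⇒m≤n eq) t≤b) (rows n τ))) (ℚₚ.+-identityʳ inner)))
  tail : ∀ τ n → length τ ≡ n → Dec≤ t τ →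
    sumℚ (map (λ τ′ → G (t ℕ.+ n ∷ rows n τ′)) (strips t τ 1)) ≡ I 1 (λ xs → G (t ℕ.+ n ∷ xs)) (rows n τ)
  tail []        zero    refl _  = refl
  tail (t₂ ∷ τ₂) (suc n) len  Dτ = sum-strips-rows (Alternating-∷ (t ℕ.+ suc n) alt) t n t₂ τ₂ (ℕₚ.suc-injective len) Dτ
    (λ { refl xs → trans (cong (λ x → G (x ∷ suc (t ℕ.+ n) ∷ xs)) (ℕₚ.+-suc t n)) (repeated alt [] (suc (t ℕ.+ n)) xs) })

I-snoc : ∀ k F us u → I (suc k) F (us ++ [ u ]) ≡ I (suc k) (λ xs → F (xs ++ [ u ])) us + I k (λ xs → F (xs ++ [ suc u ])) us
I-snoc zero    F []       u = refl
I-snoc (suc k) F []       u = refl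
I-snoc zero    F (v ∷ us) u = trans
  (cong (_+ F (suc v ∷ us ++ [ u ])) (I-snoc 0 (λ xs → F (v ∷ xs)) us u))
  (swap (I 1 (λ xs → F (v ∷ xs ++ [ u ])) us) (F (v ∷ us ++ [ suc u ])) (F (suc v ∷ us ++ [ u ])))
  where
  swap : ∀ a b c → (a + b) + c ≡ (a + c) + b
  swap = solve-∀ ℚ-ring
I-snoc (suc k) F (v ∷ us) u = trans
  (cong₂ _+_ (I-snoc (suc k) (λ xs → F (v ∷ xs)) us u) (I-snoc k (λ xs → F (suc v ∷ xs)) us u))
  (+-interchange (I (suc (suc k)) (λ xs → F (v ∷ xs ++ [ u ])) us) _ _ _)

I-reverse : ∀ k F us → I k F (reverse us) ≡ I k (λ xs → F (reverse xs)) us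
I-reverse zero    F us = refl
I-reverse (suc k) F [] = refl
I-reverse (suc k) F (u ∷ us) = begin
  I (suc k) F (reverse (u ∷ us))
    ≡⟨ cong (I (suc k) F) (unfold-reverse u us) ⟩
  I (suc k) F (reverse us ++ [ u ])
    ≡⟨ I-snoc k F (reverse us) u ⟩
  I (suc k) (λ xs → F (xs ++ [ u ])) (reverse us) + I k (λ xs → F (xs ++ [ suc u ])) (reverse us)
    ≡⟨ cong₂ _+_ (I-reverse (suc k) (λ xs → F (xs ++ [ u ])) us) (I-reverse k (λ xs → F (xs ++ [ suc u ])) us) ⟩
  I (suc k) (λ xs → F (reverse xs ++ [ u ])) us + I k (λ xs → F (reverse xs ++ [ suc u ])) us
    ≡⟨ cong₂ _+_ (I-cong (suc k) (λ xs → cong F (sym (unfold-reverse u xs))) us) (I-cong k (λ xs → cong F (sym (unfold-reverse (suc u) xs))) us) ⟩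
  I (suc k) (λ xs → F (reverse (u ∷ xs))) us + I k (λ xs → F (reverse (suc u ∷ xs))) us ∎

Alternating-reverse : ∀ {F} → Alternating F → Alternating (λ xs → F (reverse xs))
Alternating-reverse {F} alt = alternating (λ xs x ys → trans (cong F (eq xs x ys)) (repeated alt (reverse ys) x (reverse xs)))
  where
  eq : ∀ xs x ys → reverse (xs ++ x ∷ x ∷ ys) ≡ reverse ys ++ x ∷ x ∷ reverse xs
  eq xs x ys = begin
    reverse (xs ++ x ∷ x ∷ ys) ≡⟨ reverse-++ xs (x ∷ x ∷ ys) ⟩
    reverse (x ∷ x ∷ ys) ++ reverse xs ≡⟨ cong (_++ reverse xs) (reverse-++ (x ∷ x ∷ []) ys) ⟩
    (reverse ys ++ x ∷ x ∷ []) ++ reverse xs ≡⟨ ++-assoc (reverse ys) (x ∷ x ∷ []) (reverse xs) ⟩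
    reverse ys ++ x ∷ x ∷ reverse xs ∎

-- Tableau numbers as determinants

seg-≥ : ∀ h m → All (h ≤_) (seg h m)
seg-≥ h zero = []
seg-≥ h (suc m) = ℕₚ.≤-refl ∷ All.map (ℕₚ.≤-trans (ℕₚ.n≤1+n h)) (seg-≥ (suc h) m)

seg-< : ∀ h m → All (_< h ℕ.+ m) (seg h m)
seg-< h zero = []
seg-< h (suc m) rewrite ℕₚ.+-suc h m = s≤s (ℕₚ.m≤m+n h m) ∷ seg-< (suc h) m

seg-increasing : ∀ h m → AllPairs _<_ (seg h m)
seg-increasing h zero = []
seg-increasing h (suc m) = seg-≥ (suc h) m ∷ seg-increasing (suc h) m

cols-≥ : ∀ b h τ → All (h ≤_) (cols b h τ)
cols-≥ b h [] = seg-≥ h b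
cols-≥ b h (t ∷ τ) = Allₚ.++⁺ (seg-≥ h (b ∸ t))
  (All.map (ℕₚ.≤-trans (ℕₚ.≤-trans (ℕₚ.m≤m+n h (b ∸ t)) (ℕₚ.n≤1+n _))) (cols-≥ t (suc (h ℕ.+ (b ∸ t))) τ))

cols-< : ∀ b h τ → Dec≤ b τ → All (_< h ℕ.+ b ℕ.+ length τ) (cols b h τ)
cols-< b h []      _ = subst (λ c → All (_< c) (seg h b)) (sym (ℕₚ.+-identityʳ (h ℕ.+ b))) (seg-< h b)
cols-< b h (t ∷ τ) (t≤b , Dτ) = Allₚ.++⁺
  (All.map (λ p → ℕₚ.<-≤-trans p (ℕₚ.≤-trans (ℕₚ.+-monoʳ-≤ h (ℕₚ.m∸n≤m b t)) (ℕₚ.m≤m+n (h ℕ.+ b) _))) (seg-< h (b ∸ t)))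
  (subst (λ c → All (_< c) (cols t (suc (h ℕ.+ (b ∸ t))) τ)) eq (cols-< t (suc (h ℕ.+ (b ∸ t))) τ Dτ))
  where
  open +-*-Solver
  eq : suc (h ℕ.+ (b ∸ t)) ℕ.+ t ℕ.+ length τ ≡ h ℕ.+ b ℕ.+ suc (length τ)
  eq = trans (solve 4 (λ h m t l → con 1 :+ (h :+ m) :+ t :+ l := h :+ (m :+ t) :+ (con 1 :+ l)) refl h (b ∸ t) t (length τ))
             (cong (λ x → h ℕ.+ x ℕ.+ suc (length τ)) (ℕₚ.m∸n+n≡m t≤b))

cols-increasing : ∀ b h τ → AllPairs _<_ (cols b h τ)
cols-increasing b h [] = seg-increasing h b
cols-increasing b h (t ∷ τ) = AllPairsₚ.++⁺ (seg-increasing h (b ∸ t)) (cols-increasing t _ τ)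
  (All.map (λ p → All.map (λ q → ℕₚ.<-trans p q) (cols-≥ t (suc (h ℕ.+ (b ∸ t))) τ)) (seg-< h (b ∸ t)))

All-reverse : ∀ {P : ℕ → Set} {xs} → All P xs → All P (reverse xs)
All-reverse {xs = xs} = All-resp-↭ (↭-sym (↭-reverse xs))

reverse-increasing : ∀ {xs} → AllPairs _<_ xs → Decreasing (reverse xs)
reverse-increasing {[]}     [] = []
reverse-increasing {x ∷ xs} (p ∷ ps) = subst Decreasing (sym (unfold-reverse x xs))
  (AllPairsₚ.++⁺ (reverse-increasing ps) ([] ∷ []) (All.map (_∷ []) (All-reverse p)))

seg-++-injective : ∀ m m′ h {X X′} → All (suc (h ℕ.+ m) ≤_) X → All (suc (h ℕ.+ m′) ≤_) X′ →
  seg h m ++ X ≡ seg h m′ ++ X′ → m ≡ m′ × X ≡ X′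
seg-++-injective zero    zero     h _        _        eq = refl , eq
seg-++-injective zero    (suc m′) h (p ∷ _)  _        refl = ⊥-elim (ℕₚ.<-irrefl (ℕₚ.+-identityʳ h) p)
seg-++-injective (suc m) zero     h _        (p ∷ _)  refl = ⊥-elim (ℕₚ.<-irrefl (ℕₚ.+-identityʳ h) p)
seg-++-injective (suc m) (suc m′) h {X} {X′} X≥ X′≥ eq
  with seg-++-injective m m′ (suc h) (subst (λ c → All (suc c ≤_) X) (ℕₚ.+-suc h m) X≥)
                                     (subst (λ c → All (suc c ≤_) X′) (ℕₚ.+-suc h m′) X′≥) (proj₂ (∷-injective eq))
... | refl , eqX = refl , eqX

cols-injective : ∀ b h τ σ → Dec≤ b τ → Dec≤ b σ → length τ ≡ length σ → cols b h τ ≡ cols b h σ → τ ≡ σ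
cols-injective b h []      []      _          _          _   _  = refl
cols-injective b h (t ∷ τ) (s ∷ σ) (t≤b , Dτ) (s≤b , Dσ) len eq
  with seg-++-injective (b ∸ t) (b ∸ s) h (cols-≥ t _ τ) (cols-≥ s _ σ) eq
... | b∸t≡b∸s , eq′ with ℕₚ.∸-cancelˡ-≡ t≤b s≤b b∸t≡b∸s
... | refl = cong (t ∷_) (cols-injective t _ τ σ Dτ Dσ (ℕₚ.suc-injective len) eq′)

Strip-length : ∀ {b τ τ′} → Strip b τ τ′ → length τ′ ≡ length τ
Strip-length [] = refl
Strip-length (cons _ _ str) = cong suc (Strip-length str)

ℕ→ℚ-sum : ∀ {A : Set} (f : A → ℕ) xs → ℕ→ℚ (sum (map f xs)) ≡ sumℚ (map (λ x → ℕ→ℚ (f x)) xs)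
ℕ→ℚ-sum f [] = refl
ℕ→ℚ-sum f (x ∷ xs) = trans (ℕ→ℚ-+ (f x) (sum (map f xs))) (cong (ℕ→ℚ (f x) +_) (ℕ→ℚ-sum f xs))

det-[]-indicator : ∀ ts cs {A : Set} (d : Dec A) → Decreasing ts → Decreasing cs →
  (A → ts ≡ cs) → (ts ≡ cs → A) → ℕ→ℚ (if does d then 1 else 0) ≡ det ts cs []
det-[]-indicator ts cs (yes a) Dt Dc to _    with to a
... | refl = sym (det-≡ ts Dt)
det-[]-indicator ts cs (no ¬a) Dt Dc _  from = sym (det-≢ ts cs Dt Dc (¬a ∘ from))

-- `cols` increases while the determinants take decreasing coordinates, hence the reversals. A row
-- coordinate `b + length τ` exceeds every column coordinate of σ, which yields the zero row behind
-- `Cap`.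
tabCount-cols : ∀ b σ → Dec≤ b σ → ∀ α τ → Dec≤ b τ → length τ ≡ length σ →
  ℕ→ℚ (tabCount σ b τ α) ≡ det (reverse (cols b 0 τ)) (reverse (cols b 0 σ)) α
tabCount-cols b σ Dσ []      τ Dτ len = det-[]-indicator (reverse (cols b 0 τ)) (reverse (cols b 0 σ)) (≡-dec ℕ._≟_ τ σ)
  (reverse-increasing (cols-increasing b 0 τ)) (reverse-increasing (cols-increasing b 0 σ))
  (cong (λ ν → reverse (cols b 0 ν))) (λ eq → cols-injective b 0 τ σ Dτ Dσ len (reverse-injective eq))
tabCount-cols b σ Dσ (k ∷ α) τ Dτ len = begin
  ℕ→ℚ (sum (map (λ τ′ → tabCount σ b τ′ α) (strips b τ k)))
    ≡⟨ ℕ→ℚ-sum (λ τ′ → tabCount σ b τ′ α) (strips b τ k) ⟩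
  sumℚ (map (λ τ′ → ℕ→ℚ (tabCount σ b τ′ α)) (strips b τ k))
    ≡⟨ sumℚ-cong-∈ (strips b τ k) (λ {τ′} τ′∈ → let strip = proj₁ (strips-sound τ k Dτ τ′∈) in
         tabCount-cols b σ Dσ α τ′ (Strip-Dec≤ strip) (trans (Strip-length strip) len)) ⟩
  sumℚ (map (λ τ′ → det (reverse (cols b 0 τ′)) cs α) (strips b τ k))
    ≡⟨ sum-strips-cols (Alternating-reverse (det-alternating cs α)) (cap top) b 0 τ k Dτ refl ⟩
  I k (λ us → det (reverse us) cs α) (cols b 0 τ)
    ≡⟨ I-reverse k (λ us → det us cs α) (cols b 0 τ) ⟨
  I k (λ us → det us cs α) (reverse (cols b 0 τ))
    ≡⟨ det-step (reverse (cols b 0 τ)) cs k α ⟨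
  det (reverse (cols b 0 τ)) cs (k ∷ α) ∎
  where
  cs = reverse (cols b 0 σ)
  top : ∀ xs → det (reverse (xs ++ [ b ℕ.+ length τ ])) cs α ≡ 0ℚ
  top xs = trans (cong (λ ts → det ts cs α) (reverse-++ xs [ b ℕ.+ length τ ]))
    (∂-< (b ℕ.+ length τ) (det (reverse xs)) cs α
      (All-reverse (subst (λ l → All (_< b ℕ.+ l) (cols b 0 σ)) (sym len) (cols-< b 0 σ Dσ))))

rows-≤ : ∀ n {b} τ → Dec≤ b τ → All (_< b ℕ.+ n) (rows n τ)
rows-≤ zero    []      _ = []
rows-≤ zero    (t ∷ τ) _ = []
rows-≤ (suc n) []      _ = []
rows-≤ (suc n) {b} (t ∷ τ) (t≤b , Dτ) = subst (t ℕ.+ n <_) (sym (ℕₚ.+-suc b n)) (s≤s (ℕₚ.+-monoˡ-≤ n t≤b))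
  ∷ All.map (λ p → ℕₚ.<-≤-trans p (ℕₚ.+-mono-≤ t≤b (ℕₚ.n≤1+n n))) (rows-≤ n τ Dτ)

rows-decreasing : ∀ n {b} τ → Dec≤ b τ → Decreasing (rows n τ)
rows-decreasing zero    []      _ = []
rows-decreasing zero    (t ∷ τ) _ = []
rows-decreasing (suc n) []      _ = []
rows-decreasing (suc n) (t ∷ τ) (_ , Dτ) = rows-≤ n τ Dτ ∷ rows-decreasing n τ Dτ

rows-injective : ∀ n τ σ → length τ ≡ n → length σ ≡ n → rows n τ ≡ rows n σ → τ ≡ σ
rows-injective zero    []      []      _    _    _  = refl
rows-injective (suc n) (t ∷ τ) (s ∷ σ) lenτ lenσ eq with ∷-injective eq
... | eq₁ , eq₂ = cong₂ _∷_ (ℕₚ.+-cancelʳ-≡ n t s eq₁) (rows-injective n τ σ (ℕₚ.suc-injective lenτ) (ℕₚ.suc-injective lenσ) eq₂)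

-- With the first row length of σ as the bound, a first row of τ that grows past it gets a
-- coordinate above all those of σ, and its row of the determinant is zero.
tabCount-rows : ∀ n σ → length σ ≡ n → Dec≤ (nthℕ σ 0) σ → ∀ M τ → Dec≤ (nthℕ σ 0) τ → length τ ≡ n →
  ℕ→ℚ (tabCount σ (nthℕ σ 0) τ (replicate M 1)) ≡ det (rows n τ) (rows n σ) (replicate M 1)
tabCount-rows n σ lenσ Dσ zero    τ Dτ lenτ = det-[]-indicator (rows n τ) (rows n σ) (≡-dec ℕ._≟_ τ σ)
  (rows-decreasing n τ Dτ) (rows-decreasing n σ Dσ) (cong (rows n)) (rows-injective n τ σ lenτ lenσ)
tabCount-rows n σ lenσ Dσ (suc M) τ Dτ lenτ = begin
  ℕ→ℚ (sum (map (λ τ′ → tabCount σ b τ′ α) (strips b τ 1)))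
    ≡⟨ ℕ→ℚ-sum (λ τ′ → tabCount σ b τ′ α) (strips b τ 1) ⟩
  sumℚ (map (λ τ′ → ℕ→ℚ (tabCount σ b τ′ α)) (strips b τ 1))
    ≡⟨ sumℚ-cong-∈ (strips b τ 1) (λ {τ′} τ′∈ → let strip = proj₁ (strips-sound τ 1 Dτ τ′∈) in
         tabCount-rows n σ lenσ Dσ M τ′ (Strip-Dec≤ strip) (trans (Strip-length strip) lenτ)) ⟩
  sumℚ (map (λ τ′ → det (rows n τ′) cs α) (strips b τ 1))
    ≡⟨ strip-sum n τ Dτ lenτ refl ⟩
  I 1 (λ us → det us cs α) (rows n τ)
    ≡⟨ det-step (rows n τ) cs 1 α ⟨
  det (rows n τ) cs (1 ∷ α) ∎
  where
  b = nthℕ σ 0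
  α = replicate M 1
  cs = rows n σ
  strip-sum : ∀ m τ → Dec≤ b τ → length τ ≡ m → m ≡ n →
    sumℚ (map (λ τ′ → det (rows m τ′) cs α) (strips b τ 1)) ≡ I 1 (λ us → det us cs α) (rows m τ)
  strip-sum zero    []      _          _   _ = refl
  strip-sum (suc m) (t ∷ τ) Dτ@(t≤b , _) len refl = sum-strips-rows (det-alternating cs α) b m t τ (ℕₚ.suc-injective len) Dτ
    (λ { eq xs → ∂-< (suc (t ℕ.+ m)) (det xs) cs α (subst (λ c → All (_< c) cs) (trans (cong (ℕ._+ suc m) eq) (ℕₚ.+-suc t m)) (rows-≤ (suc m) σ Dσ)) })

-- The determinant as a symmetric function

module Mono = NewtonAction monomial-action
module Wt = NewtonAction weight-action

det-monoCoeff : ∀ ts cs α → monoCoeff (S.det ts cs) α ≡ det ts cs α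
det-monoCoeff ts cs α = subst₂ (λ x y → monoCoeff (S.det ts cs) α ≡ det x y α) (map-id ts) (map-id cs)
  (det-rel symmetric elementary (λ G f → ∀ α → monoCoeff G α ≡ f α) (λ x → x)
    (λ _ → refl) unit minus ent-value ts cs α)
  where
  unit : ∀ α → 1ℚ * ℕ→ℚ (if allZero α then 1 else 0) + 0ℚ ≡ (if allZero α then 1ℚ else 0ℚ)
  unit α with allZero α
  ... | true  = refl
  ... | false = refl
  minus : ∀ x y x′ y′ → (∀ α → monoCoeff x α ≡ y α) → (∀ α → monoCoeff x′ α ≡ y′ α) →
          ∀ α → monoCoeff (x ⊟ x′) α ≡ y α - y′ α
  minus x y x′ y′ p q α = trans (val-⊟ _ x x′) (cong₂ _-_ (p α) (q α))
  ent-value : ∀ t c x y → (∀ α → monoCoeff x α ≡ y α) → ∀ α → monoCoeff (S.ent t c x) α ≡ ent t c y α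
  ent-value zero    c       x y p α = trans (Mono.value-eMul c x α) (E-cong c p α)
  ent-value (suc t) zero    x y p α = refl
  ent-value (suc t) (suc c) x y p α = ent-value t c x y p α

-- On 0/1-contents, E m acts as multiplication by x^m / m!.
E-squarefree : ∀ m {f h} → (∀ α → All (_≤ 1) α → f α ≡ h (sum α)) →
               ∀ α → All (_≤ 1) α → E m f α ≡ H m h (sum α)
E-squarefree zero    fh α                [] = fh α []
E-squarefree zero    fh α                (p ∷ ps) = fh α (p ∷ ps)
E-squarefree (suc m) fh []               [] = refl
E-squarefree (suc m) fh (zero ∷ α)       (p ∷ ps) =
  trans (cong₂ _+_ (E-squarefree (suc m) (λ β β≤1 → fh (0 ∷ β) (p ∷ β≤1)) α ps) (E-0 m α)) (ℚₚ.+-identityʳ _)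
E-squarefree (suc m) {f} {h} fh (suc zero ∷ α) (p ∷ ps) = trans
  (cong₂ _+_ (E-squarefree (suc m) {f ⟨ 1 ⟩} {D h} (λ β β≤1 → fh (1 ∷ β) (p ∷ β≤1)) α ps)
             (E-squarefree m {f ⟨ 0 ⟩} {h} (λ β β≤1 → fh (0 ∷ β) (z≤n ∷ β≤1)) α ps))
  (ℚₚ.+-comm (H (suc m) (D h) (sum α)) (H m h (sum α)))
E-squarefree (suc m) fh (suc (suc _) ∷ α) (s≤s () ∷ ps)

-- On contents with entries 0 and 1, e_{2m} acts as x^{2m} / (2m)!, which is the operator of e_m in
-- `weight-action`. So doubled coordinates on the side of contents match the original ones under θ.
det-weight : ∀ ts cs α → All (_≤ 1) α → det (map dbl ts) (map dbl cs) α ≡ Wt.value (S.det ts cs) (sum α)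
det-weight ts cs = det-rel symmetric elementary (λ G f → ∀ α → All (_≤ 1) α → f α ≡ Wt.value G (sum α)) dbl
  (λ _ _ → refl) unit
  (λ x y x′ y′ p q α α≤1 → trans (cong₂ _-_ (p α α≤1) (q α α≤1)) (sym (val-⊟ _ x x′)))
  ent-value ts cs
  where
  unit : ∀ α → All (_≤ 1) α → (if allZero α then 1ℚ else 0ℚ) ≡ 1ℚ * 𝟙 (sum α) + 0ℚ
  unit []                 _ = refl
  unit (zero ∷ α)         (_ ∷ ps) = unit α ps
  unit (suc zero ∷ α)     _ = refl
  unit (suc (suc _) ∷ α)  (s≤s () ∷ _)
  ent-value : ∀ t c G f → (∀ α → All (_≤ 1) α → f α ≡ Wt.value G (sum α)) →
              ∀ α → All (_≤ 1) α → ent (dbl t) (dbl c) f α ≡ Wt.value (S.ent t c G) (sum α)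
  ent-value zero    c       G f p α α≤1 = trans (E-squarefree (dbl c) p α α≤1) (sym (Wt.value-eMul c G (sum α)))
  ent-value (suc t) zero    G f p α α≤1 = refl
  ent-value (suc t) (suc c) G f p α α≤1 = ent-value t c G f p α α≤1

det-pos : ∀ ts cs → PosIndexed (S.det ts cs)
det-pos = det-rel symmetric symmetric (λ G _ → PosIndexed G) (λ x → x) [] ([] ∷ []) (λ _ _ _ _ → ⊟-pos) ent-pos
  where
  ent-pos : ∀ t c G (_ : SymFun) → PosIndexed G → PosIndexed (S.ent t c G)
  ent-pos zero    c       G _ p = eMul-pos c p
  ent-pos (suc t) zero    G _ p = []
  ent-pos (suc t) (suc c) G _ p = ent-pos t c G G p

-- Comparison with the tableaux of the statement

get-entry : ∀ t r j → (if t ≤ᵇ j then nth r (j ∸ t) else nothing) ≡ get t r j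
get-entry zero          r j = refl
get-entry (suc t)       r zero = refl
get-entry (suc zero)    r (suc j) = refl
get-entry (suc (suc t)) r (suc j) = get-entry (suc t) r j

entry-zero : ∀ t τ r T j → entry (t ∷ τ) (r ∷ T) 0 j ≡ get t r j
entry-zero t τ r T j = get-entry t r j

entry-suc : ∀ t τ r T i j → entry (t ∷ τ) (r ∷ T) (suc i) j ≡ entry τ T i j
entry-suc t τ r T i j with nth T i
... | nothing  = refl
... | just row = refl

-- `RowLengths` subtracts with truncation; `τ ≤ σ` turns its equations into the additive ones of
-- `Row`.
Skew⁺ : ∀ {σ τ T} → Pointwise _≤_ τ σ → RowLengths σ τ T → All (Linked _≤_) T → ColumnsStrict τ T →
        All (All (1 ≤_)) T → Skew σ τ T
Skew⁺ []                         []           []       _   [] = []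
Skew⁺ {s ∷ σ} {t ∷ τ} {r ∷ T} (t≤s ∷ τ≤σ) (len ∷ lens) (l ∷ ls) str (p ∷ ps) =
  cons (trans (cong (t ℕ.+_) len) (ℕₚ.m+[n∸m]≡n t≤s) , l , p) (below τ≤σ lens str)
    (Skew⁺ τ≤σ lens ls
      (λ i j a b ea eb → str (suc i) j a b (trans (entry-suc t τ r T i j) ea) (trans (entry-suc t τ r T (suc i) j) eb)) ps)
  where
  below : ∀ {σ τ T} → Pointwise _≤_ τ σ → RowLengths σ τ T → ColumnsStrict (t ∷ τ) (r ∷ T) → Below t r τ T
  below []      []       str = none
  below {τ = t′ ∷ τ} {r′ ∷ T} (_ ∷ _) (_ ∷ _) str = next (λ j a b ea eb → str 0 j a b
    (trans (entry-zero t (t′ ∷ τ) r (r′ ∷ T) j) ea)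
    (trans (entry-suc t (t′ ∷ τ) r (r′ ∷ T) 0 j) (trans (entry-zero t′ τ r′ T j) eb)))

Skew⁻ : ∀ {σ τ T} → Skew σ τ T → RowLengths σ τ T × All (Linked _≤_) T × ColumnsStrict τ T × All (All (1 ≤_)) T
Skew⁻ [] = [] , [] , (λ i j a b ()) , []
Skew⁻ (cons {s} {t} {r} {σ} {τ} {T} (len , l , p) below skew) with Skew⁻ skew
... | lens , ls , str , ps =
    trans (sym (ℕₚ.m+n∸m≡n t (length r))) (cong (_∸ t) len) ∷ lens , l ∷ ls , strict below , p ∷ ps
  where
  strict : Below t r τ T → ColumnsStrict (t ∷ τ) (r ∷ T)
  strict none       zero    j a b ea ()
  strict (next {t′} {r′} {τ′} {T′} adj) zero j a b ea eb = adj j a b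
    (trans (sym (entry-zero t τ r T j)) ea)
    (trans (sym (entry-zero t′ τ′ r′ T′ j)) (trans (sym (entry-suc t τ r T 0 j)) eb))
  strict _          (suc i) j a b ea eb = str i j a b
    (trans (sym (entry-suc t τ r T i j)) ea) (trans (sym (entry-suc t τ r T (suc i) j)) eb)

count-∈ : ∀ {k xs} → k ∈ xs → 1 ≤ count k xs
count-∈ {k} {x ∷ xs} (here refl) = subst (1 ≤_) (sym (count-∷-≡ k xs)) (s≤s z≤n)
count-∈ {k} {x ∷ xs} (there k∈) with k ℕ.≟ x
... | yes refl = subst (1 ≤_) (sym (count-∷-≡ k xs)) (s≤s z≤n)
... | no  k≢x  = subst (1 ≤_) (sym (count-∷-≢ xs k≢x)) (count-∈ k∈)

∈-count : ∀ k xs → 1 ≤ count k xs → k ∈ xs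
∈-count k (x ∷ xs) p with k ℕ.≟ x
... | yes refl = here refl
... | no  k≢x  = there (∈-count k xs (subst (1 ≤_) (count-∷-≢ xs k≢x) p))

count-> : ∀ {k xs n} → All (_≤ n) xs → n < k → count k xs ≡ 0
count-> {xs = []}     []       _   = refl
count-> {xs = x ∷ xs} (p ∷ ps) n<k = trans (count-∷-≢ xs (λ { refl → ℕₚ.<-irrefl refl (ℕₚ.<-≤-trans n<k p) })) (count-> ps n<k)

nthℕ-≥ : ∀ α k → length α ≤ k → nthℕ α k ≡ 0
nthℕ-≥ []      k       _ = refl
nthℕ-≥ (a ∷ α) (suc k) (s≤s p) = nthℕ-≥ α k p

nthℕ-≥1 : ∀ α k → 1 ≤ nthℕ α k → k < length α
nthℕ-≥1 (a ∷ α) zero    _ = s≤s z≤n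
nthℕ-≥1 (a ∷ α) (suc k) p = s≤s (nthℕ-≥1 α k p)

nthℕ-applyUpTo : ∀ g n k → k < n → nthℕ (applyUpTo g n) k ≡ g k
nthℕ-applyUpTo g (suc n) zero    _ = refl
nthℕ-applyUpTo g (suc n) (suc k) (s≤s p) = nthℕ-applyUpTo (g ∘ suc) n k p

applyUpTo-nthℕ : ∀ α → applyUpTo (nthℕ α) (length α) ≡ α
applyUpTo-nthℕ [] = refl
applyUpTo-nthℕ (a ∷ α) = cong (a ∷_) (applyUpTo-nthℕ α)

applyUpTo-cong : ∀ {A : Set} {f g : ℕ → A} n → (∀ i → i < n → f i ≡ g i) → applyUpTo f n ≡ applyUpTo g n
applyUpTo-cong zero    _   = refl
applyUpTo-cong (suc n) f≡g = cong₂ _∷_ (f≡g 0 (s≤s z≤n)) (applyUpTo-cong n (λ i i<n → f≡g (suc i) (s≤s i<n)))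

map-oneTo : ∀ {A : Set} (f : ℕ → A) n → map f (oneTo n) ≡ applyUpTo (f ∘ suc) n
map-oneTo f n = trans (sym (map-∘ (upTo n))) (map-upTo (f ∘ suc) n)

SSYT⇒Tab : ∀ {σ τ α T} → Pointwise _≤_ τ σ →
  RowLengths σ τ T × All (Linked _≤_) T × ColumnsStrict τ T × All (All (λ x → 1 ≤ x × x ≤ length α)) T ×
    map (λ k → count k (concat T)) (oneTo (length α)) ≡ α →
  Tab σ τ α T
SSYT⇒Tab {α = α} {T} τ≤σ (lens , ls , str , rng , cnt) =
  Skew⁺ τ≤σ lens ls str (All.map (All.map proj₁) rng) , content
  where
  content : HasContent α T
  content k with k ℕ.<? length α
  ... | yes k< = trans (sym (nthℕ-applyUpTo (λ j → count (suc j) (concat T)) (length α) k k<))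
                       (cong (λ l → nthℕ l k) (trans (sym (map-oneTo (λ j → count j (concat T)) (length α))) cnt))
  ... | no  k≮ = trans (count-> (Allₚ.concat⁺ (All.map (All.map proj₂) rng)) (s≤s (ℕₚ.≮⇒≥ k≮)))
                       (sym (nthℕ-≥ α k (ℕₚ.≮⇒≥ k≮)))

Tab⇒SSYT : ∀ {σ τ α T} → Tab σ τ α T →
  RowLengths σ τ T × All (Linked _≤_) T × ColumnsStrict τ T × All (All (λ x → 1 ≤ x × x ≤ length α)) T ×
    map (λ k → count k (concat T)) (oneTo (length α)) ≡ α
Tab⇒SSYT {α = α} {T} (skew , content) with Skew⁻ skew
... | lens , ls , str , ps = lens , ls , str , Allₚ.concat⁻ (All.tabulate range)
  , trans (map-oneTo (λ k → count k (concat T)) (length α)) (trans (applyUpTo-cong (length α) (λ k _ → content k)) (applyUpTo-nthℕ α))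
  where
  range : ∀ {x} → x ∈ concat T → 1 ≤ x × x ≤ length α
  range {x} x∈ with All.lookup (Allₚ.concat⁺ ps) x∈
  range {suc x} x∈ | x≥1 = x≥1 , nthℕ-≥1 α x (subst (1 ≤_) (content x) (count-∈ x∈))

count-↭ : ∀ k {xs ys} → xs ↭ ys → count k xs ≡ count k ys
count-↭ k p = ↭-length (filter-↭ (λ x → k ℕ.≟ x) p)

count-≗⇒↭ : ∀ xs ys → (∀ k → count k xs ≡ count k ys) → xs ↭ ys
count-≗⇒↭ []       []       _  = ↭-refl
count-≗⇒↭ []       (y ∷ ys) eq with trans (eq y) (count-∷-≡ y ys)
... | ()
count-≗⇒↭ (x ∷ xs) ys       eq with ∈-∃++ (∈-count x ys (subst (1 ≤_) (trans (sym (count-∷-≡ x xs)) (eq x)) (s≤s z≤n)))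
... | as , bs , refl = ↭-trans (prep x (count-≗⇒↭ xs (as ++ bs) eq′)) (↭-sym (shift x as bs))
  where
  count-[x] : ∀ k zs → count k (x ∷ zs) ≡ count k [ x ] ℕ.+ count k zs
  count-[x] k zs = count-++ k [ x ] zs
  eq′ : ∀ k → count k xs ≡ count k (as ++ bs)
  eq′ k = ℕₚ.+-cancelˡ-≡ (count k [ x ]) _ _
    (trans (sym (count-[x] k xs)) (trans (eq k) (trans (count-↭ k (shift x as bs)) (count-[x] k (as ++ bs)))))

upTo-suc : ∀ n → upTo (suc n) ≡ 0 ∷ map suc (upTo n)
upTo-suc n = cong (0 ∷_) (sym (map-upTo suc n))

count-upTo : ∀ k n → count k (upTo n) ≡ nthℕ (replicate n 1) k
count-upTo k       zero = refl
count-upTo zero    (suc n) = trans (cong (count 0) (upTo-suc n)) (cong suc (count-0 (map suc (upTo n)) (Allₚ.map⁺ (All.universal (λ _ → s≤s z≤n) (upTo n)))))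
count-upTo (suc k) (suc n) = trans (cong (count (suc k)) (upTo-suc n)) (trans (count-suc-map k (upTo n)) (count-upTo k n))

oneTo-positive : ∀ n → All (1 ≤_) (oneTo n)
oneTo-positive n = Allₚ.map⁺ (All.universal (λ _ → s≤s z≤n) (upTo n))

Skew-size : ∀ {σ τ T} → Skew σ τ T → sum σ ≡ length (concat T) ℕ.+ sum τ
Skew-size [] = refl
Skew-size (cons {s} {t} {r} {σ} {τ} {T} (len , _) _ skew) = begin
  s ℕ.+ sum σ ≡⟨ cong₂ ℕ._+_ (sym len) (Skew-size skew) ⟩
  t ℕ.+ length r ℕ.+ (length (concat T) ℕ.+ sum τ) ≡⟨ solve 4 (λ t r c s → t :+ r :+ (c :+ s) := r :+ c :+ (t :+ s)) refl t (length r) (length (concat T)) (sum τ) ⟩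
  length r ℕ.+ length (concat T) ℕ.+ (t ℕ.+ sum τ) ≡⟨ cong (ℕ._+ (t ℕ.+ sum τ)) (length-++ r) ⟨
  length (r ++ concat T) ℕ.+ (t ℕ.+ sum τ) ∎
  where
  open +-*-Solver

module _ {σ τ : List ℕ} {M : ℕ} (size : sum σ ≡ M ℕ.+ sum τ) where

  private
    length≡M : ∀ {T} → Skew σ τ T → length (concat T) ≡ M
    length≡M skew = ℕₚ.+-cancelʳ-≡ (sum τ) _ M (trans (sym (Skew-size skew)) size)

  -- A standard tableau is a semistandard one of content (1, ..., 1). The permutation condition of
  -- `IsSYT` refers to the number of entries of `T`, which `size` identifies with `M`.
  SYT⇒Tab : ∀ {T} → Pointwise _≤_ τ σ → IsSYT σ τ T → Tab σ τ (replicate M 1) T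
  SYT⇒Tab {T} τ≤σ (lens , ls , str , perm) = skew , content
    where
    skew : Skew σ τ T
    skew = Skew⁺ τ≤σ lens (All.map (Linked.map ℕₚ.<⇒≤) ls) str
      (Allₚ.concat⁻ (All-resp-↭ (↭-sym perm) (oneTo-positive (length (concat T)))))
    content : HasContent (replicate M 1) T
    content k = trans (count-↭ (suc k) perm) (trans (count-suc-map k (upTo (length (concat T))))
      (trans (count-upTo k (length (concat T))) (cong (λ m → nthℕ (replicate m 1) k) (length≡M skew))))

  Tab⇒SYT : ∀ {T} → Tab σ τ (replicate M 1) T → IsSYT σ τ T
  Tab⇒SYT {T} (skew , content) with Skew⁻ skew
  ... | lens , ls , str , ps = lens , strict T ls (λ k → ≤1 k) , str , count-≗⇒↭ (concat T) (oneTo (length (concat T))) counts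
    where
    counts : ∀ k → count k (concat T) ≡ count k (oneTo (length (concat T)))
    counts zero = trans (count-0 (concat T) (Allₚ.concat⁺ ps)) (sym (count-0 (oneTo (length (concat T))) (oneTo-positive (length (concat T)))))
    counts (suc k) = trans (content k) (trans (cong (λ m → nthℕ (replicate m 1) k) (sym (length≡M skew)))
      (trans (sym (count-upTo k (length (concat T)))) (sym (count-suc-map k (upTo (length (concat T)))))))
    nthℕ-replicate-≤ : ∀ M k → nthℕ (replicate M 1) k ≤ 1
    nthℕ-replicate-≤ zero    k = z≤n
    nthℕ-replicate-≤ (suc M) zero = s≤s z≤n
    nthℕ-replicate-≤ (suc M) (suc k) = nthℕ-replicate-≤ M k
    ≤1 : ∀ k → count k (concat T) ≤ 1
    ≤1 zero = subst (_≤ 1) (sym (count-0 (concat T) (Allₚ.concat⁺ ps))) z≤n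
    ≤1 (suc k) = subst (_≤ 1) (sym (content k)) (nthℕ-replicate-≤ M k)
    row-strict : ∀ r → Linked _≤_ r → (∀ k → count k r ≤ 1) → Linked _<_ r
    row-strict []          _       _  = []
    row-strict (x ∷ [])    _       _  = [-]
    row-strict (x ∷ y ∷ r) (p ∷ l) c≤ = ℕₚ.≤∧≢⇒< p x≢y ∷ row-strict (y ∷ r) l (λ k → ℕₚ.≤-trans (count-tail k) (c≤ k))
      where
      count-tail : ∀ k → count k (y ∷ r) ≤ count k (x ∷ y ∷ r)
      count-tail k = subst (count k (y ∷ r) ≤_) (sym (count-++ k [ x ] (y ∷ r))) (ℕₚ.m≤n+m _ (count k [ x ]))
      x≢y : x ≢ y
      x≢y refl = ℕₚ.<-irrefl refl (ℕₚ.≤-trans (s≤s (s≤s z≤n))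
        (subst (_≤ 1) (trans (count-∷-≡ x (x ∷ r)) (cong suc (count-∷-≡ x r))) (c≤ x)))
    strict : ∀ T → All (Linked _≤_) T → (∀ k → count k (concat T) ≤ 1) → All (Linked _<_) T
    strict []      []       _  = []
    strict (r ∷ T) (l ∷ ls) c≤ =
      row-strict r l (λ k → ℕₚ.≤-trans (ℕₚ.m≤m+n (count k r) _) (split k)) ∷ strict T ls (λ k → ℕₚ.≤-trans (ℕₚ.m≤n+m _ (count k r)) (split k))
      where
      split : ∀ k → count k r ℕ.+ count k (concat T) ≤ 1
      split k = subst (_≤ 1) (count-++ k r (concat T)) (c≤ k)

-- The shape ρ(λ)

-- the length of column i + 1
column : List ℕ → ℕ → ℕ
column τ i = length (filter (λ a → suc i ℕ.≤? a) τ)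

column-< : ∀ t τ {i} → i < t → column (t ∷ τ) i ≡ suc (column τ i)
column-< t τ {i} i<t = cong length (filter-accept (λ a → suc i ℕ.≤? a) i<t)

column-≥ : ∀ t τ {i} → t ≤ i → column (t ∷ τ) i ≡ column τ i
column-≥ t τ {i} t≤i = cong length (filter-reject (λ a → suc i ℕ.≤? a) (ℕₚ.≤⇒≯ t≤i))

column-0 : ∀ {b i} τ → Dec≤ b τ → b ≤ i → column τ i ≡ 0
column-0 []      _          _   = refl
column-0 (t ∷ τ) (t≤b , Dτ) b≤i = trans (column-≥ t τ (ℕₚ.≤-trans t≤b b≤i)) (column-0 τ Dτ (ℕₚ.≤-trans t≤b b≤i))

column-antitone : ∀ τ i → column τ (suc i) ≤ column τ i
column-antitone []      i = z≤n
column-antitone (t ∷ τ) i with suc i ℕ.<? t | i ℕ.<? t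
... | yes p | _ = subst₂ _≤_ (sym (column-< t τ p)) (sym (column-< t τ (ℕₚ.<-trans (ℕₚ.n<1+n i) p))) (s≤s (column-antitone τ i))
... | no ¬p | yes q = subst₂ _≤_ (sym (column-≥ t τ (ℕₚ.≮⇒≥ ¬p))) (sym (column-< t τ q)) (ℕₚ.m≤n⇒m≤1+n (column-antitone τ i))
... | no ¬p | no ¬q = subst₂ _≤_ (sym (column-≥ t τ (ℕₚ.≮⇒≥ ¬p))) (sym (column-≥ t τ (ℕₚ.≮⇒≥ ¬q))) (column-antitone τ i)

applyUpTo-+ : ∀ {A : Set} (f : ℕ → A) m n → applyUpTo f (m ℕ.+ n) ≡ applyUpTo f m ++ applyUpTo (λ i → f (m ℕ.+ i)) n
applyUpTo-+ f zero    n = refl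
applyUpTo-+ f (suc m) n = cong (f 0 ∷_) (applyUpTo-+ (f ∘ suc) m n)

sum-applyUpTo-+ : ∀ f g n → sum (applyUpTo (λ i → f i ℕ.+ g i) n) ≡ sum (applyUpTo f n) ℕ.+ sum (applyUpTo g n)
sum-applyUpTo-+ f g zero = refl
sum-applyUpTo-+ f g (suc n) = trans (cong (f 0 ℕ.+ g 0 ℕ.+_) (sum-applyUpTo-+ (f ∘ suc) (g ∘ suc) n))
  (solve 4 (λ a b c d → (a :+ b) :+ (c :+ d) := (a :+ c) :+ (b :+ d)) refl (f 0) (g 0) _ _)
  where
  open +-*-Solver

sum-suc : ∀ f n → sum (applyUpTo (λ i → suc (f i)) n) ≡ n ℕ.+ sum (applyUpTo f n)
sum-suc f zero = refl
sum-suc f (suc n) = cong suc (trans (cong (f 0 ℕ.+_) (sum-suc (f ∘ suc) n))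
  (trans (sym (ℕₚ.+-assoc (f 0) n _)) (trans (cong (ℕ._+ sum (applyUpTo (f ∘ suc) n)) (ℕₚ.+-comm (f 0) n)) (ℕₚ.+-assoc n (f 0) _))))

sum-column : ∀ b τ → Dec≤ b τ → sum (applyUpTo (column τ) b) ≡ sum τ
sum-column b []      _ = zeros b
  where
  zeros : ∀ b → sum (applyUpTo (λ _ → 0) b) ≡ 0
  zeros zero = refl
  zeros (suc b) = zeros b
sum-column b (t ∷ τ) (t≤b , Dτ) = begin
  sum (applyUpTo (column (t ∷ τ)) b)
    ≡⟨ cong (λ x → sum (applyUpTo (column (t ∷ τ)) x)) (ℕₚ.m+[n∸m]≡n t≤b) ⟨
  sum (applyUpTo (column (t ∷ τ)) (t ℕ.+ (b ∸ t)))
    ≡⟨ cong sum (applyUpTo-+ (column (t ∷ τ)) t (b ∸ t)) ⟩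
  sum (applyUpTo (column (t ∷ τ)) t ++ applyUpTo (λ i → column (t ∷ τ) (t ℕ.+ i)) (b ∸ t))
    ≡⟨ cong₂ (λ xs ys → sum (xs ++ ys)) (applyUpTo-cong t (λ i → column-< t τ))
         (applyUpTo-cong (b ∸ t) (λ i _ → column-≥ t τ (ℕₚ.m≤m+n t i))) ⟩
  sum (applyUpTo (λ i → suc (column τ i)) t ++ applyUpTo (λ i → column τ (t ℕ.+ i)) (b ∸ t))
    ≡⟨ sum-++ (applyUpTo (λ i → suc (column τ i)) t) _ ⟩
  sum (applyUpTo (λ i → suc (column τ i)) t) ℕ.+ sum (applyUpTo (λ i → column τ (t ℕ.+ i)) (b ∸ t))
    ≡⟨ cong (ℕ._+ sum (applyUpTo (λ i → column τ (t ℕ.+ i)) (b ∸ t))) (sum-suc (column τ) t) ⟩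
  t ℕ.+ sum (applyUpTo (column τ) t) ℕ.+ sum (applyUpTo (λ i → column τ (t ℕ.+ i)) (b ∸ t))
    ≡⟨ ℕₚ.+-assoc t (sum (applyUpTo (column τ) t)) _ ⟩
  t ℕ.+ (sum (applyUpTo (column τ) t) ℕ.+ sum (applyUpTo (λ i → column τ (t ℕ.+ i)) (b ∸ t)))
    ≡⟨ cong (t ℕ.+_) (sym (trans (cong sum (applyUpTo-+ (column τ) t (b ∸ t))) (sum-++ (applyUpTo (column τ) t) _))) ⟩
  t ℕ.+ sum (applyUpTo (column τ) (t ℕ.+ (b ∸ t)))
    ≡⟨ cong (λ x → t ℕ.+ sum (applyUpTo (column τ) x)) (ℕₚ.m+[n∸m]≡n t≤b) ⟩
  t ℕ.+ sum (applyUpTo (column τ) b)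
    ≡⟨ cong (t ℕ.+_) (sum-column b τ (Dec≤-mono τ t≤b Dτ)) ⟩
  t ℕ.+ sum τ ∎

reverse-seg : ∀ h m → reverse (seg h m) ≡ applyUpTo (λ i → h ℕ.+ (m ∸ suc i)) m
reverse-seg h zero = refl
reverse-seg h (suc m) = begin
  reverse (h ∷ seg (suc h) m) ≡⟨ unfold-reverse h (seg (suc h) m) ⟩
  reverse (seg (suc h) m) ++ [ h ] ≡⟨ cong₂ (λ xs x → xs ++ [ x ]) (reverse-seg (suc h) m) last ⟩
  applyUpTo (λ i → suc h ℕ.+ (m ∸ suc i)) m ++ [ h ℕ.+ (m ∸ m) ] ≡⟨ cong (_++ [ h ℕ.+ (m ∸ m) ]) (applyUpTo-cong m (λ i i<m → trans (sym (ℕₚ.+-suc h _)) (cong (h ℕ.+_) (sym (ℕₚ.+-∸-assoc 1 i<m))))) ⟩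
  applyUpTo (λ i → h ℕ.+ (suc m ∸ suc i)) m ++ [ h ℕ.+ (m ∸ m) ] ≡⟨ applyUpTo-∷ʳ (λ i → h ℕ.+ (suc m ∸ suc i)) m ⟩
  applyUpTo (λ i → h ℕ.+ (suc m ∸ suc i)) (suc m) ∎
  where
  last : h ≡ h ℕ.+ (m ∸ m)
  last = sym (trans (cong (h ℕ.+_) (ℕₚ.n∸n≡0 m)) (ℕₚ.+-identityʳ h))

-- Passes from the encoding by runs, suited to induction over rows, to explicit column lengths,
-- which enter the definition of ρ(λ).
reverse-cols : ∀ b h τ → Dec≤ b τ → reverse (cols b h τ) ≡ applyUpTo (λ i → h ℕ.+ (b ∸ suc i) ℕ.+ column τ i) b
reverse-cols b h []      _ = trans (reverse-seg h b) (applyUpTo-cong b (λ i _ → sym (ℕₚ.+-identityʳ _)))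
reverse-cols b h (t ∷ τ) (t≤b , Dτ) = begin
  reverse (seg h (b ∸ t) ++ cols t h′ τ)
    ≡⟨ reverse-++ (seg h (b ∸ t)) (cols t h′ τ) ⟩
  reverse (cols t h′ τ) ++ reverse (seg h (b ∸ t))
    ≡⟨ cong₂ _++_ (reverse-cols t h′ τ Dτ) (reverse-seg h (b ∸ t)) ⟩
  applyUpTo (λ i → h′ ℕ.+ (t ∸ suc i) ℕ.+ column τ i) t ++ applyUpTo (λ i → h ℕ.+ (b ∸ t ∸ suc i)) (b ∸ t)
    ≡⟨ cong₂ _++_ (applyUpTo-cong t low) (applyUpTo-cong (b ∸ t) (λ i _ → high i)) ⟩
  applyUpTo F t ++ applyUpTo (λ i → F (t ℕ.+ i)) (b ∸ t)
    ≡⟨ applyUpTo-+ F t (b ∸ t) ⟨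
  applyUpTo F (t ℕ.+ (b ∸ t))
    ≡⟨ cong (applyUpTo F) (ℕₚ.m+[n∸m]≡n t≤b) ⟩
  applyUpTo F b ∎
  where
  open +-*-Solver
  h′ = suc (h ℕ.+ (b ∸ t))
  F : ℕ → ℕ
  F i = h ℕ.+ (b ∸ suc i) ℕ.+ column (t ∷ τ) i
  low : ∀ i → i < t → h′ ℕ.+ (t ∸ suc i) ℕ.+ column τ i ≡ F i
  low i i<t = begin
    suc (h ℕ.+ (b ∸ t)) ℕ.+ (t ∸ suc i) ℕ.+ column τ i
      ≡⟨ solve 4 (λ h m t c → con 1 :+ (h :+ m) :+ t :+ c := h :+ (m :+ t) :+ (con 1 :+ c)) refl h (b ∸ t) (t ∸ suc i) (column τ i) ⟩
    h ℕ.+ ((b ∸ t) ℕ.+ (t ∸ suc i)) ℕ.+ suc (column τ i)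
      ≡⟨ cong₂ (λ x y → h ℕ.+ x ℕ.+ y) (trans (sym (ℕₚ.+-∸-assoc (b ∸ t) i<t)) (cong (_∸ suc i) (ℕₚ.m∸n+n≡m t≤b))) (sym (column-< t τ i<t)) ⟩
    F i ∎
  high : ∀ i → h ℕ.+ (b ∸ t ∸ suc i) ≡ F (t ℕ.+ i)
  high i = begin
    h ℕ.+ (b ∸ t ∸ suc i) ≡⟨ cong (h ℕ.+_) (trans (ℕₚ.∸-+-assoc b t (suc i)) (cong (b ∸_) (ℕₚ.+-suc t i))) ⟩
    h ℕ.+ (b ∸ suc (t ℕ.+ i)) ≡⟨ ℕₚ.+-identityʳ _ ⟨
    h ℕ.+ (b ∸ suc (t ℕ.+ i)) ℕ.+ 0 ≡⟨ cong (h ℕ.+ (b ∸ suc (t ℕ.+ i)) ℕ.+_) (column-0 (t ∷ τ) (ℕₚ.≤-refl , Dτ) (ℕₚ.m≤m+n t i)) ⟨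
    F (t ℕ.+ i) ∎

rows-applyUpTo : ∀ n f → rows n (applyUpTo f n) ≡ applyUpTo (λ i → f i ℕ.+ (n ∸ suc i)) n
rows-applyUpTo zero    f = refl
rows-applyUpTo (suc n) f = cong (f 0 ℕ.+ n ∷_) (rows-applyUpTo n (f ∘ suc))

applyUpTo-Dec≤ : ∀ f → (∀ i → f (suc i) ≤ f i) → ∀ {b} n → f 0 ≤ b → Dec≤ b (applyUpTo f n)
applyUpTo-Dec≤ f mono zero    _ = tt
applyUpTo-Dec≤ f mono (suc n) f0≤b = f0≤b , applyUpTo-Dec≤ (f ∘ suc) (mono ∘ suc) n (mono 0)

applyUpTo-Pointwise : ∀ {f g : ℕ → ℕ} → (∀ i → f i ≤ g i) → ∀ n → Pointwise _≤_ (applyUpTo f n) (applyUpTo g n)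
applyUpTo-Pointwise f≤g zero = []
applyUpTo-Pointwise f≤g (suc n) = f≤g 0 ∷ applyUpTo-Pointwise (f≤g ∘ suc) n

Linked-Dec≤ : ∀ λs → Linked (λ a b → b ≤ a) λs → Dec≤ (nthℕ λs 0) λs
Linked-Dec≤ []           _ = tt
Linked-Dec≤ (x ∷ [])     _ = ℕₚ.≤-refl , tt
Linked-Dec≤ (x ∷ y ∷ λs) (p ∷ l) = ℕₚ.≤-refl , Dec≤-mono (y ∷ λs) p (Linked-Dec≤ (y ∷ λs) l)

replicate-0-Dec≤ : ∀ b r → Dec≤ b (replicate r 0)
replicate-0-Dec≤ b zero = tt
replicate-0-Dec≤ b (suc r) = z≤n , replicate-0-Dec≤ 0 r

replicate-0-Pointwise : ∀ σ → Pointwise _≤_ (replicate (length σ) 0) σ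
replicate-0-Pointwise [] = []
replicate-0-Pointwise (s ∷ σ) = z≤n ∷ replicate-0-Pointwise σ

sum-replicate-1 : ∀ M → sum (replicate M 1) ≡ M
sum-replicate-1 zero = refl
sum-replicate-1 (suc M) = cong suc (sum-replicate-1 M)

column-replicate-0 : ∀ r i → column (replicate r 0) i ≡ 0
column-replicate-0 zero    i = refl
column-replicate-0 (suc r) i = trans (column-≥ 0 (replicate r 0) z≤n) (column-replicate-0 r i)

dbl≡+ : ∀ n → dbl n ≡ n ℕ.+ n
dbl≡+ zero = refl
dbl≡+ (suc n) = cong suc (trans (cong suc (dbl≡+ n)) (sym (ℕₚ.+-suc n n)))

module Rho (λs : List ℕ) (Dλ : Dec≤ (nthℕ λs 0) λs) where

  L : ℕ
  L = nthℕ λs 0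

  δ-shift : ℕ → ℕ
  δ-shift i = L ∸ suc i

  outer : ℕ → ℕ
  outer i = dbl (column λs i) ℕ.+ δ-shift i

  ts cs : List ℕ
  ts = reverse (cols L 0 (replicate (length λs) 0))
  cs = reverse (cols L 0 λs)

  conjugate≡ : conjugate λs ≡ applyUpTo (column λs) L
  conjugate≡ = map-oneTo (λ i → length (filter (λ a → i ℕ.≤? a) λs)) L

  length-conjugate : length (conjugate λs) ≡ L
  length-conjugate = trans (cong length conjugate≡) (length-applyUpTo (column λs) L)

  rhoInner≡ : rhoInner λs ≡ applyUpTo δ-shift L
  rhoInner≡ = trans (cong (λ ℓ → map (λ i → ℓ ∸ suc i) (upTo ℓ)) length-conjugate) (map-upTo δ-shift L)

  rhoOuter≡ : rhoOuter λs ≡ applyUpTo outer L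
  rhoOuter≡ = trans (cong (λ ℓ → map (λ i → 2 ℕ.* nthℕ (conjugate λs) i ℕ.+ (ℓ ∸ suc i)) (upTo ℓ)) length-conjugate)
    (trans (map-upTo _ L) (applyUpTo-cong L (λ i i<L → cong (ℕ._+ δ-shift i)
      (trans (cong (2 ℕ.*_) (trans (cong (λ c → nthℕ c i) conjugate≡) (nthℕ-applyUpTo (column λs) L i i<L)))
             (sym (dbl≡2* (column λs i)))))))

  δ-antitone : ∀ i → δ-shift (suc i) ≤ δ-shift i
  δ-antitone i = ℕₚ.∸-monoʳ-≤ L (ℕₚ.n≤1+n (suc i))

  dbl-mono : ∀ {m n} → m ≤ n → dbl m ≤ dbl n
  dbl-mono z≤n = z≤n
  dbl-mono (s≤s p) = s≤s (s≤s (dbl-mono p))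

  outer-antitone : ∀ i → outer (suc i) ≤ outer i
  outer-antitone i = ℕₚ.+-mono-≤ (dbl-mono (column-antitone λs i)) (δ-antitone i)

  rhoInner≤rhoOuter : Pointwise _≤_ (rhoInner λs) (rhoOuter λs)
  rhoInner≤rhoOuter = subst₂ (Pointwise _≤_) (sym rhoInner≡) (sym rhoOuter≡)
    (applyUpTo-Pointwise (λ i → ℕₚ.m≤n+m (δ-shift i) (dbl (column λs i))) L)

  b : ℕ
  b = nthℕ (rhoOuter λs) 0

  decreasing-below : ∀ f → (∀ i → f (suc i) ≤ f i) → (∀ i → f i ≤ outer i) → Dec≤ b (applyUpTo f L)
  decreasing-below f mono f≤ = subst (λ σ → Dec≤ (nthℕ σ 0) (applyUpTo f L)) (sym rhoOuter≡) (go L)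
    where
    go : ∀ n → Dec≤ (nthℕ (applyUpTo outer n) 0) (applyUpTo f n)
    go zero = tt
    go (suc n) = applyUpTo-Dec≤ f mono (suc n) (f≤ 0)

  rhoOuter-Dec≤ : Dec≤ b (rhoOuter λs)
  rhoOuter-Dec≤ = subst (Dec≤ b) (sym rhoOuter≡) (decreasing-below outer outer-antitone (λ _ → ℕₚ.≤-refl))

  rhoInner-Dec≤ : Dec≤ b (rhoInner λs)
  rhoInner-Dec≤ = subst (Dec≤ b) (sym rhoInner≡) (decreasing-below δ-shift δ-antitone (λ i → ℕₚ.m≤n+m (δ-shift i) (dbl (column λs i))))

  length-rhoOuter : length (rhoOuter λs) ≡ L
  length-rhoOuter = trans (cong length rhoOuter≡) (length-applyUpTo outer L)

  length-rhoInner : length (rhoInner λs) ≡ L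
  length-rhoInner = trans (cong length rhoInner≡) (length-applyUpTo δ-shift L)

  size : sum (rhoOuter λs) ≡ dbl (sum λs) ℕ.+ sum (rhoInner λs)
  size = begin
    sum (rhoOuter λs) ≡⟨ cong sum rhoOuter≡ ⟩
    sum (applyUpTo outer L) ≡⟨ sum-applyUpTo-+ (dbl ∘ column λs) δ-shift L ⟩
    sum (applyUpTo (dbl ∘ column λs) L) ℕ.+ sum (applyUpTo δ-shift L) ≡⟨ cong₂ ℕ._+_ (trans (sum-dbl (column λs) L) (cong dbl (sum-column L λs Dλ))) (cong sum (sym rhoInner≡)) ⟩
    dbl (sum λs) ℕ.+ sum (rhoInner λs) ∎
    where
    sum-dbl : ∀ f n → sum (applyUpTo (dbl ∘ f) n) ≡ dbl (sum (applyUpTo f n))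
    sum-dbl f zero = refl
    sum-dbl f (suc n) = trans (cong (dbl (f 0) ℕ.+_) (sum-dbl (f ∘ suc) n)) (sym (dbl-+ (f 0) _))

  -- The indentation of row i of ρ(λ) equals the shift that `rows` adds to it. This makes the
  -- shifted inner lengths even, and likewise the outer ones in `rows-rhoOuter`.
  rows-rhoInner : rows L (rhoInner λs) ≡ map dbl ts
  rows-rhoInner = begin
    rows L (rhoInner λs) ≡⟨ cong (rows L) rhoInner≡ ⟩
    rows L (applyUpTo δ-shift L) ≡⟨ rows-applyUpTo L δ-shift ⟩
    applyUpTo (λ i → δ-shift i ℕ.+ δ-shift i) L ≡⟨ applyUpTo-cong L (λ i _ → trans (sym (dbl≡+ (δ-shift i)))
                                                             (cong dbl (sym (trans (cong (δ-shift i ℕ.+_) (column-replicate-0 (length λs) i)) (ℕₚ.+-identityʳ _))))) ⟩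
    applyUpTo (λ i → dbl (0 ℕ.+ δ-shift i ℕ.+ column (replicate (length λs) 0) i)) L
                                                        ≡⟨ map-applyUpTo _ dbl L ⟨
    map dbl (applyUpTo (λ i → 0 ℕ.+ δ-shift i ℕ.+ column (replicate (length λs) 0) i) L)
                                                        ≡⟨ cong (map dbl) (reverse-cols L 0 (replicate (length λs) 0) (replicate-0-Dec≤ L (length λs))) ⟨
    map dbl ts ∎

  rows-rhoOuter : rows L (rhoOuter λs) ≡ map dbl cs
  rows-rhoOuter = begin
    rows L (rhoOuter λs) ≡⟨ cong (rows L) rhoOuter≡ ⟩
    rows L (applyUpTo outer L) ≡⟨ rows-applyUpTo L outer ⟩
    applyUpTo (λ i → outer i ℕ.+ δ-shift i) L ≡⟨ applyUpTo-cong L (λ i _ → double-sum (column λs i) (δ-shift i)) ⟩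
    applyUpTo (λ i → dbl (0 ℕ.+ δ-shift i ℕ.+ column λs i)) L ≡⟨ map-applyUpTo _ dbl L ⟨
    map dbl (applyUpTo (λ i → 0 ℕ.+ δ-shift i ℕ.+ column λs i) L) ≡⟨ cong (map dbl) (reverse-cols L 0 λs Dλ) ⟨
    map dbl cs ∎
    where
    double-sum : ∀ c d → dbl c ℕ.+ d ℕ.+ d ≡ dbl (d ℕ.+ c)
    double-sum c d = trans (ℕₚ.+-assoc (dbl c) d d) (trans (cong (dbl c ℕ.+_) (sym (dbl≡+ d)))
      (trans (ℕₚ.+-comm (dbl c) (dbl d)) (sym (dbl-+ d c))))

theorem6p2 : (n : ℕ) → 1 ≤ n → (λs : List ℕ) → IsPartitionOf n λs →
    Σ SymFun λ s → IsSchurIn n λs s ×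
    Σ ℕ λ f → NumSYT (rhoOuter λs) (rhoInner λs) f × ⟨ scaledA n , s ⟩ ≡ ℕ→ℚ f
theorem6p2 n _ λs ((linked , _) , refl) = S.det ts cs , (det-pos ts cs , schur) , f , syt , pairing
  where
  open Rho λs (Linked-Dec≤ λs linked)
  Dλ = Linked-Dec≤ λs linked
  0s = replicate (length λs) 0
  schur : ∀ α → length α ≡ n → Σ ℕ λ k → HasCard (IsSSYT λs α) k × monoCoeff (S.det ts cs) α ≡ ℕ→ℚ k
  schur α _ = tabCount λs L 0s α
    , HasCard-⇔ (λ _ → Tab⇒SSYT) (λ _ → SSYT⇒Tab (replicate-0-Pointwise λs)) (Tab-card λs 0s α Dλ (replicate-0-Dec≤ L (length λs)))
    , trans (det-monoCoeff ts cs α) (sym (tabCount-cols L λs Dλ α 0s (replicate-0-Dec≤ L (length λs)) (length-replicate (length λs))))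
  1s = replicate (dbl n) 1
  f = tabCount (rhoOuter λs) b (rhoInner λs) 1s
  syt : NumSYT (rhoOuter λs) (rhoInner λs) f
  syt = HasCard-⇔ (λ _ → Tab⇒SYT size) (λ _ → SYT⇒Tab size rhoInner≤rhoOuter)
    (Tab-card (rhoOuter λs) (rhoInner λs) 1s rhoOuter-Dec≤ rhoInner-Dec≤)
  pairing : ⟨ scaledA n , S.det ts cs ⟩ ≡ ℕ→ℚ f
  pairing = begin
    ⟨ scaledA n , S.det ts cs ⟩ ≡⟨ scaledA-pairing n (S.det ts cs) (det-pos ts cs) ⟩
    -- The degree 2n is written as the sum of the content of 2n ones, at which `det-weight`
    -- identifies the value under θ with the determinant of doubled coordinates.
    Wt.value (S.det ts cs) (dbl n) ≡⟨ cong (Wt.value (S.det ts cs)) (sum-replicate-1 (dbl n)) ⟨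
    Wt.value (S.det ts cs) (sum 1s) ≡⟨ det-weight ts cs 1s (Allₚ.replicate⁺ (dbl n) ℕₚ.≤-refl) ⟨
    det (map dbl ts) (map dbl cs) 1s ≡⟨ cong₂ (λ us vs → det us vs 1s) rows-rhoInner rows-rhoOuter ⟨
    det (rows L (rhoInner λs)) (rows L (rhoOuter λs)) 1s ≡⟨ tabCount-rows L (rhoOuter λs) length-rhoOuter rhoOuter-Dec≤ (dbl n) (rhoInner λs) rhoInner-Dec≤ length-rhoInner ⟨
    ℕ→ℚ f ∎
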